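{- Let $q=q(n)\ge 2$ be a sequence of integers with $q = o(\sqrt{\log n})$ as $n\to\infty$, and let $\mathcal{H}_n$ be the (random) $q$-uniform hypergraph on $[n]$ obtained when the $q$-linear process on $[n]$ terminates. Then with high probability $$|E(\mathcal{H}_n)| \geq \frac{n(n-1)}{q(q-1)}(1 - o(1)),$$ that is, there is a deterministic sequence $\delta_n\to 0$ such that $\mathbb{P}\left(|E(\mathcal{H}_n)|\ge (1-\delta_n)\frac{n(n-1)}{q(q-1)}\right)\to 1$ as $n\to\infty$.
   Context: $[n]=\{1,\dots,n\}$ and $\binom{[n]}{q}$ is the set of $q$-element subsets of $[n]$. The $q$-linear process on $[n]$: start with the empty $q$-uniform hypergraph on $[n]$. In step $i\ge 1$, given the previously chosen edges $e_1,\dots,e_{i-1}$, pick $e_i$ uniformly at random from the set $\left\{e\in\binom{[n]}{q}: |e\cap e_j|\le 1 \text{ for } 1\le j\le i-1\right\}$ and add it to the hypergraph. The process terminates when this set is empty, and the output is the hypergraph whose edges are all the chosen $e_i$. -}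

module Defs where

open import Data.Bool.Base using (true; false; if_then_else_)
open import Data.Fin.Base using (Fin)
open import Data.Fin.Subset using (Subset; inside; outside; _∩_; ∣_∣)
open import Data.Fin.Subset.Properties using (∩-idem)
open import Data.Integer.Base using (+_)
open import Data.List.Base using (List; []; _∷_; _++_; map; filter; length; lookup)
open import Data.List.Membership.Propositional using (_∈_)
open import Data.List.Membership.Propositional.Properties
  using (∈-map⁺; ∈-map⁻; ∈-++⁺ˡ; ∈-++⁺ʳ; ∈-lookup; ∈-filter⁻)
open import Data.List.Properties using (length-filter)
open import Data.List.Relation.Unary.All as All using (All; []; _∷_; all?)
open import Data.List.Relation.Unary.Any using (here; there)
open import Data.List.Relation.Unary.AllPairs using ([]; _∷_)
open import Data.List.Relation.Unary.Unique.Propositional using (Unique)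
open import Data.List.Relation.Unary.Unique.Propositional.Properties using (map⁺; ++⁺)
open import Data.Nat.Base as ℕ using (ℕ; zero; suc; NonZero; s≤s; z≤n)
open import Data.Nat.Logarithm using (⌊log₂_⌋)
import Data.Nat.Properties as ℕ
open import Data.Product.Base using (∃; _×_; _,_; proj₂)
open import Data.Rational.Base using (ℚ; 0ℚ; 1ℚ; _/_; _*_; _-_; _<_) renaming (∣_∣ to abs)
open import Data.Rational.Properties using (+-0-commutativeMonoid)
open import Data.Vec.Base using ([]; _∷_)
open import Data.Vec.Properties using (∷-injectiveʳ)
open import Relation.Binary.PropositionalEquality
open import Relation.Nullary using (¬_; yes; no; does; contradiction)
open import Relation.Unary using (Decidable)
open import Algebra.Properties.CommutativeMonoid.Sum +-0-commutativeMonoid using (sum)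

-- A finite random experiment: each `draw` continues with one of its `suc k`
-- branches, chosen uniformly at random.
data Random (A : Set) : Set where
  done : A → Random A
  draw : (k : ℕ) → (Fin (suc k) → Random A) → Random A

Pr : {A : Set} {P : A → Set} → Random A → Decidable P → ℚ
Pr (done a)   P? = if does (P? a) then 1ℚ else 0ℚ
Pr (draw k f) P? = (+ 1 / suc k) * sum (λ i → Pr (f i) P?)

Surely : {A : Set} → (A → Set) → Random A → Set
Surely P (done a)   = P a
Surely P (draw k f) = ∀ i → Surely P (f i)

subsets : (n : ℕ) → List (Subset n)
subsets zero    = [] ∷ []
subsets (suc n) = map (inside ∷_) (subsets n) ++ map (outside ∷_) (subsets n)

qSubsets : (n q : ℕ) → List (Subset n)
qSubsets n q = filter (λ e → ∣ e ∣ ℕ.≟ q) (subsets n)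

MeetsAtMostOnce : {n : ℕ} → List (Subset n) → Subset n → Set
MeetsAtMostOnce es e = All (λ f → ∣ e ∩ f ∣ ℕ.≤ 1) es

meetsAtMostOnce? : {n : ℕ} (es : List (Subset n)) → Decidable (MeetsAtMostOnce es)
meetsAtMostOnce? es e = all? (λ f → ∣ e ∩ f ∣ ℕ.≤? 1) es

available : (n q : ℕ) → List (Subset n) → List (Subset n)
available n q es = filter (meetsAtMostOnce? es) (qSubsets n q)

-- The process continued from the chosen edges `es` (latest first) until no
-- edge is available, but for at most `t` further steps.
continue : (n q t : ℕ) → List (Subset n) → Random (List (Subset n))
continue n q zero    es = done es
continue n q (suc t) es with available n q es
... | []     = done es
... | e ∷ as = draw (length as) (λ i → continue n q t (lookup (e ∷ as) i ∷ es))

-- For q ≥ 2 the step bound never cuts the process short and the chosen edges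
-- are distinct, so the length of the outcome is the number of edges: see
-- `linearProcess-terminates` and `linearProcess-unique`.
linearProcess : (n q : ℕ) → Random (List (Subset n))
linearProcess n q = continue n q (length (qSubsets n q)) []

infix 4 _⟶_

_⟶_ : (ℕ → ℚ) → ℚ → Set
a ⟶ l = ∀ ε → 0ℚ < ε → ∃ λ N → ∀ n → N ℕ.≤ n → abs (a n - l) < ε

-- q = o(√log n): for each k ≥ 1, eventually q n ≤ (1/k)√(log₂ n), i.e.
-- (k * q n)² ≤ log₂ n. The floor is harmless as the left side is an integer,
-- and so is the base as k is arbitrary.
_isLittleO-√log : (ℕ → ℕ) → Set
q isLittleO-√log =
  ∀ k → ∃ λ N → ∀ n → N ℕ.≤ n → (k ℕ.* q n) ℕ.^ 2 ℕ.≤ ⌊log₂ n ⌋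

q[q-1]≢0 : ∀ {q} → 2 ℕ.≤ q → NonZero (q ℕ.* (q ℕ.∸ 1))
q[q-1]≢0 (s≤s (s≤s _)) = _

edgeBound : (n q : ℕ) → 2 ℕ.≤ q → ℚ
edgeBound n q 2≤q = _/_ (+ (n ℕ.* (n ℕ.∸ 1))) (q ℕ.* (q ℕ.∸ 1)) {{q[q-1]≢0 2≤q}}

fromℕ : ℕ → ℚ
fromℕ m = + m / 1

subsets-complete : ∀ {n} (e : Subset n) → e ∈ subsets n
subsets-complete []          = here refl
subsets-complete (true ∷ e)  = ∈-++⁺ˡ (∈-map⁺ _ (subsets-complete e))
subsets-complete (false ∷ e) = ∈-++⁺ʳ _ (∈-map⁺ _ (subsets-complete e))

subsets-unique : ∀ n → Unique (subsets n)
subsets-unique zero    = [] ∷ []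
subsets-unique (suc n) =
  ++⁺ (map⁺ ∷-injectiveʳ (subsets-unique n)) (map⁺ ∷-injectiveʳ (subsets-unique n)) disjoint
  where
  disjoint : ∀ {e} → ¬ (e ∈ map (inside ∷_) (subsets n) × e ∈ map (outside ∷_) (subsets n))
  disjoint (p , r) with ∈-map⁻ _ p | ∈-map⁻ _ r
  ... | _ , _ , refl | _ , _ , ()

module _ {A : Set} {P Q : A → Set} (P? : Decidable P) (Q? : Decidable Q)
         (P⇒Q : ∀ {x} → P x → Q x) where

  filter-≤ : ∀ xs → length (filter P? xs) ℕ.≤ length (filter Q? xs)
  filter-≤ []       = z≤n
  filter-≤ (x ∷ xs) with P? x | Q? x
  ... | yes p | yes _ = s≤s (filter-≤ xs)
  ... | yes p | no ¬q = contradiction (P⇒Q p) ¬q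
  ... | no _  | yes _ = ℕ.m≤n⇒m≤1+n (filter-≤ xs)
  ... | no _  | no _  = filter-≤ xs

  filter-< : ∀ {x xs} → x ∈ xs → Q x → ¬ P x →
             length (filter P? xs) ℕ.< length (filter Q? xs)
  filter-< {x} {_ ∷ xs} (here refl) q ¬p with P? x | Q? x
  ... | yes p | _     = contradiction p ¬p
  ... | no _  | yes _ = s≤s (filter-≤ xs)
  ... | no _  | no ¬q = contradiction q ¬q
  filter-< {xs = y ∷ _} (there x∈) q ¬p with P? y | Q? y
  ... | yes p | yes _  = s≤s (filter-< x∈ q ¬p)
  ... | yes p | no ¬q  = contradiction (P⇒Q p) ¬q
  ... | no _  | yes _  = ℕ.m≤n⇒m≤1+n (filter-< x∈ q ¬p)
  ... | no _  | no _   = filter-< x∈ q ¬p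

module _ (n q : ℕ) (2≤q : 2 ℕ.≤ q) where

  edge-self-meets : ∀ {e} → e ∈ qSubsets n q → ¬ (∣ e ∩ e ∣ ℕ.≤ 1)
  edge-self-meets {e} e∈ e∩e≤1 rewrite ∩-idem e
    with refl ← proj₂ (∈-filter⁻ (λ e → ∣ e ∣ ℕ.≟ q) {xs = subsets n} e∈)
    = ℕ.<⇒≱ 2≤q e∩e≤1

  available-shrinks : ∀ es {e} → e ∈ available n q es →
                      length (available n q (e ∷ es)) ℕ.< length (available n q es)
  available-shrinks es {e} e∈
    with e∈q , ok ← ∈-filter⁻ (meetsAtMostOnce? es) {xs = qSubsets n q} e∈
    = filter-< (meetsAtMostOnce? (e ∷ es)) (meetsAtMostOnce? es) All.tail e∈q ok
        (λ bad → edge-self-meets e∈q (All.head bad))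

  continue-terminates : ∀ t es → length (available n q es) ℕ.≤ t →
                        Surely (λ H → available n q H ≡ []) (continue n q t es)
  continue-terminates zero es bound with available n q es
  ... | [] = refl
  continue-terminates (suc t) es bound with available n q es in eq
  ... | []     = eq
  ... | e ∷ as = λ i → continue-terminates t _
    (ℕ.≤-pred (ℕ.≤-trans
      (available-shrinks es (subst (lookup (e ∷ as) i ∈_) (sym eq) (∈-lookup i)))
      (subst (λ xs → length xs ℕ.≤ suc t) (sym eq) bound)))

  linearProcess-terminates : Surely (λ H → available n q H ≡ []) (linearProcess n q)
  linearProcess-terminates =
    continue-terminates _ [] (length-filter (meetsAtMostOnce? []) (qSubsets n q))

  available-new : ∀ es {e} → e ∈ available n q es → All (e ≢_) es
  available-new es e∈
    with e∈q , ok ← ∈-filter⁻ (meetsAtMostOnce? es) {xs = qSubsets n q} e∈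
    = All.map (λ { e∩f≤1 refl → edge-self-meets e∈q e∩f≤1 }) ok

  continue-unique : ∀ t es → Unique es → Surely Unique (continue n q t es)
  continue-unique zero    es u = u
  continue-unique (suc t) es u with available n q es in eq
  ... | []     = u
  ... | e ∷ as = λ i → continue-unique t _
    (available-new es (subst (lookup (e ∷ as) i ∈_) (sym eq) (∈-lookup i)) ∷ u)

  linearProcess-unique : Surely Unique (linearProcess n q)
  linearProcess-unique = continue-unique (length (qSubsets n q)) [] []

-- Regard the process as a random greedy matching in the hypergraph whose vertices are the pairs of
-- points and whose edges are the q-sets, each containing k = q(q-1)/2 pairs.  Let d(x) be the number of
-- available q-sets through an uncovered pair x, let M be the number of uncovered pairs, and let τ follow
-- the deterministic trajectory τ ↦ τ (1 - k(k-1)/M).  The potential V = Σ_x (d(x) - τ)² vanishes at the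
-- start, and by Cauchy-Schwarz its conditional expectation grows in one step by at most a factor
-- 1 + 2kτ/Q, where Q is the number of available q-sets, plus an error that is a factor about q/n below
-- the main scale because codegrees are small.  If Q is less than half of its predicted value Mτ/k
-- then V ≥ Mτ²/4.  As long as this does not happen V is therefore multiplied by at most 1 + 4k²/M per
-- step, so that until a fraction 1/h of the pairs is left it accumulates a factor of order h^{O(k)},
-- which is n^{o(1)} for q = o(√log n).  Markov's inequality for V then shows that the process survives
-- until that moment with high probability.
module Submission where

open import Defs
open import Algebra.Bundles using (CommutativeRing)
import Data.Bool.Properties as Bool
open import Data.Bool.Base using (true; false; if_then_else_)
open import Data.Fin.Base using (Fin; zero; suc)
open import Data.Fin.Subset using (Subset; inside; outside; ∣_∣; _⊆_; _∩_; _∪_; ⊤)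
open import Data.Fin.Subset.Properties
  using ( _⊆?_; ⊆⊤; ⊆-trans; drop-∷-⊆; p⊆p∪q; q⊆p∪q; x∈p∪q⁻; x∈p∩q⁺; p∩q⊆p; p∩q⊆q
        ; ∣p∣≤n; ∣⊤∣≡n; p⊆q⇒∣p∣≤∣q∣; ∣p∣≤∣p∪q∣; ∣q∣≤∣p∪q∣)
import Data.Integer.Base as ℤ
import Data.Integer.Properties as ℤ
open import Data.List.Base using (List; []; _∷_; _++_; map; filter; length; lookup)
open import Data.List.Membership.Propositional using (_∈_)
open import Data.List.Membership.Propositional.Properties using (∈-filter⁻)
open import Data.List.Properties using (length-filter)
open import Data.List.Relation.Unary.All as All using (All; []; _∷_; all?)
open import Data.List.Relation.Unary.AllPairs using ([]; _∷_)
open import Data.List.Relation.Unary.Any using (here; there)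
open import Data.List.Relation.Unary.Unique.Propositional using (Unique)
open import Data.List.Relation.Unary.Unique.Propositional.Properties using (filter⁺)
open import Data.Nat.Base as ℕ using (ℕ; zero; suc; _∸_; NonZero)
import Data.Nat.DivMod as ℕ
open import Data.Nat.Induction using (<-rec)
open import Data.Nat.Logarithm using (⌊log₂_⌋; ⌊log₂⌊n/2⌋⌋≡⌊log₂n⌋∸1)
import Data.Nat.Properties as ℕ
import Data.Nat.Tactic.RingSolver as ℕ
open import Data.Product.Base using (∃; ∃₂; _×_; _,_; proj₁; proj₂)
open import Data.Rational.Base
  using (ℚ; mkℚ; 0ℚ; 1ℚ; _+_; _*_; _-_; -_; _/_; 1/_; _≤_; _<_; Positive; positive; nonNegative; toℚᵘ)
  renaming (∣_∣ to abs; NonZero to ℚ-NonZero)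
open import Data.Rational.Properties
open import Data.Rational.Unnormalised.Base as ℚᵘ using (mkℚᵘ; *≡*; *≤*)
import Data.Rational.Unnormalised.Properties as ℚᵘ
open import Data.Sum.Base using (_⊎_; inj₁; inj₂; [_,_]′)
open import Data.Vec.Base using ([]; _∷_; here)
open import Data.Vec.Properties using (≡-dec)
open import Function.Base using (_∘_)
open import Level using (0ℓ)
open import Relation.Binary.Definitions using (DecidableEquality)
open import Relation.Binary.PropositionalEquality
open import Relation.Nullary using (Dec; yes; no; does; ¬_; ¬?; contradiction)
open import Relation.Nullary.Decidable.Core using (dec⇒maybe)
open import Relation.Unary using (Decidable)
open import Tactic.RingSolver using (solve-∀)
open import Tactic.RingSolver.Core.AlmostCommutativeRing using (AlmostCommutativeRing; fromCommutativeRing)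
open import Algebra.Properties.CommutativeMonoid.Sum +-0-commutativeMonoid using (sum)
open import Algebra.Properties.CommutativeSemiring.Exp
  (CommutativeRing.commutativeSemiring +-*-commutativeRing) using (_^_; ^-distrib-*; ^-homo-*)

-- Inequalities and finite sums of rationals

-- The decrement of τ is chosen so that, summed over all choices of the next edge, every term linear
-- in Σ (d - τ) cancels. The obstacle is the cubic sum Σ d (d - τ)², because a degree may exceed τ
-- by far more than a constant factor. It is split at degree 2kτ, and the part above is charged to
-- the sum of (Σ_{x ∈ c} (d(x) - τ))² over the available q-sets c, which enters the change with
-- coefficient -2. Hence no degree is followed individually. Neither a stopping time nor an
-- exponential is used. Markov's inequality is an invariant, proved by induction on the number of
-- edges still wanted; it is trivial in a state with too few available sets, in particular in a
-- stuck one. Growth is recorded as a power of the ratio of the current to the final number of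
-- uncovered pairs, so all quantities stay rational. With h = 2^s the accumulated factors are at
-- most 2^(O(s q²)), against a gain of n. The choice s = log₂ n / (16 q²), rounded down, makes the
-- failure probability at most 2^(-s), and s tends to infinity exactly when q = o(√log n).

ring : AlmostCommutativeRing 0ℓ 0ℓ
ring = fromCommutativeRing +-*-commutativeRing (λ x → dec⇒maybe (0ℚ ≟ x))

2ℚ : ℚ
2ℚ = 1ℚ + 1ℚ

a≤b⇒0≤b-a : ∀ {a b} → a ≤ b → 0ℚ ≤ b - a
a≤b⇒0≤b-a {a} {b} a≤b = subst (_≤ b - a) (+-inverseʳ a) (+-monoˡ-≤ (- a) a≤b)

≤-by : ∀ {a b c} → 0ℚ ≤ c → b ≡ a + c → a ≤ b
≤-by {a} {b} {c} 0≤c b≡a+c =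
  subst₂ _≤_ (+-identityʳ a) (sym b≡a+c) (+-monoʳ-≤ a 0≤c)

0≤a+b : ∀ {a b} → 0ℚ ≤ a → 0ℚ ≤ b → 0ℚ ≤ a + b
0≤a+b = +-mono-≤

*-monoˡ : ∀ {a b} c → 0ℚ ≤ c → a ≤ b → c * a ≤ c * b
*-monoˡ c 0≤c = *-monoˡ-≤-nonNeg c {{nonNegative 0≤c}}

*-monoʳ : ∀ {a b} c → 0ℚ ≤ c → a ≤ b → a * c ≤ b * c
*-monoʳ c 0≤c = *-monoʳ-≤-nonNeg c {{nonNegative 0≤c}}

0≤a*b : ∀ {a b} → 0ℚ ≤ a → 0ℚ ≤ b → 0ℚ ≤ a * b
0≤a*b {a} {b} 0≤a 0≤b = subst (_≤ a * b) (*-zeroʳ a) (*-monoˡ a 0≤a 0≤b)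

0≤a² : ∀ a → 0ℚ ≤ a * a
0≤a² a with ≤-total 0ℚ a
... | inj₁ 0≤a = 0≤a*b 0≤a 0≤a
... | inj₂ a≤0 = subst (0ℚ ≤_) (eq a) (0≤a*b 0≤-a 0≤-a)
  where
  eq : ∀ a → (0ℚ - a) * (0ℚ - a) ≡ a * a
  eq = solve-∀ ring
  0≤-a : 0ℚ ≤ 0ℚ - a
  0≤-a = a≤b⇒0≤b-a a≤0

0≤1 : 0ℚ ≤ 1ℚ
0≤1 = nonNegative⁻¹ 1ℚ

0≤2 : 0ℚ ≤ 2ℚ
0≤2 = nonNegative⁻¹ 2ℚ

≤+ʳ : ∀ {a b} → 0ℚ ≤ b → a ≤ a + b
≤+ʳ 0≤b = ≤-by 0≤b refl

square-mono : ∀ {a b} → 0ℚ ≤ a → a ≤ b → a * a ≤ b * b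
square-mono {a} {b} 0≤a a≤b = ≤-trans (*-monoˡ a 0≤a a≤b) (*-monoʳ b (≤-trans 0≤a a≤b) a≤b)

private variable
  𝔸 𝔹 : Set

∑ : List 𝔸 → (𝔸 → ℚ) → ℚ
∑ []       f = 0ℚ
∑ (x ∷ xs) f = f x + ∑ xs f

∑-cong∈ : ∀ (xs : List 𝔸) {f g : 𝔸 → ℚ} → (∀ {x} → x ∈ xs → f x ≡ g x) → ∑ xs f ≡ ∑ xs g
∑-cong∈ []       f≡g = refl
∑-cong∈ (x ∷ xs) f≡g = cong₂ _+_ (f≡g (here refl)) (∑-cong∈ xs (λ x∈ → f≡g (there x∈)))

∑-cong : ∀ (xs : List 𝔸) {f g : 𝔸 → ℚ} → (∀ x → f x ≡ g x) → ∑ xs f ≡ ∑ xs g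
∑-cong xs f≡g = ∑-cong∈ xs (λ {x} _ → f≡g x)

∑-mono : ∀ (xs : List 𝔸) {f g : 𝔸 → ℚ} → (∀ {x} → x ∈ xs → f x ≤ g x) → ∑ xs f ≤ ∑ xs g
∑-mono []       f≤g = ≤-refl
∑-mono (x ∷ xs) f≤g = +-mono-≤ (f≤g (here refl)) (∑-mono xs (λ x∈ → f≤g (there x∈)))

∑-zero : ∀ (xs : List 𝔸) → ∑ xs (λ _ → 0ℚ) ≡ 0ℚ
∑-zero []       = refl
∑-zero (x ∷ xs) = trans (+-identityˡ _) (∑-zero xs)

0≤∑ : ∀ (xs : List 𝔸) {f : 𝔸 → ℚ} → (∀ x → 0ℚ ≤ f x) → 0ℚ ≤ ∑ xs f
0≤∑ xs {f} 0≤f = subst (_≤ ∑ xs f) (∑-zero xs) (∑-mono xs (λ {x} _ → 0≤f x))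

term≤∑ : ∀ {xs : List 𝔸} {f : 𝔸 → ℚ} {x} → (∀ y → 0ℚ ≤ f y) → x ∈ xs → f x ≤ ∑ xs f
term≤∑ {xs = _ ∷ xs} 0≤f (here refl) = ≤+ʳ (0≤∑ xs 0≤f)
term≤∑ {xs = y ∷ xs} {f} 0≤f (there x∈) =
  ≤-trans (term≤∑ 0≤f x∈) (≤-by (0≤f y) (+-comm (f y) (∑ xs f)))

∑-+ : ∀ (xs : List 𝔸) (f g : 𝔸 → ℚ) → ∑ xs (λ x → f x + g x) ≡ ∑ xs f + ∑ xs g
∑-+ []       f g = refl
∑-+ (x ∷ xs) f g rewrite ∑-+ xs f g = shuffle (f x) (g x) (∑ xs f) (∑ xs g)
  where
  shuffle : ∀ a b c d → a + b + (c + d) ≡ a + c + (b + d)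
  shuffle = solve-∀ ring

∑-*ˡ : ∀ (xs : List 𝔸) c (f : 𝔸 → ℚ) → ∑ xs (λ x → c * f x) ≡ c * ∑ xs f
∑-*ˡ []       c f = sym (*-zeroʳ c)
∑-*ˡ (x ∷ xs) c f rewrite ∑-*ˡ xs c f = sym (*-distribˡ-+ c (f x) (∑ xs f))

∑-*ʳ : ∀ (xs : List 𝔸) c (f : 𝔸 → ℚ) → ∑ xs (λ x → f x * c) ≡ ∑ xs f * c
∑-*ʳ xs c f = trans (∑-cong xs (λ x → *-comm (f x) c)) (trans (∑-*ˡ xs c f) (*-comm c _))

∑-const : ∀ (xs : List 𝔸) c → ∑ xs (λ _ → c) ≡ ∑ xs (λ _ → 1ℚ) * c
∑-const xs c = trans (∑-cong xs (λ _ → sym (*-identityˡ c))) (∑-*ʳ xs c (λ _ → 1ℚ))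

∑-lin₂ : ∀ (xs : List 𝔸) a f b g →
         ∑ xs (λ x → a * f x + b * g x) ≡ a * ∑ xs f + b * ∑ xs g
∑-lin₂ xs a f b g =
  trans (∑-+ xs (λ x → a * f x) (λ x → b * g x)) (cong₂ _+_ (∑-*ˡ xs a f) (∑-*ˡ xs b g))

∑-lin₃ : ∀ (xs : List 𝔸) a f b g c h →
         ∑ xs (λ x → a * f x + b * g x + c * h x) ≡ a * ∑ xs f + b * ∑ xs g + c * ∑ xs h
∑-lin₃ xs a f b g c h =
  trans (∑-+ xs (λ x → a * f x + b * g x) (λ x → c * h x))
        (cong₂ _+_ (∑-lin₂ xs a f b g) (∑-*ˡ xs c h))

∑-lin₅ : ∀ (xs : List 𝔸) a f b g c h d i e j →
         ∑ xs (λ x → a * f x + b * g x + c * h x + (d * i x + e * j x)) ≡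
         a * ∑ xs f + b * ∑ xs g + c * ∑ xs h + (d * ∑ xs i + e * ∑ xs j)
∑-lin₅ xs a f b g c h d i e j =
  trans (∑-+ xs (λ x → a * f x + b * g x + c * h x) (λ x → d * i x + e * j x))
        (cong₂ _+_ (∑-lin₃ xs a f b g c h) (∑-lin₂ xs d i e j))

∑-swap : ∀ (xs : List 𝔸) (ys : List 𝔹) (f : 𝔸 → 𝔹 → ℚ) →
         ∑ xs (λ x → ∑ ys (f x)) ≡ ∑ ys (λ y → ∑ xs (λ x → f x y))
∑-swap []       ys f = sym (∑-zero ys)
∑-swap (x ∷ xs) ys f rewrite ∑-swap xs ys f = sym (∑-+ ys (f x) (λ y → ∑ xs (λ x → f x y)))

-- Positive parts and zero-one values

opaque
  pos : ℚ → ℚ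
  pos a with ≤-total 0ℚ a
  ... | inj₁ _ = a
  ... | inj₂ _ = 0ℚ

  0≤pos : ∀ a → 0ℚ ≤ pos a
  0≤pos a with ≤-total 0ℚ a
  ... | inj₁ 0≤a = 0≤a
  ... | inj₂ _   = ≤-refl

  a≤pos : ∀ a → a ≤ pos a
  a≤pos a with ≤-total 0ℚ a
  ... | inj₁ 0≤a = ≤-refl
  ... | inj₂ a≤0 = a≤0

  pos²≤ : ∀ a → pos a * pos a ≤ a * a
  pos²≤ a with ≤-total 0ℚ a
  ... | inj₁ 0≤a = ≤-refl
  ... | inj₂ _   = 0≤a² a

  pos-superadditive : ∀ {a b t} → 0ℚ ≤ a → 0ℚ ≤ b → 0ℚ ≤ t → pos (a - t) + pos (b - t) ≤ pos (a + b - t)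
  pos-superadditive {a} {b} {t} 0≤a 0≤b 0≤t with ≤-total 0ℚ (a - t) | ≤-total 0ℚ (b - t)
  ... | inj₁ _ | inj₁ _ = ≤-trans (≤-by 0≤t (eq a b t)) (a≤pos (a + b - t))
    where
    eq : ∀ a b t → a + b - t ≡ a - t + (b - t) + t
    eq = solve-∀ ring
  ... | inj₁ _ | inj₂ _ = ≤-trans (≤-by 0≤b (eq a b t)) (a≤pos (a + b - t))
    where
    eq : ∀ a b t → a + b - t ≡ a - t + 0ℚ + b
    eq = solve-∀ ring
  ... | inj₂ _ | inj₁ _ = ≤-trans (≤-by 0≤a (eq a b t)) (a≤pos (a + b - t))
    where
    eq : ∀ a b t → a + b - t ≡ 0ℚ + (b - t) + a
    eq = solve-∀ ring
  ... | inj₂ _ | inj₂ _ = 0≤pos (a + b - t)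

IsBit : ℚ → Set
IsBit a = a ≡ 0ℚ ⊎ a ≡ 1ℚ

bit≥0 : ∀ {a} → IsBit a → 0ℚ ≤ a
bit≥0 (inj₁ refl) = ≤-refl
bit≥0 (inj₂ refl) = 0≤1

bit≤1 : ∀ {a} → IsBit a → a ≤ 1ℚ
bit≤1 (inj₁ refl) = 0≤1
bit≤1 (inj₂ refl) = ≤-refl

bit² : ∀ {a} → IsBit a → a * a ≡ a
bit² (inj₁ refl) = refl
bit² (inj₂ refl) = refl

-- Each term on the left subtracts its own threshold while the right side subtracts only one, so
-- this is `pos-superadditive` iterated. It compares the truncated degrees within one edge with
-- their sum, truncated at the same level.
∑-pos : ∀ (xs : List 𝔸) {i f : 𝔸 → ℚ} {t} → (∀ x → IsBit (i x)) → (∀ x → 0ℚ ≤ f x) → 0ℚ ≤ t →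
        ∑ xs (λ x → i x * pos (f x - t)) ≤ pos (∑ xs (λ x → i x * f x) - t)
∑-pos []       {t = t} bit 0≤f 0≤t = 0≤pos (0ℚ - t)
∑-pos (x ∷ xs) {i} {f} {t} bit 0≤f 0≤t with i x | bit x
... | _ | inj₁ refl = subst₂ (λ u v → u ≤ pos (v - t))
  (sym (zero* (pos (f x - t)) _)) (sym (zero* (f x) _)) (∑-pos xs bit 0≤f 0≤t)
  where
  zero* : ∀ a b → 0ℚ * a + b ≡ b
  zero* = solve-∀ ring
... | _ | inj₂ refl = ≤-trans
  (+-mono-≤ (≤-reflexive (*-identityˡ (pos (f x - t)))) (∑-pos xs bit 0≤f 0≤t))
  (≤-trans (pos-superadditive (0≤f x) (0≤∑ xs (λ y → 0≤a*b (bit≥0 (bit y)) (0≤f y))) 0≤t)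
    (≤-reflexive (cong (λ v → pos (v + _ - t)) (sym (*-identityˡ (f x))))))

∑²≤ : ∀ (xs : List 𝔸) {f : 𝔸 → ℚ} → (∀ x → 0ℚ ≤ f x) →
      ∑ xs (λ x → f x * f x) ≤ ∑ xs f * ∑ xs f
∑²≤ []       0≤f = ≤-refl
∑²≤ (x ∷ xs) {f} 0≤f = ≤-trans (+-monoʳ-≤ (f x * f x) (∑²≤ xs 0≤f))
  (≤-by (0≤a*b 0≤2 (0≤a*b (0≤f x) (0≤∑ xs 0≤f))) (eq (f x) (∑ xs f)))
  where
  eq : ∀ a b → (a + b) * (a + b) ≡ a * a + b * b + (1ℚ + 1ℚ) * (a * b)
  eq = solve-∀ ring

-- One step of a random greedy matching

module Hypergraph {X C : Set} (I : X → C → ℚ) (U : List X) (A : List C) where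

  d : X → ℚ
  d x = ∑ A (λ c → I x c)

  size : ℚ
  size = ∑ A (λ _ → 1ℚ)

  order : ℚ
  order = ∑ U (λ _ → 1ℚ)

  deviation : ℚ → ℚ
  deviation τ = ∑ U (λ x → (d x - τ) * (d x - τ))

  common : C → C → ℚ
  common c e = ∑ U (λ y → I y c * I y e)

module _ {X C : Set} (I : X → C → ℚ) (bit : ∀ x c → IsBit (I x c)) (U : List X) (A : List C) where
  open Hypergraph I U A

  private
    0≤I : ∀ x c → 0ℚ ≤ I x c
    0≤I x c = bit≥0 (bit x c)

  0≤d : ∀ x → 0ℚ ≤ d x
  0≤d x = 0≤∑ A (λ c → 0≤I x c)

  ∑-incidence : ∀ (f : X → ℚ) → ∑ A (λ c → ∑ U (λ x → I x c * f x)) ≡ ∑ U (λ x → d x * f x)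
  ∑-incidence f = trans (∑-swap A U (λ c x → I x c * f x))
    (∑-cong U (λ x → ∑-*ʳ A (f x) (λ c → I x c)))

  -- u is 1 / order, τ - σ is the value of τ after the step, and K bounds the sum of the codegrees of
  -- a vertex with the other vertices of an edge.
  module OneStep
    (k D K τ u : ℚ) (J : C → C → ℚ)
    (uniform : ∀ {c} → c ∈ A → ∑ U (λ x → I x c) ≡ k)
    (degree≤ : ∀ {x} → x ∈ U → d x ≤ D)
    (meet≤ : ∀ {x e} → x ∈ U → e ∈ A → ∑ A (λ c → I x c * common c e) ≤ I x e * d x + K)
    (0≤J : ∀ c e → 0ℚ ≤ J c e)
    (J≤common : ∀ {c e} → c ∈ A → e ∈ A → J c e ≤ common c e)
    (common≤J : ∀ {c e} → c ∈ A → e ∈ A → common c e - J c e ≤ common c e * common c e - common c e)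
    (1≤k : 1ℚ ≤ k) (0≤D : 0ℚ ≤ D) (0≤K : 0ℚ ≤ K) (0≤τ : 0ℚ ≤ τ) (0≤u : 0ℚ ≤ u)
    (order*u≡1 : order * u ≡ 1ℚ)
    where

    ω σ : ℚ
    ω = k * τ * u
    σ = (k - 1ℚ) * ω

    loss : X → C → ℚ
    loss x e = ∑ A (λ c → I x c * J c e)

    deviation′ : C → ℚ
    deviation′ e = ∑ U (λ x → (1ℚ - I x e) * ((d x - loss x e - (τ - σ)) * (d x - loss x e - (τ - σ))))

    private
      0≤k-1 : 0ℚ ≤ k - 1ℚ
      0≤k-1 = a≤b⇒0≤b-a 1≤k

      0≤k : 0ℚ ≤ k
      0≤k = ≤-trans 0≤1 1≤k

      0≤ω : 0ℚ ≤ ω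
      0≤ω = 0≤a*b (0≤a*b 0≤k 0≤τ) 0≤u

      0≤σ : 0ℚ ≤ σ
      0≤σ = 0≤a*b 0≤k-1 0≤ω

      s : C → C → ℚ
      s = common

      m : X → C → ℚ
      m x e = ∑ A (λ c → I x c * s c e)

      ζ : X → ℚ
      ζ x = d x - τ

      B h : C → ℚ
      B c = ∑ U (λ x → I x c * d x)
      h c = ∑ U (λ x → I x c * ζ x)

      Q M V P L T H : ℚ
      Q = size
      M = order
      V = deviation τ
      P = ∑ U ζ
      L = ∑ U (λ x → d x * ζ x)
      T = ∑ U (λ x → d x * (ζ x * ζ x))
      H = ∑ A (λ c → h c * h c)

      κ : X → C → ℚ
      κ x e = m x e - I x e * d x

      0≤loss : ∀ x e → 0ℚ ≤ loss x e
      0≤loss x e = 0≤∑ A (λ c → 0≤a*b (0≤I x c) (0≤J c e))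

      loss≤m : ∀ {x e} → e ∈ A → loss x e ≤ m x e
      loss≤m {x} e∈ = ∑-mono A (λ {c} c∈ → *-monoˡ (I x c) (0≤I x c) (J≤common c∈ e∈))

      d≤m : ∀ {x e} → x ∈ U → I x e ≡ 1ℚ → d x ≤ m x e
      d≤m {x} {e} x∈ i≡1 = ∑-mono A λ {c} _ → ≤-trans
        (≤-reflexive (trans (sym (bit² (bit x c))) (cong (I x c *_)
          (trans (sym (*-identityʳ (I x c))) (cong (I x c *_) (sym i≡1))))))
        (*-monoˡ (I x c) (0≤I x c)
          (term≤∑ {f = λ y → I y c * I y e} (λ y → 0≤a*b (0≤I y c) (0≤I y e)) x∈))

      0≤D-ζ : ∀ {x} → x ∈ U → 0ℚ ≤ D - ζ x
      0≤D-ζ {x} x∈ = a≤b⇒0≤b-a (≤-trans (≤-by 0≤τ (eq (d x) τ)) (degree≤ x∈))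
        where
        eq : ∀ a b → a ≡ a - b + b
        eq = solve-∀ ring

      -- `D` replaces `ζ x` where `loss` is exchanged for `κ`, whose sum over `e` can be computed
      -- exactly, and `K * κ x e` pays for the squared loss. The last term makes up for
      -- `2ℚ * (σ * ζ x)` at the vertices of `e`, where `ζ x` can be as low as `- τ`.
      noise : X → C → ℚ
      noise x e = 2ℚ * D * (κ x e - (1ℚ - I x e) * loss x e) + K * κ x e + σ * σ + 2ℚ * (σ * τ) * I x e

      main : X → C → ℚ
      main x e = (1ℚ - I x e) * (ζ x * ζ x) - 2ℚ * (ζ x * κ x e) + 2ℚ * (σ * ζ x)

      -- At a surviving vertex this expands the square; at a vertex of e the left side vanishes.
      pointwise : ∀ {x e} → x ∈ U → e ∈ A →
        (1ℚ - I x e) * ((d x - loss x e - (τ - σ)) * (d x - loss x e - (τ - σ))) ≤ main x e + noise x e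
      pointwise {x} {e} x∈ e∈ with I x e in i≡ | bit x e
      ... | _ | inj₁ refl = ≤-by
        (0≤a+b (0≤a+b (0≤a+b (0≤a*b (0≤a*b 0≤2 (0≤D-ζ x∈)) 0≤m-l) (0≤a*b 0≤K 0≤m-l))
          (0≤a*b (0≤loss x e) 0≤K-l)) (0≤a*b (0≤a*b 0≤2 (0≤loss x e)) 0≤σ))
        (eq (d x) (loss x e) τ σ (m x e) D K)
        where
        eq : ∀ δ l τ σ m D K →
          (1ℚ - 0ℚ) * ((δ - τ) * (δ - τ)) - (1ℚ + 1ℚ) * ((δ - τ) * (m - 0ℚ * δ)) + (1ℚ + 1ℚ) * (σ * (δ - τ)) +
          ((1ℚ + 1ℚ) * D * (m - 0ℚ * δ - (1ℚ - 0ℚ) * l) + K * (m - 0ℚ * δ) + σ * σ + (1ℚ + 1ℚ) * (σ * τ) * 0ℚ) ≡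
          (1ℚ - 0ℚ) * ((δ - l - (τ - σ)) * (δ - l - (τ - σ))) +
          ((1ℚ + 1ℚ) * (D - (δ - τ)) * (m - l) + K * (m - l) + l * (K - l) + (1ℚ + 1ℚ) * l * σ)
        eq = solve-∀ ring
        0≤m-l : 0ℚ ≤ m x e - loss x e
        0≤m-l = a≤b⇒0≤b-a (loss≤m e∈)
        0≤K-l : 0ℚ ≤ K - loss x e
        0≤K-l = a≤b⇒0≤b-a (≤-trans (loss≤m e∈) (≤-trans (meet≤ x∈ e∈) (≤-reflexive
          (trans (cong (λ i → i * d x + K) i≡) (trans (cong (_+ K) (*-zeroˡ (d x))) (+-identityˡ K))))))
      ... | _ | inj₂ refl = ≤-by
        (0≤a+b (0≤a+b (0≤a+b (0≤a*b (0≤a*b 0≤2 (0≤D-ζ x∈)) 0≤κ) (0≤a*b 0≤K 0≤κ)) (0≤a² σ))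
          (0≤a*b (0≤a*b 0≤2 0≤σ) (0≤d x)))
        (eq (d x) (loss x e) τ σ (m x e) D K)
        where
        eq : ∀ δ l τ σ m D K →
          (1ℚ - 1ℚ) * ((δ - τ) * (δ - τ)) - (1ℚ + 1ℚ) * ((δ - τ) * (m - 1ℚ * δ)) + (1ℚ + 1ℚ) * (σ * (δ - τ)) +
          ((1ℚ + 1ℚ) * D * (m - 1ℚ * δ - (1ℚ - 1ℚ) * l) + K * (m - 1ℚ * δ) + σ * σ + (1ℚ + 1ℚ) * (σ * τ) * 1ℚ) ≡
          (1ℚ - 1ℚ) * ((δ - l - (τ - σ)) * (δ - l - (τ - σ))) +
          ((1ℚ + 1ℚ) * (D - (δ - τ)) * (m - δ) + K * (m - δ) + σ * σ + (1ℚ + 1ℚ) * σ * δ)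
        eq = solve-∀ ring
        0≤κ : 0ℚ ≤ m x e - d x
        0≤κ = a≤b⇒0≤b-a (d≤m x∈ i≡)

      ∑I*d : ∀ {c} → c ∈ A → B c ≡ h c + k * τ
      ∑I*d {c} c∈ = trans (∑-cong U (λ x → eq (I x c) (d x) τ))
        (trans (∑-+ U (λ x → I x c * ζ x) (λ x → I x c * τ))
          (cong (h c +_) (trans (∑-*ʳ U τ (λ x → I x c)) (cong (_* τ) (uniform c∈)))))
        where
        eq : ∀ i a t → i * a ≡ i * (a - t) + i * t
        eq = solve-∀ ring

      B≤kD : ∀ {c} → c ∈ A → B c ≤ k * D
      B≤kD {c} c∈ = ≤-trans (∑-mono U (λ {x} x∈ → *-monoˡ (I x c) (0≤I x c) (degree≤ x∈)))
        (≤-reflexive (trans (∑-*ʳ U D (λ x → I x c)) (cong (_* D) (uniform c∈))))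

      ∑s : ∀ e → ∑ A (λ c → s c e) ≡ B e
      ∑s e = trans (∑-swap A U (λ c y → I y c * I y e))
        (∑-cong U (λ y → trans (∑-*ʳ A (I y e) (λ c → I y c)) (*-comm (d y) (I y e))))

      ∑s′ : ∀ c → ∑ A (λ e → s c e) ≡ B c
      ∑s′ c = trans (∑-swap A U (λ e y → I y c * I y e))
        (∑-cong U (λ y → ∑-*ˡ A (I y c) (λ e → I y e)))

      ∑m : ∀ x → ∑ A (λ e → m x e) ≡ ∑ A (λ c → I x c * B c)
      ∑m x = trans (∑-swap A A (λ e c → I x c * s c e))
        (∑-cong A (λ c → trans (∑-*ˡ A (I x c) (λ e → s c e)) (cong (I x c *_) (∑s′ c))))

      ∑U-incidence : ∀ (f : C → ℚ) → ∑ U (λ x → ∑ A (λ c → I x c * f c)) ≡ k * ∑ A f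
      ∑U-incidence f = trans (∑-swap U A (λ x c → I x c * f c)) (trans
        (∑-cong∈ A (λ {c} c∈ → trans (∑-*ʳ U (f c) (λ x → I x c)) (cong (_* f c) (uniform c∈))))
        (∑-*ˡ A k f))

      ∑Im : ∀ e → ∑ U (λ x → I x e * m x e) ≡ ∑ A (λ c → s c e * s c e)
      ∑Im e = trans (∑-cong U (λ x → sym (∑-*ˡ A (I x e) (λ c → I x c * s c e))))
        (trans (∑-swap U A (λ x c → I x e * (I x c * s c e)))
          (∑-cong A (λ c → trans (∑-cong U (λ x → eq (I x e) (I x c) (s c e)))
            (∑-*ʳ U (s c e) (λ x → I x c * I x e)))))
        where
        eq : ∀ a b c → a * (b * c) ≡ b * a * c
        eq = solve-∀ ring

      ∑s²≤ : ∀ {e} → e ∈ A → ∑ A (λ c → s c e * s c e) ≤ B e + k * K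
      ∑s²≤ {e} e∈ = ≤-trans (≤-reflexive (sym (∑Im e)))
        (≤-trans (∑-mono U (λ {x} x∈ → *-monoˡ (I x e) (0≤I x e) (meet≤ x∈ e∈)))
          (≤-reflexive (trans (∑-cong U (λ x → trans (eq (I x e) (d x) K)
            (cong (λ i → i * d x + I x e * K) (bit² (bit x e)))))
            (trans (∑-+ U (λ x → I x e * d x) (λ x → I x e * K))
              (cong (B e +_) (trans (∑-*ʳ U K (λ x → I x e)) (cong (_* K) (uniform e∈))))))))
        where
        eq : ∀ i a K → i * (i * a + K) ≡ i * i * a + i * K
        eq = solve-∀ ring

      excess : C → ℚ
      excess e = ∑ A (λ c → s c e - J c e)

      -- Each summand is at most `s² - s`, which vanishes when `c` and `e` share exactly one vertex.
      -- The sum of `s²` is the sum of `m x e` over the `k` vertices of `e`, so `meet≤` leaves at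
      -- most `k * K` beyond `B e`, which is the sum of `s`.
      excess≤ : ∀ {e} → e ∈ A → excess e ≤ k * K
      excess≤ {e} e∈ = ≤-trans (∑-mono A (λ c∈ → common≤J c∈ e∈))
        (≤-trans (≤-reflexive (trans (∑-cong A (λ c → eq (s c e * s c e) (s c e)))
          (∑-lin₂ A 1ℚ (λ c → s c e * s c e) (- 1ℚ) (λ c → s c e))))
          (≤-by (a≤b⇒0≤b-a (∑s²≤ e∈))
            (subst (λ b → k * K ≡ 1ℚ * S + - 1ℚ * b + (B e + k * K - S)) (sym (∑s e)) (eq′ (B e) (k * K) S))))
        where
        eq : ∀ a b → a - b ≡ 1ℚ * a + - 1ℚ * b
        eq = solve-∀ ring
        S : ℚ
        S = ∑ A (λ c → s c e * s c e)
        eq′ : ∀ b c a → c ≡ 1ℚ * a + - 1ℚ * b + (b + c - a)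
        eq′ = solve-∀ ring

      kQ : Q * k ≡ P + M * τ
      kQ = trans (sym (∑-const A k)) (trans (∑-cong∈ A (λ {c} c∈ → sym
        (trans (∑-cong U (λ x → *-identityʳ (I x c))) (uniform c∈))))
        (trans (∑-incidence (λ _ → 1ℚ)) (trans (∑-cong U (λ x → shift (d x) τ))
          (trans (∑-+ U ζ (λ _ → τ)) (cong (P +_) (∑-const U τ))))))
        where
        shift : ∀ a t → a * 1ℚ ≡ a - t + t
        shift = solve-∀ ring

      -- By `kQ`, the total decrement over all choices is `(k - 1ℚ) * τ * τ` plus a correction
      -- linear in `P`. Multiplied by `2ℚ * P`, the former cancels the linear terms of `∑main`, and
      -- the latter is what Cauchy-Schwarz controls.
      σ*Q : σ * Q ≡ (k - 1ℚ) * τ * (u * P + τ)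
      σ*Q = trans (eq k τ u Q) (trans (cong (λ a → (k - 1ℚ) * τ * u * a) kQ) (trans (eq′ k τ u P M)
        (trans (cong (λ a → (k - 1ℚ) * τ * (u * P + a * τ)) order*u≡1)
          (cong (λ a → (k - 1ℚ) * τ * (u * P + a)) (*-identityˡ τ)))))
        where
        eq : ∀ k τ u Q → (k - 1ℚ) * (k * τ * u) * Q ≡ (k - 1ℚ) * τ * u * (Q * k)
        eq = solve-∀ ring
        eq′ : ∀ k τ u P M → (k - 1ℚ) * τ * u * (P + M * τ) ≡ (k - 1ℚ) * τ * (u * P + M * u * τ)
        eq′ = solve-∀ ring

      M*σ : M * σ ≡ (k - 1ℚ) * k * τ
      M*σ = trans (eq M k τ u) (trans (cong ((k - 1ℚ) * k * τ *_) order*u≡1) (*-identityʳ _))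
        where
        eq : ∀ M k τ u → M * ((k - 1ℚ) * (k * τ * u)) ≡ (k - 1ℚ) * k * τ * (M * u)
        eq = solve-∀ ring

      L≡ : L ≡ V + τ * P
      L≡ = trans (∑-cong U (λ x → eq (d x) τ)) (trans (∑-+ U (λ x → ζ x * ζ x) (λ x → τ * ζ x))
        (cong (V +_) (∑-*ˡ U τ ζ)))
        where
        eq : ∀ a t → a * (a - t) ≡ (a - t) * (a - t) + t * (a - t)
        eq = solve-∀ ring

      ∑h : ∑ A h ≡ L
      ∑h = ∑-incidence ζ

      truncated : X → ℚ
      truncated x = pos (d x - k * τ)

      -- Above degree `2kτ` one has `ζ² ≤ d²`, and `d (d - kτ)² = d² (d - 2kτ) + d (kτ)²`. The split
      -- lies at twice the truncation level to make this expansion fit.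
      cube≤ : ∀ x → d x * (ζ x * ζ x) ≤ 2ℚ * k * τ * (ζ x * ζ x) + d x * (truncated x * truncated x)
      cube≤ x with ≤-total (d x) (2ℚ * k * τ)
      ... | inj₁ small = ≤-trans (*-monoʳ (ζ x * ζ x) (0≤a² (ζ x)) small)
        (≤+ʳ (0≤a*b (0≤d x) (0≤a² (truncated x))))
      ... | inj₂ large = ≤-trans
        (≤-by (0≤a+b (0≤a*b (0≤d x) (0≤a² (k * τ)))
            (0≤a*b (a≤b⇒0≤b-a large) (0≤a*b 0≤τ
              (0≤a+b (0≤a+b (0≤d x) (a≤b⇒0≤b-a large)) (0≤a+b (0≤a*b 0≤k-1 0≤τ) (0≤a*b 0≤k 0≤τ))))))
          (eq (d x) τ k))
        (+-monoʳ-≤ (2ℚ * k * τ * (ζ x * ζ x)) (*-monoˡ (d x) (0≤d x) (square-mono 0≤d-kτ (a≤pos (d x - k * τ)))))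
        where
        eq : ∀ a t k → (1ℚ + 1ℚ) * k * t * ((a - t) * (a - t)) + a * ((a - k * t) * (a - k * t)) ≡
          a * ((a - t) * (a - t)) + (a * (k * t * (k * t)) +
          (a - (1ℚ + 1ℚ) * k * t) * (t * (a + (a - (1ℚ + 1ℚ) * k * t) + ((k - 1ℚ) * t + k * t))))
        eq = solve-∀ ring
        0≤d-kτ : 0ℚ ≤ d x - k * τ
        0≤d-kτ = subst (0ℚ ≤_) (eq′ (d x) k τ) (0≤a+b (a≤b⇒0≤b-a large) (0≤a*b 0≤k 0≤τ))
          where
          eq′ : ∀ a k t → a - (1ℚ + 1ℚ) * k * t + k * t ≡ a - k * t
          eq′ = solve-∀ ring

      ∑truncated²≤ : ∀ {c} → c ∈ A → ∑ U (λ x → I x c * (truncated x * truncated x)) ≤ h c * h c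
      ∑truncated²≤ {c} c∈ = ≤-trans
        (≤-reflexive (∑-cong U (λ x → trans (cong (_* (truncated x * truncated x)) (sym (bit² (bit x c))))
          (eq (I x c) (truncated x)))))
        (≤-trans (∑²≤ U (λ x → 0≤a*b (0≤I x c) (0≤pos (d x - k * τ))))
          (≤-trans (square-mono (0≤∑ U (λ x → 0≤a*b (0≤I x c) (0≤pos (d x - k * τ))))
              (∑-pos U (λ x → bit x c) 0≤d (0≤a*b 0≤k 0≤τ)))
            (≤-trans (pos²≤ (B c - k * τ)) (≤-reflexive (cong₂ _*_ B-kτ B-kτ)))))
        where
        eq : ∀ i w → i * i * (w * w) ≡ i * w * (i * w)
        eq = solve-∀ ring
        eq′ : ∀ a b → a + b - b ≡ a
        eq′ = solve-∀ ring
        B-kτ : B c - k * τ ≡ h c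
        B-kτ = trans (cong (_- k * τ) (∑I*d c∈)) (eq′ (h c) (k * τ))

      -- Vertices of degree above 2kτ are paid for by H, since within an edge c the truncations of
      -- their degrees sum to at most (B c - kτ)₊ and B c - kτ = h c.
      T≤ : T ≤ 2ℚ * k * τ * V + H
      T≤ = ≤-trans (∑-mono U (λ {x} _ → cube≤ x))
        (≤-trans (≤-reflexive (trans (∑-+ U (λ x → 2ℚ * k * τ * (ζ x * ζ x))
          (λ x → d x * (truncated x * truncated x)))
            (cong₂ _+_ (∑-*ˡ U (2ℚ * k * τ) (λ x → ζ x * ζ x))
              (sym (∑-incidence (λ x → truncated x * truncated x))))))
          (+-monoʳ-≤ (2ℚ * k * τ * V) (∑-mono A ∑truncated²≤)))

      -- The gap is the sum of the squared deviations of `ζ` from its mean `P * u`.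
      uP²≤V : u * (P * P) ≤ V
      uP²≤V = ≤-by (0≤∑ U (λ x → 0≤a² (ζ x - P * u)))
        (sym (trans (cong (u * (P * P) +_) (trans (∑-cong U (λ x → eq (ζ x) (P * u)))
            (∑-lin₃ U 1ℚ (λ x → ζ x * ζ x) (- (2ℚ * (P * u))) ζ (P * u * (P * u)) (λ _ → 1ℚ))))
          (trans (eq′ u P V M) (trans (cong (λ a → V + (a - 1ℚ) * (u * (P * P))) order*u≡1)
            (eq″ V (u * (P * P)))))))
        where
        eq : ∀ z t → (z - t) * (z - t) ≡ 1ℚ * (z * z) + - ((1ℚ + 1ℚ) * t) * z + t * t * 1ℚ
        eq = solve-∀ ring
        eq′ : ∀ u P V M → u * (P * P) + (1ℚ * V + - ((1ℚ + 1ℚ) * (P * u)) * P + P * u * (P * u) * M) ≡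
                          V + (M * u - 1ℚ) * (u * (P * P))
        eq′ = solve-∀ ring
        eq″ : ∀ V a → V + (1ℚ - 1ℚ) * a ≡ V
        eq″ = solve-∀ ring

      G : ℚ
      G = ∑ U (λ x → ζ x * ∑ A (λ c → I x c * B c))

      -- Exchanging the sums turns `G` into the sum of `h c * B c`, and `B c` is `h c + k * τ`. The
      -- square that splits off is the negative feedback needed against `T`.
      G≡ : G ≡ H + k * τ * L
      G≡ = trans (∑-cong U (λ x → sym (∑-*ˡ A (ζ x) (λ c → I x c * B c))))
        (trans (∑-swap U A (λ x c → ζ x * (I x c * B c)))
        (trans (∑-cong∈ A (λ {c} c∈ → trans (∑-cong U (λ x → eq (ζ x) (I x c) (B c)))
            (trans (∑-*ʳ U (B c) (λ x → I x c * ζ x)) (trans (cong (h c *_) (∑I*d c∈)) (eq′ (h c) (k * τ))))))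
        (trans (∑-+ A (λ c → h c * h c) (λ c → k * τ * h c))
          (cong (H +_) (trans (∑-*ˡ A (k * τ) h) (cong (k * τ *_) ∑h))))))
        where
        eq : ∀ z i b → z * (i * b) ≡ i * z * b
        eq = solve-∀ ring
        eq′ : ∀ h t → h * (h + t) ≡ h * h + t * h
        eq′ = solve-∀ ring

      ∑main : ∑ A (λ e → ∑ U (λ x → main x e)) ≡ Q * V + 2ℚ * (σ * Q) * P + 1ℚ * T + (2ℚ * τ * L + - 2ℚ * G)
      ∑main = trans (∑-swap A U (λ e x → main x e)) (trans (∑-cong U inner)
        (∑-lin₅ U Q (λ x → ζ x * ζ x) (2ℚ * (σ * Q)) ζ 1ℚ (λ x → d x * (ζ x * ζ x)) (2ℚ * τ) (λ x → d x * ζ x)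
          (- 2ℚ) (λ x → ζ x * ∑ A (λ c → I x c * B c))))
        where
        eq : ∀ i δ τ m σ → (1ℚ - i) * ((δ - τ) * (δ - τ)) - (1ℚ + 1ℚ) * ((δ - τ) * (m - i * δ)) + (1ℚ + 1ℚ) *
          (σ * (δ - τ)) ≡
          ((δ - τ) * (δ - τ) + (1ℚ + 1ℚ) * (σ * (δ - τ))) * 1ℚ +
            ((1ℚ + 1ℚ) * ((δ - τ) * δ) - (δ - τ) * (δ - τ)) * i + - ((1ℚ + 1ℚ) * (δ - τ)) * m
        eq = solve-∀ ring
        eq′ : ∀ δ τ σ Q b →
          ((δ - τ) * (δ - τ) + (1ℚ + 1ℚ) * (σ * (δ - τ))) * Q +
            ((1ℚ + 1ℚ) * ((δ - τ) * δ) - (δ - τ) * (δ - τ)) * δ + - ((1ℚ + 1ℚ) * (δ - τ)) * b ≡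
          Q * ((δ - τ) * (δ - τ)) + (1ℚ + 1ℚ) * (σ * Q) * (δ - τ) + 1ℚ * (δ * ((δ - τ) * (δ - τ))) +
            ((1ℚ + 1ℚ) * τ * (δ * (δ - τ)) + - (1ℚ + 1ℚ) * ((δ - τ) * b))
        eq′ = solve-∀ ring
        inner : ∀ x → ∑ A (main x) ≡ Q * (ζ x * ζ x) + 2ℚ * (σ * Q) * ζ x + 1ℚ * (d x * (ζ x * ζ x)) +
                  (2ℚ * τ * (d x * ζ x) + - 2ℚ * (ζ x * ∑ A (λ c → I x c * B c)))
        inner x = trans (∑-cong A (λ e → eq (I x e) (d x) τ (m x e) σ))
          (trans (∑-lin₃ A (ζ x * ζ x + 2ℚ * (σ * ζ x)) (λ _ → 1ℚ) (2ℚ * (ζ x * d x) - ζ x * ζ x) (I x)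
            (- (2ℚ * ζ x)) (m x))
          (trans (cong (λ a → (ζ x * ζ x + 2ℚ * (σ * ζ x)) * Q + (2ℚ * (ζ x * d x) - ζ x * ζ x) * d x + -
            (2ℚ * ζ x) * a) (∑m x))
            (eq′ (d x) τ σ Q (∑ A (λ c → I x c * B c)))))

      -- After substitution the sum is `Q V + T - 2H - 2(k - 1)τ(V - u P²)`. One `H` absorbs the
      -- large degrees in `T≤`, and the last bracket is nonnegative by `uP²≤V`.
      ∑main≤ : ∑ A (λ e → ∑ U (λ x → main x e)) ≤ (Q + 2ℚ * k * τ) * V
      ∑main≤ = ≤-by (0≤a+b (0≤a+b (a≤b⇒0≤b-a T≤) 0≤H) (0≤a*b (0≤a*b (0≤a*b 0≤2 0≤k-1) 0≤τ) (a≤b⇒0≤b-a uP²≤V)))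
        (trans (eq Q V k τ P u T H) (cong (_+ (2ℚ * k * τ * V + H - T + H + 2ℚ * (k - 1ℚ) * τ * (V - u * (P * P))))
          (sym (trans ∑main (cong₂ (λ a b → Q * V + 2ℚ * a * P + 1ℚ * T + b) σ*Q
            (cong₂ (λ a b → 2ℚ * τ * a + - 2ℚ * b) L≡ (trans G≡ (cong (λ a → H + k * τ * a) L≡))))))))
        where
        0≤H : 0ℚ ≤ H
        0≤H = 0≤∑ A (λ c → 0≤a² (h c))
        eq : ∀ Q V k τ P u T H → (Q + (1ℚ + 1ℚ) * k * τ) * V ≡
          Q * V + (1ℚ + 1ℚ) * ((k - 1ℚ) * τ * (u * P + τ)) * P + 1ℚ * T +
          ((1ℚ + 1ℚ) * τ * (V + τ * P) + - (1ℚ + 1ℚ) * (H + k * τ * (V + τ * P))) +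
          ((1ℚ + 1ℚ) * k * τ * V + H - T + H + (1ℚ + 1ℚ) * (k - 1ℚ) * τ * (V - u * (P * P)))
        eq = solve-∀ ring

    -- A bound for the noise of one choice. Its two parts round up `(3k² + k) K D`, caused by
    -- overlapping edges, and `k² (k² - 1) τ² u`, caused by the terms with `σ`.
    ν : ℚ
    ν = (1ℚ + 1ℚ + 1ℚ + 1ℚ + 1ℚ) * (k * k) * K * D + k * k * (k * k) * (τ * τ * u)

    private
      ∑κ : ∀ {e} → e ∈ A → ∑ U (λ x → κ x e) ≡ (k - 1ℚ) * B e
      ∑κ {e} e∈ = trans (∑-cong U (λ x → eq (m x e) (I x e * d x)))
        (trans (∑-lin₂ U 1ℚ (λ x → m x e) (- 1ℚ) (λ x → I x e * d x))
        (trans (cong (λ a → 1ℚ * a + - 1ℚ * B e) (trans (∑U-incidence (λ c → s c e)) (cong (k *_) (∑s e))))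
          (eq′ k (B e))))
        where
        eq : ∀ a b → a - b ≡ 1ℚ * a + - 1ℚ * b
        eq = solve-∀ ring
        eq′ : ∀ k b → 1ℚ * (k * b) + - 1ℚ * b ≡ (k - 1ℚ) * b
        eq′ = solve-∀ ring

      overcount : X → C → ℚ
      overcount x e = κ x e - (1ℚ - I x e) * loss x e

      -- There are two defects. An edge meeting `e` in several vertices may weigh more in `m` than
      -- in `loss`, and this is felt at each of its `k` vertices; and at the vertices of `e` itself
      -- `m` may exceed the degree. They are bounded by `excess≤` and `∑s²≤`.
      ∑overcount≤ : ∀ {e} → e ∈ A → ∑ U (λ x → overcount x e) ≤ k * (k * K) + k * K
      ∑overcount≤ {e} e∈ = ≤-trans
        (∑-mono U (λ {x} x∈ → ≤-by (0≤a*b (0≤I x e) (a≤b⇒0≤b-a (loss≤m {x} e∈)))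
          (eq (m x e) (I x e) (d x) (loss x e))))
        (≤-trans (≤-reflexive (trans (∑-+ U (λ x → m x e - loss x e) (λ x → I x e * m x e - I x e * d x))
            (cong₂ _+_ missed repeated)))
          (+-mono-≤ (*-monoˡ k 0≤k (excess≤ e∈))
            (≤-by (a≤b⇒0≤b-a (∑s²≤ e∈)) (eq″ (∑ A (λ c → s c e * s c e)) (B e) (k * K)))))
        where
        eq : ∀ m i δ l → m - l + (i * m - i * δ) ≡ m - i * δ - (1ℚ - i) * l + i * (m - l)
        eq = solve-∀ ring
        eq′ : ∀ a b → a - b ≡ 1ℚ * a + - 1ℚ * b
        eq′ = solve-∀ ring
        eq″ : ∀ a b c → c ≡ 1ℚ * a + - 1ℚ * b + (b + c - a)
        eq″ = solve-∀ ring
        distrib : ∀ i a b → i * (a - b) ≡ 1ℚ * (i * a) + - 1ℚ * (i * b)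
        distrib = solve-∀ ring
        missed : ∑ U (λ x → m x e - loss x e) ≡ k * excess e
        missed = trans (∑-cong U (λ x → trans (eq′ (m x e) (loss x e))
          (sym (trans (∑-cong A (λ c → distrib (I x c) (s c e) (J c e)))
            (∑-lin₂ A 1ℚ (λ c → I x c * s c e) (- 1ℚ) (λ c → I x c * J c e))))))
          (∑U-incidence (λ c → s c e - J c e))
        repeated : ∑ U (λ x → I x e * m x e - I x e * d x) ≡ 1ℚ * ∑ A (λ c → s c e * s c e) + - 1ℚ * B e
        repeated = trans (∑-cong U (λ x → eq′ (I x e * m x e) (I x e * d x)))
          (trans (∑-lin₂ U 1ℚ (λ x → I x e * m x e) (- 1ℚ) (λ x → I x e * d x))
            (cong (λ a → 1ℚ * a + - 1ℚ * B e) (∑Im e)))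

      ∑noise≤ : ∀ {e} → e ∈ A → ∑ U (λ x → noise x e) ≤ ν
      ∑noise≤ {e} e∈ = ≤-trans (≤-reflexive total)
        (≤-trans (+-mono-≤ (+-mono-≤ (+-mono-≤ (*-monoˡ (2ℚ * D) (0≤a*b 0≤2 0≤D) (∑overcount≤ e∈))
            (*-monoˡ K 0≤K (*-monoˡ (k - 1ℚ) 0≤k-1 (B≤kD e∈)))) ≤-refl) ≤-refl)
          (≤-by (0≤a+b (0≤a*b (0≤a*b (0≤a*b 0≤D 0≤K) 0≤k) (0≤a+b 0≤k 0≤k-1)) (0≤a*b (0≤a² k) (0≤a*b (0≤a² τ) 0≤u)))
            (trans (eq D k K τ u) (cong (λ a → 2ℚ * D * (k * (k * K) + k * K) + K *
              ((k - 1ℚ) * (k * D)) + a + 2ℚ * (σ * τ) * k +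
                (D * K * k * (k + (k - 1ℚ)) + k * k * (τ * τ * u)))
              (sym (trans (eq′ M σ) (cong (_* σ) M*σ)))))))
        where
        eq : ∀ D k K τ u → (1ℚ + 1ℚ + 1ℚ + 1ℚ + 1ℚ) * (k * k) * K * D + k * k * (k * k) * (τ * τ * u) ≡
          (1ℚ + 1ℚ) * D * (k * (k * K) + k * K) + K * ((k - 1ℚ) * (k * D)) + (k - 1ℚ) * k * τ *
            ((k - 1ℚ) * (k * τ * u)) +
          (1ℚ + 1ℚ) * ((k - 1ℚ) * (k * τ * u) * τ) * k + (D * K * k * (k + (k - 1ℚ)) + k * k * (τ * τ * u))
        eq = solve-∀ ring
        eq′ : ∀ M σ → M * (σ * σ) ≡ M * σ * σ
        eq′ = solve-∀ ring
        total : ∑ U (λ x → noise x e) ≡ 2ℚ * D * ∑ U (λ x → overcount x e) + K * ((k - 1ℚ) * B e) + M *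
          (σ * σ) + 2ℚ * (σ * τ) * k
        total = trans (∑-+ U (λ x → 2ℚ * D * overcount x e + K * κ x e + σ * σ) (λ x → 2ℚ * (σ * τ) * I x e))
          (cong₂ _+_ (trans (∑-+ U (λ x → 2ℚ * D * overcount x e + K * κ x e) (λ _ → σ * σ))
              (cong₂ _+_ (trans (∑-lin₂ U (2ℚ * D) (λ x → overcount x e) K (λ x → κ x e))
                (cong (λ a → 2ℚ * D * ∑ U (λ x → overcount x e) + K * a) (∑κ e∈)))
                (∑-const U (σ * σ))))
            (trans (∑-*ˡ U (2ℚ * (σ * τ)) (λ x → I x e)) (cong (2ℚ * (σ * τ) *_) (uniform e∈))))

    ∑deviation′≤ : ∑ A deviation′ ≤ (size + 2ℚ * k * τ) * deviation τ + size * ν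
    ∑deviation′≤ = ≤-trans (∑-mono A (λ {e} e∈ → ≤-trans (∑-mono U (λ x∈ → pointwise x∈ e∈))
        (≤-trans (≤-reflexive (∑-+ U (λ x → main x e) (λ x → noise x e)))
          (+-monoʳ-≤ (∑ U (λ x → main x e)) (∑noise≤ e∈)))))
      (≤-trans (≤-reflexive (trans (∑-+ A (λ e → ∑ U (λ x → main x e)) (λ _ → ν))
        (cong (∑ A (λ e → ∑ U (λ x → main x e)) +_) (∑-const A ν))))
        (+-monoˡ-≤ (Q * ν) ∑main≤))

    -- Sparsity pushes `P`, which is `Q k - M τ`, down to `- M τ / 2` or less, and `uP²≤V` turns
    -- this shortfall of the mean into potential.
    deviation≥ : 2ℚ * (size * k) ≤ order * τ → order * (τ * τ) ≤ (2ℚ + 2ℚ) * deviation τ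
    deviation≥ sparse = ≤-trans
      (≤-by (0≤a*b 0≤u (0≤a*b 0≤w (0≤a+b (0≤a*b 0≤2 (0≤a*b 0≤M 0≤τ)) 0≤w)))
        (trans (cong (λ a → (2ℚ + 2ℚ) * (u * (a * a))) (trans (eq P M τ) (cong (_- M * τ) (sym kQ))))
          (trans (eq′ u Q k M τ) (trans (cong (λ a → a * (M * (τ * τ)) + u * (w * (2ℚ * (M * τ) + w))) order*u≡1)
            (cong (_+ u * (w * (2ℚ * (M * τ) + w))) (*-identityˡ (M * (τ * τ))))))))
      (*-monoˡ (2ℚ + 2ℚ) (0≤a+b 0≤2 0≤2) uP²≤V)
      where
      w : ℚ
      w = M * τ - 2ℚ * (Q * k)
      0≤w : 0ℚ ≤ w
      0≤w = a≤b⇒0≤b-a sparse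
      0≤M : 0ℚ ≤ M
      0≤M = 0≤∑ U (λ _ → 0≤1)
      eq : ∀ P M τ → P ≡ P + M * τ - M * τ
      eq = solve-∀ ring
      eq′ : ∀ u Q k M τ → (1ℚ + 1ℚ + (1ℚ + 1ℚ)) * (u * ((Q * k - M * τ) * (Q * k - M * τ))) ≡
        M * u * (M * (τ * τ)) + u * ((M * τ - (1ℚ + 1ℚ) * (Q * k)) *
          ((1ℚ + 1ℚ) * (M * τ) + (M * τ - (1ℚ + 1ℚ) * (Q * k))))
      eq′ = solve-∀ ring

-- Natural numbers, indicators and probabilities

fromℕ-suc : ∀ m → fromℕ (suc m) ≡ 1ℚ + fromℕ m
fromℕ-suc m = toℚᵘ-injective (ℚᵘ.≃-trans (toℚᵘ-fromℚᵘ (mkℚᵘ (ℤ.+ suc m) 0)) (ℚᵘ.≃-sym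
  (ℚᵘ.≃-trans (toℚᵘ-homo-+ 1ℚ (fromℕ m))
    (ℚᵘ.≃-trans (ℚᵘ.+-congʳ (toℚᵘ 1ℚ) (toℚᵘ-fromℚᵘ (mkℚᵘ (ℤ.+ m) 0)))
      (*≡* (cong (λ a → (ℤ.+ 1 ℤ.+ a) ℤ.* ℤ.+ 1) (ℤ.*-identityʳ (ℤ.+ m))))))))

fromℕ-+ : ∀ a b → fromℕ (a ℕ.+ b) ≡ fromℕ a + fromℕ b
fromℕ-+ zero    b = sym (+-identityˡ (fromℕ b))
fromℕ-+ (suc a) b = trans (fromℕ-suc (a ℕ.+ b)) (trans (cong (1ℚ +_) (fromℕ-+ a b))
  (trans (sym (+-assoc 1ℚ (fromℕ a) (fromℕ b))) (cong (_+ fromℕ b) (sym (fromℕ-suc a)))))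

fromℕ-* : ∀ a b → fromℕ (a ℕ.* b) ≡ fromℕ a * fromℕ b
fromℕ-* zero    b = sym (*-zeroˡ (fromℕ b))
fromℕ-* (suc a) b = trans (fromℕ-+ b (a ℕ.* b)) (trans (cong (fromℕ b +_) (fromℕ-* a b))
  (trans (eq (fromℕ a) (fromℕ b)) (cong (_* fromℕ b) (sym (fromℕ-suc a)))))
  where
  eq : ∀ a b → b + a * b ≡ (1ℚ + a) * b
  eq = solve-∀ ring

0≤fromℕ : ∀ m → 0ℚ ≤ fromℕ m
0≤fromℕ zero    = ≤-refl
0≤fromℕ (suc m) = subst (0ℚ ≤_) (sym (fromℕ-suc m)) (0≤a+b 0≤1 (0≤fromℕ m))

fromℕ-mono : ∀ {a b} → a ℕ.≤ b → fromℕ a ≤ fromℕ b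
fromℕ-mono {b = b} ℕ.z≤n = 0≤fromℕ b
fromℕ-mono {suc a} {suc b} (ℕ.s≤s a≤b) =
  subst₂ _≤_ (sym (fromℕ-suc a)) (sym (fromℕ-suc b)) (+-monoʳ-≤ 1ℚ (fromℕ-mono a≤b))

inverse : ∀ {p} → 0ℚ < p → ∃ λ u → p * u ≡ 1ℚ × 0ℚ ≤ u
inverse {p} 0<p = 1/ p , *-inverseʳ p , <⇒≤ (positive⁻¹ (1/ p) {{1/pos⇒pos p}})
  where
  instance
    p-positive : Positive p
    p-positive = positive 0<p
    p-nonZero : ℚ-NonZero p
    p-nonZero = pos⇒nonZero p

𝟙 : {P : Set} → Dec P → ℚ
𝟙 P? = if does P? then 1ℚ else 0ℚ

𝟙-bit : {P : Set} (P? : Dec P) → IsBit (𝟙 P?)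
𝟙-bit P? with does P?
... | true  = inj₂ refl
... | false = inj₁ refl

𝟙-true : {P : Set} (P? : Dec P) → P → 𝟙 P? ≡ 1ℚ
𝟙-true (yes _) p = refl
𝟙-true (no ¬p) p = contradiction p ¬p

𝟙-false : {P : Set} (P? : Dec P) → ¬ P → 𝟙 P? ≡ 0ℚ
𝟙-false (yes p) ¬p = contradiction p ¬p
𝟙-false (no _)  ¬p = refl

𝟙-× : {P Q R : Set} (P? : Dec P) (Q? : Dec Q) (R? : Dec R) →
      (P → Q → R) → (R → P × Q) → 𝟙 P? * 𝟙 Q? ≡ 𝟙 R?
𝟙-× (yes p) (yes q) R? to from = sym (𝟙-true R? (to p q))
𝟙-× (yes p) (no ¬q) R? to from = sym (𝟙-false R? (λ r → ¬q (proj₂ (from r))))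
𝟙-× (no ¬p) Q?      R? to from = trans (*-zeroˡ (𝟙 Q?)) (sym (𝟙-false R? (λ r → ¬p (proj₁ (from r)))))

𝟙-¬ : {P Q : Set} (P? : Dec P) (Q? : Dec Q) → (P → ¬ Q) → (¬ P → Q) → 𝟙 Q? ≡ 1ℚ - 𝟙 P?
𝟙-¬ (yes p) Q? ¬q q = 𝟙-false Q? (¬q p)
𝟙-¬ (no ¬p) Q? ¬q q = 𝟙-true Q? (q ¬p)

∑-filter : {P : 𝔸 → Set} (P? : Decidable P) (xs : List 𝔸) (f : 𝔸 → ℚ) →
           ∑ (filter P? xs) f ≡ ∑ xs (λ x → 𝟙 (P? x) * f x)
∑-filter P? []       f = refl
∑-filter P? (x ∷ xs) f with does (P? x)
... | true  = cong₂ _+_ (sym (*-identityˡ (f x))) (∑-filter P? xs f)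
... | false = trans (∑-filter P? xs f) (trans (sym (+-identityˡ _))
  (cong (_+ ∑ xs (λ y → 𝟙 (P? y) * f y)) (sym (*-zeroˡ (f x)))))

∑-++ : (xs ys : List 𝔸) (f : 𝔸 → ℚ) → ∑ (xs ++ ys) f ≡ ∑ xs f + ∑ ys f
∑-++ []       ys f = sym (+-identityˡ (∑ ys f))
∑-++ (x ∷ xs) ys f = trans (cong (f x +_) (∑-++ xs ys f)) (sym (+-assoc (f x) (∑ xs f) (∑ ys f)))

∑-map : (g : 𝔸 → 𝔹) (xs : List 𝔸) (f : 𝔹 → ℚ) → ∑ (map g xs) f ≡ ∑ xs (f ∘ g)
∑-map g []       f = refl
∑-map g (x ∷ xs) f = cong (f (g x) +_) (∑-map g xs f)

∑-length : (xs : List 𝔸) → ∑ xs (λ _ → 1ℚ) ≡ fromℕ (length xs)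
∑-length []       = refl
∑-length (x ∷ xs) = trans (cong (1ℚ +_) (∑-length xs)) (sym (fromℕ-suc (length xs)))

∑-lookup : (xs : List 𝔸) (f : 𝔸 → ℚ) → sum (λ i → f (lookup xs i)) ≡ ∑ xs f
∑-lookup []       f = refl
∑-lookup (x ∷ xs) f = cong (f x +_) (∑-lookup xs f)

module _ {X : Set} (_≟_ : DecidableEquality X) {f : X → ℚ} (0≤f : ∀ x → 0ℚ ≤ f x) where

  ∑-diagonal : ∀ x {xs} → Unique xs → ∑ xs (λ y → 𝟙 (x ≟ y) * f y) ≤ f x
  ∑-diagonal x [] = 0≤f x
  ∑-diagonal x {y ∷ ys} (y∉ ∷ unique) with x ≟ y
  ... | no _     = ≤-trans (≤-reflexive (trans (cong (_+ _) (*-zeroˡ (f y))) (+-identityˡ _)))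
    (∑-diagonal x unique)
  ... | yes refl = ≤-reflexive (trans (cong₂ _+_ (*-identityˡ (f x)) rest) (+-identityʳ (f x)))
    where
    off-diagonal : ∀ {zs} → All (x ≢_) zs → ∑ zs (λ z → 𝟙 (x ≟ z) * f z) ≡ 0ℚ
    off-diagonal []                = refl
    off-diagonal {z ∷ _} (x≢z ∷ a) =
      cong₂ _+_ (trans (cong (_* f z) (𝟙-false (x ≟ z) x≢z)) (*-zeroˡ (f z))) (off-diagonal a)
    rest : ∑ ys (λ z → 𝟙 (x ≟ z) * f z) ≡ 0ℚ
    rest = off-diagonal y∉

/-* : ∀ a b .{{_ : NonZero b}} → (ℤ.+ a / b) * fromℕ b ≡ fromℕ a
/-* a b@(suc b-1) = toℚᵘ-injective (ℚᵘ.≃-trans (toℚᵘ-homo-* (ℤ.+ a / b) (fromℕ b))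
  (ℚᵘ.≃-trans (ℚᵘ.*-cong (toℚᵘ-fromℚᵘ (mkℚᵘ (ℤ.+ a) b-1)) (toℚᵘ-fromℚᵘ (mkℚᵘ (ℤ.+ b) 0)))
    (ℚᵘ.≃-trans (*≡* eq) (ℚᵘ.≃-sym (toℚᵘ-fromℚᵘ (mkℚᵘ (ℤ.+ a) 0))))))
  where
  eq : ℤ.+ a ℤ.* ℤ.+ b ℤ.* ℤ.+ 1 ≡ ℤ.+ a ℤ.* (ℤ.+ (b ℕ.* 1))
  eq = trans (ℤ.*-identityʳ (ℤ.+ a ℤ.* ℤ.+ b)) (cong (λ c → ℤ.+ a ℤ.* ℤ.+ c) (sym (ℕ.*-identityʳ b)))

sum-mono : ∀ n {f g : Fin n → ℚ} → (∀ i → f i ≤ g i) → sum f ≤ sum g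
sum-mono zero    f≤g = ≤-refl
sum-mono (suc n) f≤g = +-mono-≤ (f≤g zero) (sum-mono n (λ i → f≤g (suc i)))

sum-const : ∀ n c → sum {n} (λ _ → c) ≡ fromℕ n * c
sum-const zero    c = sym (*-zeroˡ c)
sum-const (suc n) c = trans (cong (c +_) (sum-const n c))
  (trans (eq c (fromℕ n)) (cong (_* c) (sym (fromℕ-suc n))))
  where
  eq : ∀ c n → c + n * c ≡ (1ℚ + n) * c
  eq = solve-∀ ring

module _ {A : Set} {P : A → Set} (P? : Decidable P) where

  mean : ∀ k (f : Fin (suc k) → Random A) → fromℕ (suc k) * Pr (draw k f) P? ≡ sum (λ i → Pr (f i) P?)
  mean k f = trans (sym (*-assoc (fromℕ (suc k)) (ℤ.+ 1 / suc k) S))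
    (trans (cong (_* S) (trans (*-comm (fromℕ (suc k)) (ℤ.+ 1 / suc k)) (/-* 1 (suc k)))) (*-identityˡ S))
    where
    S : ℚ
    S = sum (λ i → Pr (f i) P?)

  private
    0<1+k : ∀ k → 0ℚ < fromℕ (suc k)
    0<1+k k = <-≤-trans (positive⁻¹ 1ℚ) (fromℕ-mono (ℕ.s≤s (ℕ.z≤n {k})))

    cancel : ∀ k {a b} → fromℕ (suc k) * a ≤ fromℕ (suc k) * b → a ≤ b
    cancel k = *-cancelˡ-≤-pos (fromℕ (suc k)) {{positive (0<1+k k)}}

  0≤Pr : ∀ r → 0ℚ ≤ Pr r P?
  0≤Pr (done a)   = bit≥0 (𝟙-bit (P? a))
  0≤Pr (draw k f) = cancel k (subst₂ _≤_ (sum-const (suc k) 0ℚ) (sym (mean k f))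
    (sum-mono (suc k) (λ i → 0≤Pr (f i))))

  Pr≤1 : ∀ r → Pr r P? ≤ 1ℚ
  Pr≤1 (done a)   = bit≤1 (𝟙-bit (P? a))
  Pr≤1 (draw k f) = cancel k (subst₂ _≤_ (sym (mean k f)) (sum-const (suc k) 1ℚ)
    (sum-mono (suc k) (λ i → Pr≤1 (f i))))

  Surely⇒1≤Pr : ∀ r → Surely P r → 1ℚ ≤ Pr r P?
  Surely⇒1≤Pr (done a)   p = ≤-reflexive (sym (𝟙-true (P? a) p))
  Surely⇒1≤Pr (draw k f) s = cancel k (subst₂ _≤_ (sum-const (suc k) 1ℚ) (sym (mean k f))
    (sum-mono (suc k) (λ i → Surely⇒1≤Pr (f i) (s i))))

-- Counting subsets

-- The number of q-element sets c with S ⊆ c ⊆ S ∪ F, where |S| = s, |F| = m and S ∩ F = ∅.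
between : ℕ → ℕ → ℕ → ℕ
between s zero    q with s ℕ.≟ q
... | yes _ = 1
... | no _  = 0
between s (suc m) q = between (suc s) m q ℕ.+ between s m q

between-suc : ∀ s m q → between (suc s) m (suc q) ≡ between s m q
between-suc s zero q with s ℕ.≟ q | suc s ℕ.≟ suc q
... | yes _ | yes _  = refl
... | yes p | no ¬p  = contradiction (cong suc p) ¬p
... | no ¬p | yes p  = contradiction (ℕ.suc-injective p) ¬p
... | no _  | no _   = refl
between-suc s (suc m) q = cong₂ ℕ._+_ (between-suc (suc s) m q) (between-suc s m q)

between-> : ∀ {s q} m → q ℕ.< s → between s m q ≡ 0
between-> {s} {q} zero q<s with s ℕ.≟ q
... | yes refl = contradiction q<s (ℕ.<-irrefl refl)
... | no _     = refl
between-> (suc m) q<s = cong₂ ℕ._+_ (between-> m (ℕ.m<n⇒m<1+n q<s)) (between-> m q<s)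

between-positive : ∀ s m {q} → s ℕ.≤ q → q ℕ.≤ s ℕ.+ m → 1 ℕ.≤ between s m q
between-positive s zero {q} s≤q q≤s+m with s ℕ.≟ q
... | yes _  = ℕ.s≤s ℕ.z≤n
... | no s≢q = contradiction (ℕ.≤-antisym s≤q (subst (q ℕ.≤_) (ℕ.+-identityʳ s) q≤s+m)) s≢q
between-positive s (suc m) {q} s≤q q≤s+m with s ℕ.≟ q
... | yes refl = ℕ.≤-trans (between-positive s m s≤q (ℕ.m≤m+n s m)) (ℕ.m≤n+m _ (between (suc s) m s))
... | no s≢q   = ℕ.≤-trans (between-positive (suc s) m (ℕ.≤∧≢⇒< s≤q s≢q) (subst (q ℕ.≤_) (ℕ.+-suc s m) q≤s+m))
                   (ℕ.m≤m+n (between (suc s) m q) _)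

-- Both sides count the pairs (c, a) with a ∈ c, according to whether a ∈ S.
between-absorption : ∀ s m q →
  q ℕ.* between s (suc m) q ≡ s ℕ.* between s (suc m) q ℕ.+ suc m ℕ.* between (suc s) m q
between-absorption s zero q with s ℕ.≟ q | suc s ℕ.≟ q
... | yes refl | yes p = contradiction (sym p) (λ q≡ → ℕ.<-irrefl q≡ (ℕ.n<1+n s))
... | yes refl | no _  = sym (ℕ.+-identityʳ (s ℕ.* 1))
... | no _     | yes refl = eq s
  where
  eq : ∀ s → suc s ℕ.* 1 ≡ s ℕ.* 1 ℕ.+ 1
  eq = ℕ.solve-∀
... | no _     | no _  = eq q s
  where
  eq : ∀ q s → q ℕ.* 0 ≡ s ℕ.* 0 ℕ.+ 0
  eq = ℕ.solve-∀
between-absorption s (suc m) q = trans (ℕ.*-distribˡ-+ q (between (suc s) (suc m) q) (between s (suc m) q))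
  (trans (cong₂ ℕ._+_ (between-absorption (suc s) m q) (between-absorption s m q))
    (eq s m (between (suc (suc s)) m q) (between (suc s) m q) (between s m q)))
  where
  eq : ∀ s m a b c →
    (suc s ℕ.* (a ℕ.+ b) ℕ.+ suc m ℕ.* a) ℕ.+ (s ℕ.* (b ℕ.+ c) ℕ.+ suc m ℕ.* b) ≡
    s ℕ.* ((a ℕ.+ b) ℕ.+ (b ℕ.+ c)) ℕ.+ suc (suc m) ℕ.* (a ℕ.+ b)
  eq = ℕ.solve-∀

between-≤ : ∀ s m q → suc m ℕ.* between (suc s) m q ℕ.≤ q ℕ.* between s (suc m) q
between-≤ s m q = subst (suc m ℕ.* between (suc s) m q ℕ.≤_) (sym (between-absorption s m q))
  (ℕ.m≤n+m _ (s ℕ.* between s (suc m) q))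

between-all : ∀ q m → between q m q ≡ 1
between-all q zero with q ℕ.≟ q
... | yes _   = refl
... | no q≢q  = contradiction refl q≢q
between-all q (suc m) = cong₂ ℕ._+_ (between-> m (ℕ.n<1+n q)) (between-all q m)

between-1-2 : ∀ m → between 1 m 2 ≡ m
between-1-2 zero    = refl
between-1-2 (suc m) = cong₂ ℕ._+_ (between-all 2 m) (between-1-2 m)

2*between-0-2 : ∀ m → 2 ℕ.* between 0 m 2 ≡ m ℕ.* (m ∸ 1)
2*between-0-2 zero    = refl
2*between-0-2 (suc m) = trans (between-absorption 0 m 2) (cong (suc m ℕ.*_) (between-1-2 m))

-- One more prescribed point keeps only the first summand in the recursion of `between`. This is
-- needed because the union of two distinct pairs may have four points, while `D₃` refers to three.
between-antitone : ∀ s t n q → s ℕ.≤ t → t ℕ.≤ n → between t (n ∸ t) q ℕ.≤ between s (n ∸ s) q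
between-antitone s t n q s≤t t≤n with ℕ.≤⇒≤′ s≤t
... | s≤′t = go t t≤n s≤′t
  where
  ∸-suc : ∀ {n t} → t ℕ.< n → n ∸ t ≡ suc (n ∸ suc t)
  ∸-suc (ℕ.s≤s t≤n) = ℕ.+-∸-assoc 1 t≤n
  go : ∀ t → t ℕ.≤ n → s ℕ.≤′ t → between t (n ∸ t) q ℕ.≤ between s (n ∸ s) q
  go t       t≤n ℕ.≤′-refl        = ℕ.≤-refl
  go (suc t) t<n (ℕ.≤′-step s≤′t) = ℕ.≤-trans
    (subst (λ m → between (suc t) (n ∸ suc t) q ℕ.≤ between t m q) (sym (∸-suc t<n)) (ℕ.m≤m+n _ _))
    (go t (ℕ.<⇒≤ t<n) s≤′t)

∑-subsets : ∀ {n} (f : Subset (suc n) → ℚ) →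
            ∑ (subsets (suc n)) f ≡ ∑ (subsets n) (f ∘ (inside ∷_)) + ∑ (subsets n) (f ∘ (outside ∷_))
∑-subsets {n} f = trans (∑-++ (map (inside ∷_) (subsets n)) (map (outside ∷_) (subsets n)) f)
  (cong₂ _+_ (∑-map (inside ∷_) (subsets n) f) (∑-map (outside ∷_) (subsets n) f))

private
  0*∑ : (xs : List 𝔸) (f : 𝔸 → ℚ) → ∑ xs (λ c → 0ℚ * f c) ≡ 0ℚ
  0*∑ xs f = trans (∑-*ˡ xs 0ℚ f) (*-zeroˡ (∑ xs f))

  ∑*0 : (xs : List 𝔸) (f : 𝔸 → ℚ) → ∑ xs (λ c → f c * 0ℚ) ≡ 0ℚ
  ∑*0 xs f = trans (∑-*ʳ xs 0ℚ f) (*-zeroʳ (∑ xs f))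

-- Induction on the first point. If it lies in `x`, only sets containing it count, and `between-suc`
-- shifts both sizes; otherwise the two halves of `subsets` are the two summands of `between`.
∑-supersets′ : ∀ {n} (x : Subset n) q →
  ∑ (subsets n) (λ c → 𝟙 (∣ c ∣ ℕ.≟ q) * 𝟙 (x ⊆? c)) ≡ fromℕ (between ∣ x ∣ (n ∸ ∣ x ∣) q)
∑-supersets′ [] zero    = refl
∑-supersets′ [] (suc q) = refl
∑-supersets′ {suc n} (inside ∷ x) zero = trans (∑-subsets (λ c → 𝟙 (∣ c ∣ ℕ.≟ 0) * 𝟙 (inside ∷ x ⊆? c))) (trans
  (cong₂ _+_ (0*∑ (subsets n) (λ c → 𝟙 (inside ∷ x ⊆? inside ∷ c)))
    (∑*0 (subsets n) (λ c → 𝟙 (∣ c ∣ ℕ.≟ 0))))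
  (cong fromℕ (sym (between-> (n ∸ ∣ x ∣) (ℕ.s≤s (ℕ.z≤n {∣ x ∣}))))))
∑-supersets′ {suc n} (inside ∷ x) (suc q) = trans (∑-subsets
  (λ c → 𝟙 (∣ c ∣ ℕ.≟ (suc q)) * 𝟙 (inside ∷ x ⊆? c))) (trans
  (cong₂ _+_ (∑-supersets′ x q)
    (∑*0 (subsets n) (λ c → 𝟙 (∣ c ∣ ℕ.≟ suc q))))
  (trans (+-identityʳ (fromℕ (between ∣ x ∣ (n ∸ ∣ x ∣) q))) (cong fromℕ (sym (between-suc ∣ x ∣ (n ∸ ∣ x ∣) q)))))
∑-supersets′ {suc n} (outside ∷ x) zero = trans (∑-subsets (λ c → 𝟙 (∣ c ∣ ℕ.≟ 0) * 𝟙 (outside ∷ x ⊆? c))) (trans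
  (cong₂ _+_ (0*∑ (subsets n) (λ c → 𝟙 (outside ∷ x ⊆? inside ∷ c))) (∑-supersets′ x 0))
  (trans (+-identityˡ _) (cong fromℕ (trans
    (cong (ℕ._+ between ∣ x ∣ (n ∸ ∣ x ∣) 0) (sym (between-> (n ∸ ∣ x ∣) (ℕ.s≤s (ℕ.z≤n {∣ x ∣})))))
    (cong (λ m → between ∣ x ∣ m 0) (sym (ℕ.+-∸-assoc 1 (∣p∣≤n x))))))))
∑-supersets′ {suc n} (outside ∷ x) (suc q) = trans (∑-subsets
  (λ c → 𝟙 (∣ c ∣ ℕ.≟ (suc q)) * 𝟙 (outside ∷ x ⊆? c))) (trans
  (cong₂ _+_ (∑-supersets′ x q) (∑-supersets′ x (suc q)))
  (trans (sym (fromℕ-+ (between ∣ x ∣ (n ∸ ∣ x ∣) q) _)) (cong fromℕ (trans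
    (cong (ℕ._+ between ∣ x ∣ (n ∸ ∣ x ∣) (suc q)) (sym (between-suc ∣ x ∣ (n ∸ ∣ x ∣) q)))
    (cong (λ m → between ∣ x ∣ m (suc q)) (sym (ℕ.+-∸-assoc 1 (∣p∣≤n x))))))))

∑-supersets : ∀ {n} (x : Subset n) q →
  ∑ (qSubsets n q) (λ c → 𝟙 (x ⊆? c)) ≡ fromℕ (between ∣ x ∣ (n ∸ ∣ x ∣) q)
∑-supersets {n} x q = trans (∑-filter (λ c → ∣ c ∣ ℕ.≟ q) (subsets n) (λ c → 𝟙 (x ⊆? c))) (∑-supersets′ x q)

∑-subsetsOf′ : ∀ {n} (c : Subset n) q →
  ∑ (subsets n) (λ x → 𝟙 (∣ x ∣ ℕ.≟ q) * 𝟙 (x ⊆? c)) ≡ fromℕ (between 0 ∣ c ∣ q)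
∑-subsetsOf′ [] zero    = refl
∑-subsetsOf′ [] (suc q) = refl
∑-subsetsOf′ {suc n} (outside ∷ c) q = trans (∑-subsets (λ x → 𝟙 (∣ x ∣ ℕ.≟ q) * 𝟙 (x ⊆? outside ∷ c))) (trans
  (cong₂ _+_ (∑*0 (subsets n) (λ c → 𝟙 (∣ inside ∷ c ∣ ℕ.≟ q)))
    (∑-subsetsOf′ c q)) (+-identityˡ _))
∑-subsetsOf′ {suc n} (inside ∷ c) zero = trans (∑-subsets (λ x → 𝟙 (∣ x ∣ ℕ.≟ 0) * 𝟙 (x ⊆? inside ∷ c))) (trans
  (cong₂ _+_ (0*∑ (subsets n) (λ x → 𝟙 (x ⊆? c))) (∑-subsetsOf′ c 0))
  (trans (+-identityˡ _) (cong (λ a → fromℕ (a ℕ.+ between 0 ∣ c ∣ 0))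
    (sym (between-> ∣ c ∣ (ℕ.s≤s (ℕ.z≤n {0})))))))
∑-subsetsOf′ {suc n} (inside ∷ c) (suc q) = trans (∑-subsets
  (λ x → 𝟙 (∣ x ∣ ℕ.≟ (suc q)) * 𝟙 (x ⊆? inside ∷ c))) (trans
  (cong₂ _+_ (∑-subsetsOf′ c q) (∑-subsetsOf′ c (suc q)))
  (trans (sym (fromℕ-+ (between 0 ∣ c ∣ q) _))
    (cong (λ a → fromℕ (a ℕ.+ between 0 ∣ c ∣ (suc q))) (sym (between-suc 0 ∣ c ∣ q)))))

∑-subsetsOf : ∀ {n} (c : Subset n) q → ∑ (qSubsets n q) (λ x → 𝟙 (x ⊆? c)) ≡ fromℕ (between 0 ∣ c ∣ q)
∑-subsetsOf {n} c q = trans (∑-filter (λ x → ∣ x ∣ ℕ.≟ q) (subsets n) (λ x → 𝟙 (x ⊆? c))) (∑-subsetsOf′ c q)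

∣p∣≡∣q∣∧p⊆q⇒p≡q : ∀ {n} {p q : Subset n} → p ⊆ q → ∣ p ∣ ≡ ∣ q ∣ → p ≡ q
∣p∣≡∣q∣∧p⊆q⇒p≡q {p = []} {[]} _ _ = refl
∣p∣≡∣q∣∧p⊆q⇒p≡q {p = outside ∷ p} {outside ∷ q} p⊆q eq = cong (outside ∷_) (∣p∣≡∣q∣∧p⊆q⇒p≡q (drop-∷-⊆ p⊆q) eq)
∣p∣≡∣q∣∧p⊆q⇒p≡q {p = inside ∷ p} {inside ∷ q} p⊆q eq = cong (inside ∷_)
  (∣p∣≡∣q∣∧p⊆q⇒p≡q (drop-∷-⊆ p⊆q) (ℕ.suc-injective eq))
∣p∣≡∣q∣∧p⊆q⇒p≡q {p = outside ∷ p} {inside ∷ q} p⊆q eq =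
  contradiction eq (ℕ.<⇒≢ (ℕ.s≤s (p⊆q⇒∣p∣≤∣q∣ (drop-∷-⊆ p⊆q))))
∣p∣≡∣q∣∧p⊆q⇒p≡q {p = inside ∷ p} {outside ∷ q} p⊆q eq = contradiction (p⊆q here) λ ()

-- A union of at most two points would coincide with each of the two pairs.
pairs-union : ∀ {n} {x y : Subset n} → ∣ x ∣ ≡ 2 → ∣ y ∣ ≡ 2 → x ≢ y → 3 ℕ.≤ ∣ x ∪ y ∣
pairs-union {x = x} {y} ∣x∣≡2 ∣y∣≡2 x≢y with 3 ℕ.≤? ∣ x ∪ y ∣
... | yes 3≤ = 3≤
... | no 3≰  = contradiction (trans x≡ (sym y≡)) x≢y
  where
  ∪≤2 : ∣ x ∪ y ∣ ℕ.≤ 2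
  ∪≤2 = ℕ.≤-pred (ℕ.≰⇒> 3≰)
  x≡ : x ≡ x ∪ y
  x≡ = ∣p∣≡∣q∣∧p⊆q⇒p≡q (p⊆p∪q y) (ℕ.≤-antisym (∣p∣≤∣p∪q∣ x y) (subst (∣ x ∪ y ∣ ℕ.≤_) (sym ∣x∣≡2) ∪≤2))
  y≡ : y ≡ x ∪ y
  y≡ = ∣p∣≡∣q∣∧p⊆q⇒p≡q (q⊆p∪q x y) (ℕ.≤-antisym (∣q∣≤∣p∪q∣ x y) (subst (∣ x ∪ y ∣ ℕ.≤_) (sym ∣y∣≡2) ∪≤2))

-- The hypergraph of uncovered pairs and available q-sets

_⊆ᵢ_ : ∀ {n} → Subset n → Subset n → ℚ
x ⊆ᵢ c = 𝟙 (x ⊆? c)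

_≟ₛ_ : ∀ {n} → DecidableEquality (Subset n)
_≟ₛ_ = ≡-dec Bool._≟_

⊆ᵢ-∩ : ∀ {n} (x c e : Subset n) → (x ⊆ᵢ c) * (x ⊆ᵢ e) ≡ x ⊆ᵢ (c ∩ e)
⊆ᵢ-∩ x c e = 𝟙-× (x ⊆? c) (x ⊆? e) (x ⊆? (c ∩ e))
  (λ x⊆c x⊆e i∈x → x∈p∩q⁺ (x⊆c i∈x , x⊆e i∈x))
  (λ x⊆c∩e → ⊆-trans x⊆c∩e (p∩q⊆p c e) , ⊆-trans x⊆c∩e (p∩q⊆q c e))

⊆ᵢ-∪ : ∀ {n} (x y c : Subset n) → (x ⊆ᵢ c) * (y ⊆ᵢ c) ≡ (x ∪ y) ⊆ᵢ c
⊆ᵢ-∪ x y c = 𝟙-× (x ⊆? c) (y ⊆? c) ((x ∪ y) ⊆? c)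
  (λ x⊆c y⊆c i∈ → [ x⊆c , y⊆c ]′ (x∈p∪q⁻ x y i∈))
  (λ x∪y⊆c → ⊆-trans (p⊆p∪q y) x∪y⊆c , ⊆-trans (q⊆p∪q x y) x∪y⊆c)

∑-filter-≤ : {A : Set} {P : A → Set} (P? : Decidable P) (xs : List A) {f : A → ℚ} → (∀ x → 0ℚ ≤ f x) →
             ∑ (filter P? xs) f ≤ ∑ xs f
∑-filter-≤ P? xs {f} 0≤f = ≤-trans (≤-reflexive (∑-filter P? xs f))
  (∑-mono xs (λ {x} _ → ≤-trans (*-monoʳ (f x) (0≤f x) (bit≤1 (𝟙-bit (P? x)))) (≤-reflexive (*-identityˡ (f x)))))

module Pairs (n q : ℕ) (3≤n : 3 ℕ.≤ n) where

  pairs : List (Subset n)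
  pairs = qSubsets n 2

  Uncovered : List (Subset n) → Subset n → Set
  Uncovered es x = All (λ f → ¬ x ⊆ f) es

  uncovered? : ∀ es → Decidable (Uncovered es)
  uncovered? es x = all? (λ f → ¬? (x ⊆? f)) es

  uncovered : List (Subset n) → List (Subset n)
  uncovered es = filter (uncovered? es) pairs

  k D D₃ K : ℚ
  k  = fromℕ (between 0 q 2)
  D  = fromℕ (between 2 (n ∸ 2) q)
  D₃ = fromℕ (between 3 (n ∸ 3) q)
  K  = k * D₃

  conflict : Subset n → Subset n → ℚ
  conflict c e = 1ℚ - 𝟙 (∣ c ∩ e ∣ ℕ.≤? 1)

  module State (es : List (Subset n)) =
    Hypergraph _⊆ᵢ_ (uncovered es) (available n q es)

  0≤⊆ᵢ : ∀ (x c : Subset n) → 0ℚ ≤ x ⊆ᵢ c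
  0≤⊆ᵢ x c = bit≥0 (𝟙-bit (x ⊆? c))

  ∣pair∣ : ∀ {x} → x ∈ pairs → ∣ x ∣ ≡ 2
  ∣pair∣ x∈ = proj₂ (∈-filter⁻ (λ e → ∣ e ∣ ℕ.≟ 2) {xs = subsets n} x∈)

  uncovered⁻ : ∀ es {x} → x ∈ uncovered es → ∣ x ∣ ≡ 2
  uncovered⁻ es x∈ = ∣pair∣ (proj₁ (∈-filter⁻ (uncovered? es) {xs = pairs} x∈))

  available⁻ : ∀ es {c} → c ∈ available n q es → ∣ c ∣ ≡ q × MeetsAtMostOnce es c
  available⁻ es c∈ with c∈E , meets ← ∈-filter⁻ (meetsAtMostOnce? es) {xs = qSubsets n q} c∈ =
    proj₂ (∈-filter⁻ (λ e → ∣ e ∣ ℕ.≟ q) {xs = subsets n} c∈E) , meets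

  pairs-uncovered : ∀ {es c x} → MeetsAtMostOnce es c → ∣ x ∣ ≡ 2 → x ⊆ c → Uncovered es x
  pairs-uncovered {c = c} {x} meets ∣x∣≡2 x⊆c = All.map
    (λ {f} ∣c∩f∣≤1 x⊆f → ℕ.<-irrefl refl (ℕ.≤-trans
      (subst (ℕ._≤ ∣ c ∩ f ∣) ∣x∣≡2 (p⊆q⇒∣p∣≤∣q∣ (λ i∈x → x∈p∩q⁺ (x⊆c i∈x , x⊆f i∈x)))) ∣c∩f∣≤1))
    meets

  -- A pair inside an available set cannot lie in a chosen edge, since the two sets would then share
  -- two points. So restricting to uncovered pairs loses nothing below `c`. The case `g = c` gives
  -- uniformity, and `g = c ∩ e` gives the number of common pairs.
  ∑-uncovered : ∀ es {c g} → c ∈ available n q es → g ⊆ c →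
                ∑ (uncovered es) (λ x → x ⊆ᵢ g) ≡ fromℕ (between 0 ∣ g ∣ 2)
  ∑-uncovered es {c} {g} c∈ g⊆c = trans (∑-filter (uncovered? es) pairs (λ x → x ⊆ᵢ g))
    (trans (∑-cong∈ pairs absorb) (∑-subsetsOf g 2))
    where
    absorb : ∀ {x} → x ∈ pairs → 𝟙 (uncovered? es x) * (x ⊆ᵢ g) ≡ x ⊆ᵢ g
    absorb {x} x∈ = 𝟙-× (uncovered? es x) (x ⊆? g) (x ⊆? g) (λ _ x⊆g → x⊆g)
      (λ x⊆g → pairs-uncovered (proj₂ (available⁻ es c∈)) (∣pair∣ x∈) (⊆-trans x⊆g g⊆c) , x⊆g)

  module _ (es : List (Subset n)) where
    open State es

    private
      U A : List (Subset n)
      U = uncovered es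
      A = available n q es

    uniform : ∀ {c} → c ∈ A → ∑ U (λ x → x ⊆ᵢ c) ≡ k
    uniform c∈ = trans (∑-uncovered es c∈ (λ i∈ → i∈)) (cong (λ r → fromℕ (between 0 r 2))
      (proj₁ (available⁻ es c∈)))

    common≡ : ∀ {c} e → c ∈ A → common c e ≡ fromℕ (between 0 ∣ c ∩ e ∣ 2)
    common≡ {c} e c∈ = trans (∑-cong U (λ x → ⊆ᵢ-∩ x c e)) (∑-uncovered es c∈ (p∩q⊆p c e))

    degree≤ : ∀ {x} → x ∈ U → d x ≤ D
    degree≤ {x} x∈ = ≤-trans (∑-filter-≤ (meetsAtMostOnce? es) (qSubsets n q) (0≤⊆ᵢ x))
      (≤-reflexive (trans (∑-supersets x q) (cong (λ s → fromℕ (between s (n ∸ s) q)) (uncovered⁻ es x∈))))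

    codegree≤ : ∀ {x y} → x ∈ U → y ∈ U → x ≢ y → ∑ A (λ c → (x ⊆ᵢ c) * (y ⊆ᵢ c)) ≤ D₃
    codegree≤ {x} {y} x∈ y∈ x≢y = ≤-trans (≤-reflexive (∑-cong A (⊆ᵢ-∪ x y)))
      (≤-trans (∑-filter-≤ (meetsAtMostOnce? es) (qSubsets n q) (0≤⊆ᵢ (x ∪ y)))
        (≤-trans (≤-reflexive (∑-supersets (x ∪ y) q))
          (fromℕ-mono (between-antitone 3 ∣ x ∪ y ∣ n q (pairs-union (uncovered⁻ es x∈) (uncovered⁻ es y∈) x≢y)
            (∣p∣≤n (x ∪ y))))))

    -- The left side is the sum over the pairs `y` inside `e` of the codegree of `x` and `y`. The
    -- term `y = x`, present only if `x ⊆ e`, is `d x`; each of the others is at most `D₃`, and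
    -- there are at most `k` of them.
    meet≤ : ∀ {x e} → x ∈ U → e ∈ A → ∑ A (λ c → (x ⊆ᵢ c) * common c e) ≤ (x ⊆ᵢ e) * d x + K
    meet≤ {x} {e} x∈ e∈ = ≤-trans (≤-reflexive exchange)
      (≤-trans (∑-mono U bound)
        (≤-trans (≤-reflexive (∑-+ U (λ y → 𝟙 (x ≟ₛ y) * ((y ⊆ᵢ e) * d x)) (λ y → (y ⊆ᵢ e) * D₃)))
          (+-mono-≤ (∑-diagonal _≟ₛ_ {λ y → (y ⊆ᵢ e) * d x} (λ y → 0≤a*b (0≤⊆ᵢ y e) 0≤dx) x unique)
            (≤-reflexive (trans (∑-*ʳ U D₃ (λ y → y ⊆ᵢ e)) (cong (_* D₃) (uniform e∈)))))))
      where
      0≤dx : 0ℚ ≤ d x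
      0≤dx = 0≤∑ A (0≤⊆ᵢ x)
      unique : Unique U
      unique = filter⁺ (uncovered? es) (filter⁺ (λ e → ∣ e ∣ ℕ.≟ 2) (subsets-unique n))
      eq : ∀ a b c → a * (b * c) ≡ c * (a * b)
      eq = solve-∀ ring
      exchange : ∑ A (λ c → (x ⊆ᵢ c) * common c e) ≡ ∑ U (λ y → (y ⊆ᵢ e) * ∑ A (λ c → (x ⊆ᵢ c) * (y ⊆ᵢ c)))
      exchange = trans (∑-cong A (λ c → sym (∑-*ˡ U (x ⊆ᵢ c) (λ y → (y ⊆ᵢ c) * (y ⊆ᵢ e)))))
        (trans (∑-swap A U (λ c y → (x ⊆ᵢ c) * ((y ⊆ᵢ c) * (y ⊆ᵢ e))))
          (∑-cong U (λ y → trans (∑-cong A (λ c → eq (x ⊆ᵢ c) (y ⊆ᵢ c) (y ⊆ᵢ e)))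
            (∑-*ˡ A (y ⊆ᵢ e) (λ c → (x ⊆ᵢ c) * (y ⊆ᵢ c))))))
      bound : ∀ {y} → y ∈ U → (y ⊆ᵢ e) * ∑ A (λ c → (x ⊆ᵢ c) * (y ⊆ᵢ c)) ≤
                              𝟙 (x ≟ₛ y) * ((y ⊆ᵢ e) * d x) + (y ⊆ᵢ e) * D₃
      bound {y} y∈ with x ≟ₛ y
      ... | yes refl = ≤-by (0≤a*b (0≤⊆ᵢ x e) (0≤fromℕ (between 3 (n ∸ 3) q)))
        (cong (_+ (x ⊆ᵢ e) * D₃) (trans (*-identityˡ ((x ⊆ᵢ e) * d x))
          (cong ((x ⊆ᵢ e) *_) (∑-cong A (λ c → sym (bit² (𝟙-bit (x ⊆? c))))))))
      ... | no x≢y = ≤-trans (*-monoˡ (y ⊆ᵢ e) (0≤⊆ᵢ y e) (codegree≤ x∈ y∈ x≢y))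
        (≤-reflexive (sym (trans (cong (_+ (y ⊆ᵢ e) * D₃) (*-zeroˡ ((y ⊆ᵢ e) * d x))) (+-identityˡ _))))

    0≤conflict : ∀ c e → 0ℚ ≤ conflict c e
    0≤conflict c e = a≤b⇒0≤b-a (bit≤1 (𝟙-bit (∣ c ∩ e ∣ ℕ.≤? 1)))

    private
      conflict-bounds : ∀ r → 1ℚ - 𝟙 (r ℕ.≤? 1) ≤ fromℕ (between 0 r 2) ×
        fromℕ (between 0 r 2) - (1ℚ - 𝟙 (r ℕ.≤? 1)) ≤ fromℕ (between 0 r 2) * fromℕ (between 0 r 2) - fromℕ
          (between 0 r 2)
      conflict-bounds 0             = ≤-refl , ≤-refl
      conflict-bounds 1             = ≤-refl , ≤-refl
      -- Here the conflict is 1 and `w` counts the common pairs, so the second bound amounts to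
      -- `(w - 1)² ≥ 0`.
      conflict-bounds (suc (suc r)) =
        fromℕ-mono (between-positive 0 (suc (suc r)) {2} ℕ.z≤n (ℕ.s≤s (ℕ.s≤s ℕ.z≤n))) ,
        ≤-by (0≤a² (w - 1ℚ)) (eq w)
        where
        w : ℚ
        w = fromℕ (between 0 (suc (suc r)) 2)
        eq : ∀ w → w * w - w ≡ w - (1ℚ - 0ℚ) + (w - 1ℚ) * (w - 1ℚ)
        eq = solve-∀ ring

    conflict≤common : ∀ {c e} → c ∈ A → e ∈ A → conflict c e ≤ common c e
    conflict≤common {c} {e} c∈ _ = subst (conflict c e ≤_) (sym (common≡ e c∈)) (proj₁ (conflict-bounds ∣ c ∩ e ∣))

    common≤conflict : ∀ {c e} → c ∈ A → e ∈ A → common c e - conflict c e ≤ common c e * common c e - common c e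
    common≤conflict {c} {e} c∈ _ = subst (λ s → s - conflict c e ≤ s * s - s) (sym (common≡ e c∈))
      (proj₂ (conflict-bounds ∣ c ∩ e ∣))

    ∑-available-∷ : ∀ e f → ∑ (available n q (e ∷ es)) f ≡ ∑ A (λ c → (1ℚ - conflict c e) * f c)
    ∑-available-∷ e f = trans (∑-filter (meetsAtMostOnce? (e ∷ es)) (qSubsets n q) f)
      (trans (∑-cong (qSubsets n q) split) (sym (∑-filter (meetsAtMostOnce? es) (qSubsets n q)
        (λ c → (1ℚ - conflict c e) * f c))))
      where
      eq : ∀ a b c → a * b * c ≡ b * ((1ℚ - (1ℚ - a)) * c)
      eq = solve-∀ ring
      split : ∀ c → 𝟙 (meetsAtMostOnce? (e ∷ es) c) * f c ≡ 𝟙 (meetsAtMostOnce? es c) * ((1ℚ - conflict c e) * f c)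
      split c = trans (cong (_* f c) (sym (𝟙-× (∣ c ∩ e ∣ ℕ.≤? 1) (meetsAtMostOnce? es c)
        (meetsAtMostOnce? (e ∷ es) c) _∷_ All.uncons)))
        (eq (𝟙 (∣ c ∩ e ∣ ℕ.≤? 1)) (𝟙 (meetsAtMostOnce? es c)) (f c))

    ∑-uncovered-∷ : ∀ e f → ∑ (uncovered (e ∷ es)) f ≡ ∑ U (λ x → (1ℚ - x ⊆ᵢ e) * f x)
    ∑-uncovered-∷ e f = trans (∑-filter (uncovered? (e ∷ es)) pairs f)
      (trans (∑-cong pairs split) (sym (∑-filter (uncovered? es) pairs (λ x → (1ℚ - x ⊆ᵢ e) * f x))))
      where
      eq : ∀ a b c → a * b * c ≡ b * (a * c)
      eq = solve-∀ ring
      split : ∀ x → 𝟙 (uncovered? (e ∷ es) x) * f x ≡ 𝟙 (uncovered? es x) * ((1ℚ - x ⊆ᵢ e) * f x)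
      split x = trans (cong (_* f x) (sym (𝟙-× (¬? (x ⊆? e)) (uncovered? es x)
        (uncovered? (e ∷ es) x) _∷_ All.uncons)))
        (trans (eq (𝟙 (¬? (x ⊆? e))) (𝟙 (uncovered? es x)) (f x))
          (cong (λ a → 𝟙 (uncovered? es x) * (a * f x)) (𝟙-¬ (x ⊆? e) (¬? (x ⊆? e)) (λ x⊆e x⊈e → x⊈e x⊆e)
            (λ x⊈e → x⊈e))))

    order-∷ : ∀ {e} → e ∈ A → State.order (e ∷ es) ≡ order - k
    order-∷ {e} e∈ = trans (∑-uncovered-∷ e (λ _ → 1ℚ)) (trans (∑-cong U (λ x → eq (x ⊆ᵢ e)))
      (trans (∑-lin₂ U 1ℚ (λ _ → 1ℚ) (- 1ℚ) (λ x → x ⊆ᵢ e)) (trans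
        (cong (λ a → 1ℚ * order + - 1ℚ * a) (uniform e∈)) (eq′ order k))))
      where
      eq : ∀ i → (1ℚ - i) * 1ℚ ≡ 1ℚ * 1ℚ + - 1ℚ * i
      eq = solve-∀ ring
      eq′ : ∀ a b → 1ℚ * a + - 1ℚ * b ≡ a - b
      eq′ = solve-∀ ring

    d-∷ : ∀ e x → State.d (e ∷ es) x ≡ d x - ∑ A (λ c → (x ⊆ᵢ c) * conflict c e)
    d-∷ e x = trans (∑-available-∷ e (λ c → x ⊆ᵢ c)) (trans (∑-cong A (λ c → eq (conflict c e) (x ⊆ᵢ c)))
      (trans (∑-lin₂ A 1ℚ (λ c → x ⊆ᵢ c) (- 1ℚ) (λ c → (x ⊆ᵢ c) * conflict c e)) (eq′ (d x) _)))
      where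
      eq : ∀ j i → (1ℚ - j) * i ≡ 1ℚ * i + - 1ℚ * (i * j)
      eq = solve-∀ ring
      eq′ : ∀ a b → 1ℚ * a + - 1ℚ * b ≡ a - b
      eq′ = solve-∀ ring

-- The potential along the process

0≤^ : ∀ {a} n → 0ℚ ≤ a → 0ℚ ≤ a ^ n
0≤^ zero    0≤a = 0≤1
0≤^ (suc n) 0≤a = 0≤a*b 0≤a (0≤^ n 0≤a)

1≤^ : ∀ {a} n → 1ℚ ≤ a → 1ℚ ≤ a ^ n
1≤^         zero    1≤a = ≤-refl
1≤^ {a} (suc n) 1≤a = ≤-trans 1≤a (≤-trans (≤-reflexive (sym (*-identityʳ a)))
  (*-monoˡ a (≤-trans 0≤1 1≤a) (1≤^ n 1≤a)))

-- The left side decreases with `n`, because `(1 - y)(1 + (n + 1) y) = 1 + n y - (n + 1) y²`. This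
-- is how powers of a shrinking ratio absorb growth factors.
[1-y]^n[1+ny]≤1 : ∀ {y} n → 0ℚ ≤ y → 0ℚ ≤ 1ℚ - y → (1ℚ - y) ^ n * (1ℚ + fromℕ n * y) ≤ 1ℚ
[1-y]^n[1+ny]≤1 {y} zero 0≤y y≤1 = ≤-reflexive (eq y)
  where
  eq : ∀ y → 1ℚ * (1ℚ + 0ℚ * y) ≡ 1ℚ
  eq = solve-∀ ring
[1-y]^n[1+ny]≤1 {y} (suc n) 0≤y y≤1 = ≤-trans
  (≤-by (0≤a*b (0≤^ n y≤1) (0≤a*b (0≤a+b 0≤1 (0≤fromℕ n)) (0≤a² y)))
    (trans (eq ((1ℚ - y) ^ n) (fromℕ n) y)
      (cong (λ a → (1ℚ - y) * (1ℚ - y) ^ n * (1ℚ + a * y) + (1ℚ - y) ^ n * ((1ℚ + fromℕ n) * (y * y)))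
        (sym (fromℕ-suc n)))))
  ([1-y]^n[1+ny]≤1 n 0≤y y≤1)
  where
  eq : ∀ p n y → p * (1ℚ + n * y) ≡ (1ℚ - y) * p * (1ℚ + (1ℚ + n) * y) + p * ((1ℚ + n) * (y * y))
  eq = solve-∀ ring

-- Halving the linear coefficient leaves room for the quadratic terms: the induction step has slack
-- `y (1 - n y)`.
2[1-y]^n≤2-ny : ∀ {y} n → 0ℚ ≤ y → 0ℚ ≤ 1ℚ - y → fromℕ n * y ≤ 1ℚ → 2ℚ * (1ℚ - y) ^ n ≤ 2ℚ - fromℕ n * y
2[1-y]^n≤2-ny {y} zero 0≤y y≤1 ny≤1 = ≤-reflexive (eq y)
  where
  eq : ∀ y → (1ℚ + 1ℚ) * 1ℚ ≡ 1ℚ + 1ℚ - 0ℚ * y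
  eq = solve-∀ ring
2[1-y]^n≤2-ny {y} (suc n) 0≤y y≤1 [1+n]y≤1 = ≤-trans
  (≤-reflexive (eq ((1ℚ - y) ^ n) y))
  (≤-trans (*-monoˡ (1ℚ - y) y≤1 (2[1-y]^n≤2-ny n 0≤y y≤1 ny≤1))
    (≤-by (0≤a*b 0≤y (a≤b⇒0≤b-a ny≤1)) (trans (cong (λ a → 2ℚ - a * y) (fromℕ-suc n)) (eq′ (fromℕ n) y))))
  where
  eq : ∀ p y → (1ℚ + 1ℚ) * ((1ℚ - y) * p) ≡ (1ℚ - y) * ((1ℚ + 1ℚ) * p)
  eq = solve-∀ ring
  eq′ : ∀ n y → 1ℚ + 1ℚ - (1ℚ + n) * y ≡ (1ℚ - y) * (1ℚ + 1ℚ - n * y) + y * (1ℚ - n * y)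
  eq′ = solve-∀ ring
  ny≤1 : fromℕ n * y ≤ 1ℚ
  ny≤1 = ≤-trans (*-monoʳ y 0≤y (fromℕ-mono (ℕ.n≤1+n n))) [1+n]y≤1

Surely-map : {A : Set} {P Q : A → Set} → (∀ {a} → P a → Q a) → ∀ r → Surely P r → Surely Q r
Surely-map P⇒Q (done a)   p = P⇒Q p
Surely-map P⇒Q (draw k f) s = λ i → Surely-map P⇒Q (f i) (s i)

continue-extends : ∀ n q t es → Surely (λ H → length es ℕ.≤ length H) (continue n q t es)
continue-extends n q zero    es = ℕ.≤-refl
continue-extends n q (suc t) es with available n q es
... | []     = ℕ.≤-refl
... | e ∷ as = λ i → Surely-map (ℕ.≤-trans (ℕ.n≤1+n _)) (continue n q t _) (continue-extends n q t _)

continue-draw : ∀ n q t es {e as} → available n q es ≡ e ∷ as →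
  continue n q (suc t) es ≡ draw (length as) (λ i → continue n q t (lookup (e ∷ as) i ∷ es))
continue-draw n q t es eq with available n q es
continue-draw n q t es refl | _ = refl

module Run (n q : ℕ) (3≤n : 3 ℕ.≤ n) (2≤q : 2 ℕ.≤ q)
  (μ v τ₁ : ℚ) (μ*v≡1 : μ * v ≡ 1ℚ) (0≤v : 0ℚ ≤ v) (0<μ : 0ℚ < μ) (0≤τ₁ : 0ℚ ≤ τ₁)
  (2k²≤μ : 2ℚ * (fromℕ (between 0 q 2) * fromℕ (between 0 q 2)) ≤ μ)
  {P : List (Subset n) → Set} (P? : Decidable P) where

  open Pairs n q 3≤n

  private
    kₙ : ℕ
    kₙ = between 0 q 2

    1≤k : 1ℚ ≤ k
    1≤k = fromℕ-mono (between-positive 0 q {2} ℕ.z≤n 2≤q)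

    0≤k : 0ℚ ≤ k
    0≤k = ≤-trans 0≤1 1≤k

    0≤μ : 0ℚ ≤ μ
    0≤μ = <⇒≤ 0<μ

    0≤D : 0ℚ ≤ D
    0≤D = 0≤fromℕ (between 2 (n ∸ 2) q)

    0≤K : 0ℚ ≤ K
    0≤K = 0≤a*b 0≤k (0≤fromℕ (between 3 (n ∸ 3) q))

    4ℚ : ℚ
    4ℚ = 2ℚ + 2ℚ

    0≤4 : 0ℚ ≤ 4ℚ
    0≤4 = 0≤a+b 0≤2 0≤2

  -- `ν` with `τ` and the inverse of the order replaced by the upper bounds `D` and `v`, valid
  -- throughout the run, so that one value serves every step.
  ν̂ : ℚ
  ν̂ = (1ℚ + 1ℚ + 1ℚ + 1ℚ + 1ℚ) * (k * k) * K * D + k * k * (k * k) * (D * D * v)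

  private
    0≤ν̂ : 0ℚ ≤ ν̂
    0≤ν̂ = 0≤a+b (0≤a*b (0≤a*b (0≤a*b (0≤fromℕ 5) (0≤a² k)) 0≤K) 0≤D)
                  (0≤a*b (0≤a*b (0≤a² k) (0≤a² k)) (0≤a*b (0≤a² D) 0≤v))

  -- Markov's inequality for the potential, cleared of denominators: μ and τ₁ are the number of
  -- uncovered pairs and a lower bound for τ at the end of the run, and order es * v is order es / μ.
  Goal : ℕ → ℕ → List (Subset n) → ℚ → Set
  Goal j t es τ = (1ℚ - Pr (continue n q t es) P?) * (μ * (τ₁ * τ₁)) ≤
    (2ℚ + 2ℚ) * ((State.order es * v) ^ (4 ℕ.* kₙ) * (State.deviation es τ + fromℕ j * ν̂))

  module At (j t : ℕ) (es : List (Subset n)) (τ : ℚ)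
    (μ≤M : μ ≤ State.order es)
    (τ≤D : τ ≤ D) (τ₁≤τ : τ₁ * (State.order es * v) ^ (2 ℕ.* kₙ) ≤ τ) where

    open State es

    private
      A : List (Subset n)
      A = available n q es

      M r : ℚ
      M = order
      r = M * v

      inv : ∃ λ u → M * u ≡ 1ℚ × 0ℚ ≤ u
      inv = inverse (<-≤-trans 0<μ μ≤M)

      u : ℚ
      u = proj₁ inv
      M*u≡1 : M * u ≡ 1ℚ
      M*u≡1 = proj₁ (proj₂ inv)
      0≤u : 0ℚ ≤ u
      0≤u = proj₂ (proj₂ inv)

      0≤M : 0ℚ ≤ M
      0≤M = ≤-trans 0≤μ μ≤M

      0≤r : 0ℚ ≤ r
      0≤r = 0≤a*b 0≤M 0≤v

      1≤r : 1ℚ ≤ r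
      1≤r = ≤-trans (≤-reflexive (sym μ*v≡1)) (*-monoʳ v 0≤v μ≤M)

      0≤τ : 0ℚ ≤ τ
      0≤τ = ≤-trans (0≤a*b 0≤τ₁ (0≤^ (2 ℕ.* kₙ) 0≤r)) τ₁≤τ

      V : ℚ
      V = deviation τ

      0≤V : 0ℚ ≤ V
      0≤V = 0≤∑ (uncovered es) (λ x → 0≤a² (d x - τ))

    open OneStep _⊆ᵢ_ (λ x c → 𝟙-bit (x ⊆? c)) (uncovered es) A k D K τ u conflict
      (uniform es) (degree≤ es) (meet≤ es) (0≤conflict es) (conflict≤common es) (common≤conflict es)
      1≤k 0≤D 0≤K 0≤τ 0≤u M*u≡1 public

    -- The failure probability is at most 1, and by `deviation≥` the potential alone already reaches
    -- a quarter of `μ * (τ₁ * τ₁)`. So nothing has to be known about the further course of the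
    -- process.
    sparse : 2ℚ * (size * k) ≤ order * τ → Goal j t es τ
    sparse few = ≤-trans
      (≤-trans (*-monoʳ (μ * (τ₁ * τ₁)) 0≤F (≤-by {1ℚ - Pr (continue n q t es) P?}
        (0≤Pr P? (continue n q t es)) (eq (Pr (continue n q t es) P?))))
        (≤-trans (≤-reflexive (*-identityˡ (μ * (τ₁ * τ₁))))
          (≤-trans (*-monoʳ (τ₁ * τ₁) (0≤a² τ₁) μ≤M) (*-monoˡ M 0≤M (square-mono 0≤τ₁ τ₁≤τ′)))))
      (≤-trans (deviation≥ few)
        (*-monoˡ 4ℚ 0≤4 (≤-trans (≤+ʳ {V} 0≤jν) (≤-trans (≤-reflexive (sym (*-identityˡ (V + fromℕ j * ν̂))))
          (*-monoʳ (V + fromℕ j * ν̂) (0≤a+b 0≤V 0≤jν) (1≤^ (4 ℕ.* kₙ) 1≤r))))))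
      where
      eq : ∀ p → 1ℚ ≡ 1ℚ - p + p
      eq = solve-∀ ring
      0≤F : 0ℚ ≤ μ * (τ₁ * τ₁)
      0≤F = 0≤a*b 0≤μ (0≤a² τ₁)
      0≤jν : 0ℚ ≤ fromℕ j * ν̂
      0≤jν = 0≤a*b (0≤fromℕ j) 0≤ν̂
      τ₁≤τ′ : τ₁ ≤ τ
      τ₁≤τ′ = ≤-trans (≤-reflexive (sym (*-identityʳ τ₁))) (≤-trans (*-monoˡ τ₁ 0≤τ₁ (1≤^ (2 ℕ.* kₙ) 1≤r)) τ₁≤τ)

    private
      y : ℚ
      y = k * u

      0≤y : 0ℚ ≤ y
      0≤y = 0≤a*b 0≤k 0≤u

      2ky≤1 : 2ℚ * k * y ≤ 1ℚ
      2ky≤1 = ≤-trans (≤-reflexive (eq k u)) (≤-trans (*-monoʳ u 0≤u (≤-trans 2k²≤μ μ≤M)) (≤-reflexive M*u≡1))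
        where
        eq : ∀ k u → (1ℚ + 1ℚ) * k * (k * u) ≡ (1ℚ + 1ℚ) * (k * k) * u
        eq = solve-∀ ring

      0≤1-y : 0ℚ ≤ 1ℚ - y
      0≤1-y = a≤b⇒0≤b-a (≤-trans (≤-by {y} (0≤a*b (0≤a+b (a≤b⇒0≤b-a 1≤k) 0≤k) 0≤y) (eq k y)) 2ky≤1)
        where
        eq : ∀ k y → (1ℚ + 1ℚ) * k * y ≡ y + (k - 1ℚ + k) * y
        eq = solve-∀ ring

      r′≡ : (M - k) * v ≡ r * (1ℚ - y)
      r′≡ = trans (eq M k v) (trans (cong (λ a → M * v - k * v * a) (sym M*u≡1)) (eq′ M k u v))
        where
        eq : ∀ M k v → (M - k) * v ≡ M * v - k * v * 1ℚ
        eq = solve-∀ ring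
        eq′ : ∀ M k u v → M * v - k * v * (M * u) ≡ M * v * (1ℚ - k * u)
        eq′ = solve-∀ ring

      fromℕ-c*k : ∀ c → fromℕ (c ℕ.* kₙ) ≡ fromℕ c * k
      fromℕ-c*k c = fromℕ-* c kₙ

    -- A choice multiplies the ratio `r` by `1 - y` and the potential by at most `1 + 4ky`, up to
    -- noise. Exponent `4k` is what lets the first factor compensate for the second.
    growth : ((M - k) * v) ^ (4 ℕ.* kₙ) * (1ℚ + 4ℚ * k * y) ≤ r ^ (4 ℕ.* kₙ)
    growth = ≤-trans
      (≤-reflexive (trans (cong (λ a → a ^ (4 ℕ.* kₙ) * (1ℚ + 4ℚ * k * y)) r′≡)
        (trans (cong (_* (1ℚ + 4ℚ * k * y)) (^-distrib-* r (1ℚ - y) (4 ℕ.* kₙ)))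
          (trans (*-assoc (r ^ (4 ℕ.* kₙ)) _ _)
            (cong (λ a → r ^ (4 ℕ.* kₙ) * ((1ℚ - y) ^ (4 ℕ.* kₙ) * (1ℚ + a * y))) (sym (fromℕ-c*k 4)))))))
      (≤-trans (*-monoˡ (r ^ (4 ℕ.* kₙ)) (0≤^ (4 ℕ.* kₙ) 0≤r) ([1-y]^n[1+ny]≤1 (4 ℕ.* kₙ) 0≤y 0≤1-y))
        (≤-reflexive (*-identityʳ _)))

    -- The trajectory is multiplied by `1 - (k - 1) y`, which is at least `1 - k y` and hence at
    -- least `(1 - y)^(2k)`. The last comparison needs `2ky ≤ 1`, the reason for the hypothesis
    -- `2k²≤μ`; its price is the exponent `2k` in place of about `k - 1`.
    decay : τ₁ * ((M - k) * v) ^ (2 ℕ.* kₙ) ≤ τ - σ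
    decay = ≤-trans
      (≤-reflexive (trans (cong (λ a → τ₁ * a ^ (2 ℕ.* kₙ)) r′≡)
        (trans (cong (τ₁ *_) (^-distrib-* r (1ℚ - y) (2 ℕ.* kₙ))) (sym (*-assoc τ₁ _ _)))))
      (≤-trans (*-monoʳ ((1ℚ - y) ^ (2 ℕ.* kₙ)) (0≤^ (2 ℕ.* kₙ) 0≤1-y) τ₁≤τ)
        (≤-trans (*-monoˡ τ 0≤τ halve) (≤-by (0≤a*b 0≤τ 0≤y) (eq τ k u))))
      where
      eq : ∀ τ k u → τ - (k - 1ℚ) * (k * τ * u) ≡ τ * (1ℚ - k * (k * u)) + τ * (k * u)
      eq = solve-∀ ring
      halve : (1ℚ - y) ^ (2 ℕ.* kₙ) ≤ 1ℚ - k * y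
      halve = *-cancelˡ-≤-pos 2ℚ (≤-trans
        (2[1-y]^n≤2-ny (2 ℕ.* kₙ) 0≤y 0≤1-y (≤-trans (≤-reflexive (cong (_* y) (fromℕ-c*k 2))) 2ky≤1))
        (≤-reflexive (trans (cong (λ a → 2ℚ - a * y) (fromℕ-c*k 2)) (eq′ k y))))
        where
        eq′ : ∀ k y → 1ℚ + 1ℚ - (1ℚ + 1ℚ) * k * y ≡ (1ℚ + 1ℚ) * (1ℚ - k * y)
        eq′ = solve-∀ ring

    σ≥0 : 0ℚ ≤ σ
    σ≥0 = 0≤a*b (a≤b⇒0≤b-a 1≤k) (0≤a*b (0≤a*b 0≤k 0≤τ) 0≤u)

    deviation-∷ : ∀ e → State.deviation (e ∷ es) (τ - σ) ≡ deviation′ e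
    deviation-∷ e = trans (∑-uncovered-∷ es e (λ x → (State.d (e ∷ es) x - (τ - σ)) *
      (State.d (e ∷ es) x - (τ - σ))))
      (∑-cong (uncovered es) (λ x → cong (λ a → (1ℚ - x ⊆ᵢ e) * ((a - (τ - σ)) * (a - (τ - σ)))) (d-∷ es e x)))

    ν≤ν̂ : ν ≤ ν̂
    ν≤ν̂ = +-monoʳ-≤ ((1ℚ + 1ℚ + 1ℚ + 1ℚ + 1ℚ) * (k * k) * K * D)
      (*-monoˡ (k * k * (k * k)) (0≤a*b (0≤a² k) (0≤a² k))
      (≤-trans (*-monoʳ u 0≤u (square-mono 0≤τ τ≤D)) (*-monoˡ (D * D) (0≤a² D) u≤v)))
      where
      u≤v : u ≤ v
      u≤v = ≤-trans (≤-reflexive (trans (sym (*-identityʳ u)) (trans (cong (u *_) (sym μ*v≡1)) (eq′ u μ v))))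
        (≤-trans (*-monoʳ (u * v) (0≤a*b 0≤u 0≤v) μ≤M) (≤-reflexive
          (trans (eq″ M u v) (trans (cong (_* v) M*u≡1) (*-identityˡ v)))))
        where
        eq′ : ∀ u μ v → u * (μ * v) ≡ μ * (u * v)
        eq′ = solve-∀ ring
        eq″ : ∀ M u v → M * (u * v) ≡ M * u * v
        eq″ = solve-∀ ring

    -- In a state that is not sparse `τ ≤ 2 Q k u`, so the growth term `2kτ` is at most `4ky` times
    -- the number `Q` of choices.
    ∑deviation-∷≤ : order * τ ≤ 2ℚ * (size * k) →
      ∑ A (λ e → State.deviation (e ∷ es) (τ - σ)) ≤ size * ((1ℚ + 4ℚ * k * y) * V + ν̂)
    ∑deviation-∷≤ many = ≤-trans (≤-reflexive (∑-cong A deviation-∷)) (≤-trans ∑deviation′≤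
      (≤-trans (+-mono-≤ (*-monoʳ V 0≤V (+-monoʳ-≤ size 2kτ≤)) (*-monoˡ size 0≤Q ν≤ν̂))
        (≤-reflexive (eq size V k u ν̂))))
      where
      0≤Q : 0ℚ ≤ size
      0≤Q = 0≤∑ A (λ _ → 0≤1)
      eq : ∀ Q V k u ν → (Q + (1ℚ + 1ℚ) * k * ((1ℚ + 1ℚ) * (Q * k) * u)) * V + Q * ν ≡
                         Q * ((1ℚ + (1ℚ + 1ℚ + (1ℚ + 1ℚ)) * k * (k * u)) * V + ν)
      eq = solve-∀ ring
      eq′ : ∀ M τ u → τ * (M * u) ≡ M * τ * u
      eq′ = solve-∀ ring
      τ≤ : τ ≤ 2ℚ * (size * k) * u
      τ≤ = ≤-trans (≤-reflexive (trans (sym (*-identityʳ τ)) (trans (cong (τ *_) (sym M*u≡1)) (eq′ M τ u))))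
        (*-monoʳ u 0≤u many)
      2kτ≤ : 2ℚ * k * τ ≤ 2ℚ * k * (2ℚ * (size * k) * u)
      2kτ≤ = *-monoˡ (2ℚ * k) (0≤a*b 0≤2 0≤k) τ≤

    step : ∀ {e as} → A ≡ e ∷ as → order * τ ≤ 2ℚ * (size * k) →
      (∀ {e} → e ∈ A → (1ℚ - Pr (continue n q t (e ∷ es)) P?) * (μ * (τ₁ * τ₁)) ≤
        4ℚ * (((M - k) * v) ^ (4 ℕ.* kₙ) * (State.deviation (e ∷ es) (τ - σ) + fromℕ j * ν̂))) →
      Goal (suc j) (suc t) es τ
    step {e} {as} A≡ many ih = *-cancelˡ-≤-pos size {{positive 0<size}} (≤-trans
        (≤-reflexive (trans (sym (*-assoc size fail F)) (trans (cong (_* F) average)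
          (sym (∑-*ʳ A F (λ e → 1ℚ - Pr (next e) P?))))))
        (≤-trans (∑-mono A ih)
        (≤-trans (≤-reflexive (trans (∑-*ˡ A 4ℚ _) (cong (4ℚ *_) (trans (∑-*ˡ A R′ _)
            (cong (R′ *_) (trans (∑-+ A (λ e → State.deviation (e ∷ es) (τ - σ)) (λ _ → fromℕ j * ν̂))
              (cong (S +_) (∑-const A (fromℕ j * ν̂)))))))))
        (≤-trans (*-monoˡ 4ℚ 0≤4 (*-monoˡ R′ 0≤R′ (+-monoˡ-≤ (size * (fromℕ j * ν̂)) (∑deviation-∷≤ many))))
        -- The noise is multiplied by the growth factor too, although only `V` requires it, so that
        -- `growth` applies to the whole bracket.
        (≤-trans (*-monoˡ 4ℚ 0≤4 (≤-by {R′ * (size * ((1ℚ + 4ℚ * k * y) * V + ν̂) + size * (fromℕ j * ν̂))}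
          (0≤a*b 0≤R′ (0≤a*b 0≤size (0≤a*b 0≤4ky (0≤a*b (0≤a+b 0≤1 (0≤fromℕ j)) 0≤ν̂))))
            (eq R′ size (4ℚ * k * y) V (fromℕ j) ν̂)))
        (≤-trans (*-monoˡ 4ℚ 0≤4 (*-monoʳ (size * (V + (1ℚ + fromℕ j) * ν̂))
            (0≤a*b 0≤size (0≤a+b 0≤V (0≤a*b (0≤a+b 0≤1 (0≤fromℕ j)) 0≤ν̂))) growth))
          (≤-reflexive (trans (eq′ (r ^ (4 ℕ.* kₙ)) size (V + (1ℚ + fromℕ j) * ν̂))
            (cong (λ a → size * (4ℚ * (r ^ (4 ℕ.* kₙ) * (V + a * ν̂)))) (sym (fromℕ-suc j)))))))))))
      where
      next : Subset n → Random (List (Subset n))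
      next e = continue n q t (e ∷ es)
      fail F R′ S : ℚ
      fail = 1ℚ - Pr (continue n q (suc t) es) P?
      F = μ * (τ₁ * τ₁)
      R′ = ((M - k) * v) ^ (4 ℕ.* kₙ)
      S = ∑ A (λ e → State.deviation (e ∷ es) (τ - σ))
      size≡ : size ≡ fromℕ (suc (length as))
      size≡ = trans (∑-length A) (cong (λ xs → fromℕ (length xs)) A≡)
      0<size : 0ℚ < size
      0<size = subst (0ℚ <_) (sym size≡) (<-≤-trans (positive⁻¹ 1ℚ) (fromℕ-mono (ℕ.s≤s (ℕ.z≤n {length as}))))
      0≤size : 0ℚ ≤ size
      0≤size = <⇒≤ 0<size
      0≤R′ : 0ℚ ≤ R′
      0≤R′ = 0≤^ (4 ℕ.* kₙ) (subst (0ℚ ≤_) (sym r′≡) (0≤a*b 0≤r 0≤1-y))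
      0≤4ky : 0ℚ ≤ 4ℚ * k * y
      0≤4ky = 0≤a*b (0≤a*b 0≤4 0≤k) 0≤y
      Pr≡ : size * Pr (continue n q (suc t) es) P? ≡ ∑ A (λ e → Pr (next e) P?)
      Pr≡ = trans (cong₂ (λ a b → a * Pr b P?) size≡ (continue-draw n q t es A≡))
        (trans (mean P? (length as) (λ i → next (lookup (e ∷ as) i)))
          (trans (∑-lookup (e ∷ as) (λ e → Pr (next e) P?)) (cong (λ xs → ∑ xs (λ e → Pr (next e) P?)) (sym A≡))))
      average : size * fail ≡ ∑ A (λ e → 1ℚ - Pr (next e) P?)
      average = trans (eq₁ size (Pr (continue n q (suc t) es) P?)) (trans (cong (λ a → 1ℚ * size + - 1ℚ * a) Pr≡)
        (sym (trans (∑-cong A (λ e → eq₂ (Pr (next e) P?))) (∑-lin₂ A 1ℚ (λ _ → 1ℚ) (- 1ℚ)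
          (λ e → Pr (next e) P?)))))
        where
        eq₁ : ∀ s p → s * (1ℚ - p) ≡ 1ℚ * s + - 1ℚ * (s * p)
        eq₁ = solve-∀ ring
        eq₂ : ∀ p → 1ℚ - p ≡ 1ℚ * 1ℚ + - 1ℚ * p
        eq₂ = solve-∀ ring
      eq : ∀ R s g V j ν → R * (1ℚ + g) * (s * (V + (1ℚ + j) * ν)) ≡
        R * (s * ((1ℚ + g) * V + ν) + s * (j * ν)) + R * (s * (g * ((1ℚ + j) * ν)))
      eq = solve-∀ ring
      eq′ : ∀ R s W → (1ℚ + 1ℚ + (1ℚ + 1ℚ)) * (R * (s * W)) ≡ s * ((1ℚ + 1ℚ + (1ℚ + 1ℚ)) * (R * W))
      eq′ = solve-∀ ring

  -- Induction on the number `j` of edges still wanted. At `j = 0` the outcome is good whatever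
  -- follows, as the process only adds edges. The bound on `t` ensures that the process is not cut
  -- off while sets are available.
  failure≤ : ∀ j t es τ → length (available n q es) ℕ.≤ t →
    State.order es ≡ μ + fromℕ j * k → τ ≤ D → τ₁ * (State.order es * v) ^ (2 ℕ.* kₙ) ≤ τ →
    (∀ H → length es ℕ.+ j ℕ.≤ length H → P H) → Goal j t es τ
  failure≤ zero t es τ fuel order≡ τ≤D τ₁≤τ enough = ≤-trans
    (≤-by {b = 0ℚ} (0≤a*b (a≤b⇒0≤b-a 1≤p) (0≤a*b 0≤μ (0≤a² τ₁))) (eq p (μ * (τ₁ * τ₁))))
    (0≤a*b 0≤4 (0≤a*b (0≤^ (4 ℕ.* kₙ) (0≤a*b (0≤∑ (uncovered es) (λ _ → 0≤1)) 0≤v))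
      (0≤a+b (0≤∑ (uncovered es) (λ x → 0≤a² (State.d es x - τ))) (0≤a*b (0≤fromℕ zero) 0≤ν̂))))
    where
    p : ℚ
    p = Pr (continue n q t es) P?
    1≤p : 1ℚ ≤ p
    1≤p = Surely⇒1≤Pr P? (continue n q t es) (Surely-map
      (λ {H} long → enough H (subst (ℕ._≤ length H) (sym (ℕ.+-identityʳ (length es))) long))
      (continue n q t es) (continue-extends n q t es))
    eq : ∀ p F → 0ℚ ≡ (1ℚ - p) * F + (p - 1ℚ) * F
    eq = solve-∀ ring
  failure≤ (suc j) t es τ fuel order≡ τ≤D τ₁≤τ enough = cases t fuel (available n q es) refl
    where
    μ≤M : μ ≤ State.order es
    μ≤M = ≤-by (0≤a*b (0≤fromℕ (suc j)) 0≤k) order≡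
    0≤τ : 0ℚ ≤ τ
    0≤τ = ≤-trans (0≤a*b 0≤τ₁ (0≤^ (2 ℕ.* kₙ) (0≤a*b (≤-trans 0≤μ μ≤M) 0≤v))) τ₁≤τ
    eq : ∀ k → (1ℚ + 1ℚ) * (0ℚ * k) ≡ 0ℚ
    eq = solve-∀ ring
    eq′ : ∀ μ j k → μ + (1ℚ + j) * k - k ≡ μ + j * k
    eq′ = solve-∀ ring
    eq″ : ∀ a b → a ≡ a - b + b
    eq″ = solve-∀ ring
    cases : ∀ t → length (available n q es) ℕ.≤ t → ∀ A → available n q es ≡ A → Goal (suc j) t es τ
    -- A stuck process is a sparse state with `size` equal to 0.
    cases t fuel [] A≡ = At.sparse (suc j) t es τ μ≤M τ≤D τ₁≤τ
      (≤-trans (≤-reflexive (trans (cong (λ xs → 2ℚ * (∑ xs (λ _ → 1ℚ) * k)) A≡) (eq k)))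
        (0≤a*b (≤-trans 0≤μ μ≤M) 0≤τ))
    cases zero fuel (e ∷ as) A≡ = contradiction (subst (λ xs → length xs ℕ.≤ 0) A≡ fuel) λ ()
    cases (suc t) fuel (e ∷ as) A≡ = [ At.sparse (suc j) (suc t) es τ μ≤M τ≤D τ₁≤τ ,
      (λ many → step A≡ many next) ]′
      (≤-total (2ℚ * (State.size es * k)) (State.order es * τ))
      where
      open At j t es τ μ≤M τ≤D τ₁≤τ
      next : ∀ {e} → e ∈ available n q es → (1ℚ - Pr (continue n q t (e ∷ es)) P?) * (μ * (τ₁ * τ₁)) ≤
        (2ℚ + 2ℚ) * (((State.order es - k) * v) ^ (4 ℕ.* kₙ) * (State.deviation (e ∷ es) (τ - σ) + fromℕ j * ν̂))
      next {e} e∈ = subst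
        (λ M → (1ℚ - Pr (continue n q t (e ∷ es)) P?) * (μ * (τ₁ * τ₁)) ≤
               (2ℚ + 2ℚ) * ((M * v) ^ (4 ℕ.* kₙ) * (State.deviation (e ∷ es) (τ - σ) + fromℕ j * ν̂)))
        (order-∷ es e∈)
        (failure≤ j t (e ∷ es) (τ - σ)
          (ℕ.≤-pred (ℕ.≤-trans (available-shrinks n q 2≤q es e∈) fuel))
          (trans (order-∷ es e∈) (trans (cong (_- k) (trans order≡ (cong (λ a → μ + a * k) (fromℕ-suc j))))
            (eq′ μ (fromℕ j) k)))
          (≤-trans (≤-by {τ - σ} σ≥0 (eq″ τ σ)) τ≤D)
          (subst (λ M → τ₁ * (M * v) ^ (2 ℕ.* kₙ) ≤ τ - σ) (sym (order-∷ es e∈)) decay)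
          (λ H long → enough H (subst (ℕ._≤ length H) (sym (ℕ.+-suc (length es) j)) long)))

-- Choice of parameters

n≤2^n : ∀ n → n ℕ.≤ 2 ℕ.^ n
n≤2^n zero    = ℕ.z≤n
n≤2^n (suc n) = ℕ.≤-trans (ℕ.+-mono-≤ (ℕ.m^n>0 2 n) (n≤2^n n))
  (ℕ.≤-reflexive (cong (2 ℕ.^ n ℕ.+_) (sym (ℕ.+-identityʳ (2 ℕ.^ n)))))

2^⌊log₂n⌋≤n : ∀ n → 1 ℕ.≤ n → 2 ℕ.^ ⌊log₂ n ⌋ ℕ.≤ n
2^⌊log₂n⌋≤n = <-rec (λ n → 1 ℕ.≤ n → 2 ℕ.^ ⌊log₂ n ⌋ ℕ.≤ n) λ where
  1                 rec _ → ℕ.≤-refl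
  n@(suc (suc n-2)) rec _ → ℕ.≤-trans (ℕ.^-monoʳ-≤ 2 (ℕ.m≤n+m∸n ⌊log₂ n ⌋ 1))
    (ℕ.≤-trans (ℕ.*-monoʳ-≤ 2 (subst (λ l → 2 ℕ.^ l ℕ.≤ ℕ.⌊ n /2⌋) (⌊log₂⌊n/2⌋⌋≡⌊log₂n⌋∸1 n)
      (rec (ℕ.⌊n/2⌋<n (suc n-2)) (ℕ.s≤s ℕ.z≤n))))
      (ℕ.≤-trans (ℕ.≤-reflexive (cong (ℕ.⌊ n /2⌋ ℕ.+_) (ℕ.+-identityʳ ℕ.⌊ n /2⌋)))
        (ℕ.≤-trans (ℕ.+-monoʳ-≤ ℕ.⌊ n /2⌋ (ℕ.⌊n/2⌋≤⌈n/2⌉ n)) (ℕ.≤-reflexive (ℕ.⌊n/2⌋+⌈n/2⌉≡n n)))))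

module Budget (q s n k N : ℕ) (2≤q : 2 ℕ.≤ q) (1≤s : 1 ℕ.≤ s)
  (2k≡ : 2 ℕ.* k ≡ q ℕ.* (q ∸ 1)) (2N≡ : 2 ℕ.* N ≡ n ℕ.* (n ∸ 1))
  (2^≤n : 2 ℕ.^ (s ℕ.* (16 ℕ.* (q ℕ.* q))) ℕ.≤ n) where

  private
    -- Everything is measured in powers of `Z`. The numbers `q`, `k` and `h` are at most `Z`, and
    -- `(2h)^(8k + 2)` is at most `Z^9`. In `error≤n` this gives `9 + 4 + 1` factors, and the
    -- constant 64 costs two more, whence the 16 in the exponent of the hypothesis.
    h Y Z : ℕ
    h = 2 ℕ.^ s
    Y = s ℕ.* (q ℕ.* q)
    Z = 2 ℕ.^ Y

    Z^16≤n : Z ℕ.^ 16 ℕ.≤ n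
    Z^16≤n = subst (ℕ._≤ n) (trans (cong (2 ℕ.^_) (eq s (q ℕ.* q))) (sym (ℕ.^-*-assoc 2 Y 16))) 2^≤n
      where
      eq : ∀ s p → s ℕ.* (16 ℕ.* p) ≡ s ℕ.* p ℕ.* 16
      eq = ℕ.solve-∀

    4≤q² : 4 ℕ.≤ q ℕ.* q
    4≤q² = ℕ.*-mono-≤ 2≤q 2≤q

    q²≤Y : q ℕ.* q ℕ.≤ Y
    q²≤Y = ℕ.≤-trans (ℕ.≤-reflexive (sym (ℕ.*-identityˡ (q ℕ.* q)))) (ℕ.*-monoˡ-≤ (q ℕ.* q) 1≤s)

    16≤Z : 16 ℕ.≤ Z
    16≤Z = ℕ.^-monoʳ-≤ 2 (ℕ.≤-trans 4≤q² q²≤Y)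

    q²≤Z : q ℕ.* q ℕ.≤ Z
    q²≤Z = ℕ.≤-trans (ℕ.*-mono-≤ (n≤2^n q) (n≤2^n q)) (ℕ.≤-trans (ℕ.≤-reflexive (sym (ℕ.^-distribˡ-+-* 2 q q)))
      (ℕ.^-monoʳ-≤ 2 (ℕ.≤-trans (ℕ.≤-reflexive (cong (q ℕ.+_) (sym (ℕ.+-identityʳ q))))
        (ℕ.≤-trans (ℕ.*-monoˡ-≤ q 2≤q) q²≤Y))))

    q≤Z : q ℕ.≤ Z
    q≤Z = ℕ.≤-trans (ℕ.≤-trans (ℕ.≤-reflexive (sym (ℕ.*-identityˡ q)))
      (ℕ.*-monoˡ-≤ q (ℕ.≤-trans (ℕ.n≤1+n 1) 2≤q))) q²≤Z

    2k≤q² : 2 ℕ.* k ℕ.≤ q ℕ.* q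
    2k≤q² = ℕ.≤-trans (ℕ.≤-reflexive 2k≡) (ℕ.*-monoʳ-≤ q (ℕ.m∸n≤m q 1))

    k≤Z : k ℕ.≤ Z
    k≤Z = ℕ.≤-trans (ℕ.m≤m+n k (k ℕ.+ 0)) (ℕ.≤-trans 2k≤q² q²≤Z)

    h≤Z : h ℕ.≤ Z
    h≤Z = ℕ.^-monoʳ-≤ 2 (ℕ.≤-trans (ℕ.≤-reflexive (sym (ℕ.*-identityʳ s)))
      (ℕ.*-monoʳ-≤ s (ℕ.≤-trans (ℕ.s≤s ℕ.z≤n) 4≤q²)))

    Z≤n : Z ℕ.≤ n
    Z≤n = ℕ.≤-trans (ℕ.≤-reflexive (sym (ℕ.*-identityʳ Z)))
      (ℕ.≤-trans (ℕ.*-monoʳ-≤ Z (subst (1 ℕ.≤_) (sym (ℕ.^-*-assoc 2 Y 15)) (ℕ.m^n>0 2 (Y ℕ.* 15)))) Z^16≤n)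

    exponent≤ : suc s ℕ.* (8 ℕ.* k ℕ.+ 2) ℕ.≤ Y ℕ.* 9
    exponent≤ = ℕ.≤-trans (ℕ.*-mono-≤ (ℕ.+-monoˡ-≤ s 1≤s) (ℕ.+-monoˡ-≤ 2 8k≤))
      (ℕ.≤-trans (ℕ.≤-reflexive (eq s (q ℕ.* q))) (ℕ.≤-trans (ℕ.+-monoʳ-≤ (8 ℕ.* Y) (ℕ.*-monoʳ-≤ s 4≤q²))
        (ℕ.≤-reflexive (eq′ Y))))
      where
      8k≤ : 8 ℕ.* k ℕ.≤ 4 ℕ.* (q ℕ.* q)
      8k≤ = ℕ.≤-trans (ℕ.≤-reflexive (eq k)) (ℕ.*-monoʳ-≤ 4 2k≤q²)
        where
        eq : ∀ k → 8 ℕ.* k ≡ 4 ℕ.* (2 ℕ.* k)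
        eq = ℕ.solve-∀
      eq : ∀ s p → (s ℕ.+ s) ℕ.* (4 ℕ.* p ℕ.+ 2) ≡ 8 ℕ.* (s ℕ.* p) ℕ.+ s ℕ.* 4
      eq = ℕ.solve-∀
      eq′ : ∀ Y → 8 ℕ.* Y ℕ.+ Y ≡ Y ℕ.* 9
      eq′ = ℕ.solve-∀

    power≤ : (2 ℕ.* h) ℕ.^ (8 ℕ.* k ℕ.+ 2) ℕ.≤ Z ℕ.^ 9
    power≤ = ℕ.≤-trans (ℕ.≤-reflexive (ℕ.^-*-assoc 2 (suc s) (8 ℕ.* k ℕ.+ 2)))
      (ℕ.≤-trans (ℕ.^-monoʳ-≤ 2 exponent≤) (ℕ.≤-reflexive (sym (ℕ.^-*-assoc 2 Y 9))))

  error≤n : 4 ℕ.* (2 ℕ.* h) ℕ.^ (8 ℕ.* k ℕ.+ 2) ℕ.*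
    (15 ℕ.* (k ℕ.* k ℕ.* k ℕ.* q) ℕ.+ k ℕ.* k ℕ.* k ℕ.* k) ℕ.* h ℕ.≤ n
  error≤n = ℕ.≤-trans
    (ℕ.*-mono-≤ (ℕ.*-mono-≤ (ℕ.*-monoʳ-≤ 4 power≤)
      (ℕ.+-mono-≤ (ℕ.*-monoʳ-≤ 15 (ℕ.*-mono-≤ k³≤ q≤Z)) (ℕ.*-mono-≤ k³≤ k≤Z))) h≤Z)
    (ℕ.≤-trans (ℕ.≤-reflexive (eq (Z ℕ.^ 9) Z))
      (ℕ.≤-trans (ℕ.*-monoˡ-≤ (Z ℕ.^ 9 ℕ.* (Z ℕ.* Z ℕ.* Z ℕ.* Z ℕ.* Z)) 64≤Z²)
        (ℕ.≤-trans (ℕ.≤-reflexive (trans (eq′ (Z ℕ.^ 9) Z) (sym (ℕ.^-distribˡ-+-* Z 9 7)))) Z^16≤n)))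
    where
    k³≤ : k ℕ.* k ℕ.* k ℕ.≤ Z ℕ.* Z ℕ.* Z
    k³≤ = ℕ.*-mono-≤ (ℕ.*-mono-≤ k≤Z k≤Z) k≤Z
    64≤Z² : 64 ℕ.≤ Z ℕ.* Z
    64≤Z² = ℕ.≤-trans (ℕ.m≤m+n 64 192) (ℕ.*-mono-≤ 16≤Z 16≤Z)
    eq : ∀ W Z → 4 ℕ.* W ℕ.* (15 ℕ.* (Z ℕ.* Z ℕ.* Z ℕ.* Z) ℕ.+ Z ℕ.* Z ℕ.* Z ℕ.* Z) ℕ.* Z ≡
                 64 ℕ.* (W ℕ.* (Z ℕ.* Z ℕ.* Z ℕ.* Z ℕ.* Z))
    eq = ℕ.solve-∀
    eq′ : ∀ W Z → Z ℕ.* Z ℕ.* (W ℕ.* (Z ℕ.* Z ℕ.* Z ℕ.* Z ℕ.* Z)) ≡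
                  W ℕ.* (Z ℕ.* (Z ℕ.* (Z ℕ.* (Z ℕ.* (Z ℕ.* (Z ℕ.* (Z ℕ.* 1)))))))
    eq′ = ℕ.solve-∀

  3≤n : 3 ℕ.≤ n
  3≤n = ℕ.≤-trans (ℕ.≤-trans (ℕ.m≤m+n 3 13) 16≤Z) Z≤n

  q≤n : q ℕ.≤ n
  q≤n = ℕ.≤-trans q≤Z Z≤n

  n≤N : n ℕ.≤ N
  n≤N = ℕ.*-cancelˡ-≤ 2 (ℕ.≤-trans (ℕ.≤-reflexive (ℕ.*-comm 2 n))
    (ℕ.≤-trans (ℕ.*-monoʳ-≤ n (ℕ.∸-monoˡ-≤ 1 3≤n)) (ℕ.≤-reflexive (sym 2N≡))))

  4hk²≤N : 4 ℕ.* h ℕ.* (k ℕ.* k) ℕ.≤ N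
  4hk²≤N = ℕ.≤-trans (ℕ.*-mono-≤ (ℕ.*-mono-≤ (ℕ.≤-trans (ℕ.m≤m+n 4 12) 16≤Z) h≤Z) (ℕ.*-mono-≤ k≤Z k≤Z))
    (ℕ.≤-trans (ℕ.≤-reflexive (eq Z))
      (ℕ.≤-trans (ℕ.*-monoʳ-≤ (Z ℕ.^ 4) (subst (1 ℕ.≤_) (sym (ℕ.^-*-assoc 2 Y 12)) (ℕ.m^n>0 2 (Y ℕ.* 12))))
        (ℕ.≤-trans (ℕ.≤-reflexive (sym (ℕ.^-distribˡ-+-* Z 4 12))) (ℕ.≤-trans Z^16≤n n≤N))))
    where
    eq : ∀ Z → Z ℕ.* Z ℕ.* (Z ℕ.* Z) ≡ Z ℕ.* (Z ℕ.* (Z ℕ.* (Z ℕ.* 1))) ℕ.* 1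
    eq = ℕ.solve-∀

module _ (h k N : ℕ) (1≤h : 1 ℕ.≤ h) (1≤k : 1 ℕ.≤ k) (4hk²≤N : 4 ℕ.* h ℕ.* (k ℕ.* k) ℕ.≤ N) where

  private
    c a : ℕ
    c = h ℕ.* k
    a = (h ∸ 1) ℕ.* N

    instance
      c-nonZero : NonZero c
      c-nonZero = ℕ.m*n≢0 h k {{ℕ.>-nonZero 1≤h}} {{ℕ.>-nonZero 1≤k}}
      h-nonZero : NonZero h
      h-nonZero = ℕ.>-nonZero 1≤h

    -- The least integer above `(1 - 1/h) N / k`: enough edges for the claim, while about `N / h`
    -- pairs remain uncovered.
    m : ℕ
    m = suc (a ℕ./ c)

    a≤mc : a ℕ.≤ m ℕ.* c
    a≤mc = ℕ.≤-trans (ℕ.≤-reflexive (ℕ.m≡m%n+[m/n]*n a c)) (ℕ.+-monoˡ-≤ (a ℕ./ c ℕ.* c) (ℕ.<⇒≤ (ℕ.m%n<n a c)))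

    mc≤a+c : m ℕ.* c ℕ.≤ a ℕ.+ c
    mc≤a+c = ℕ.≤-trans (ℕ.+-monoʳ-≤ c (ℕ.m/n*n≤m a c)) (ℕ.≤-reflexive (ℕ.+-comm c a))

    2c≤N : 2 ℕ.* c ℕ.≤ N
    2c≤N = ℕ.≤-trans (ℕ.≤-trans (ℕ.≤-reflexive (sym (ℕ.*-identityʳ (2 ℕ.* c))))
      (ℕ.≤-trans (ℕ.*-mono-≤ (ℕ.*-monoˡ-≤ c (ℕ.m≤m+n 2 2)) 1≤k) (ℕ.≤-reflexive (eq h k)))) 4hk²≤N
      where
      eq : ∀ h k → 4 ℕ.* (h ℕ.* k) ℕ.* k ≡ 4 ℕ.* h ℕ.* (k ℕ.* k)
      eq = ℕ.solve-∀

    hN≡ : h ℕ.* N ≡ a ℕ.+ N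
    hN≡ = trans (cong (ℕ._* N) (sym (ℕ.m∸n+n≡m 1≤h))) (trans (ℕ.*-distribʳ-+ N (h ∸ 1) 1)
      (cong (a ℕ.+_) (ℕ.*-identityˡ N)))

    eq₁ : ∀ h m k → h ℕ.* (m ℕ.* k) ≡ m ℕ.* (h ℕ.* k)
    eq₁ = ℕ.solve-∀

    mk≤N : m ℕ.* k ℕ.≤ N
    mk≤N = ℕ.*-cancelˡ-≤ h (ℕ.≤-trans (ℕ.≤-reflexive (eq₁ h m k)) (ℕ.≤-trans mc≤a+c
      (ℕ.≤-trans (ℕ.+-monoʳ-≤ a (ℕ.≤-trans (ℕ.m≤m+n c (c ℕ.+ 0)) 2c≤N)) (ℕ.≤-reflexive (sym hN≡)))))

    M : ℕ
    M = N ∸ m ℕ.* k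

    -- Rounding costs at most `h k` in `h m k`, so `h M ≥ N - h k`, and `2 h k ≤ N` makes this at
    -- least `N / 2`.
    N≤2hM : N ℕ.≤ 2 ℕ.* h ℕ.* M
    N≤2hM = ℕ.+-cancelʳ-≤ (2 ℕ.* (m ℕ.* c)) N (2 ℕ.* h ℕ.* M) (ℕ.≤-trans
      (ℕ.+-monoʳ-≤ N (ℕ.*-monoʳ-≤ 2 mc≤a+c))
      (ℕ.≤-trans (ℕ.≤-reflexive (eq N a c)) (ℕ.≤-trans (ℕ.+-monoˡ-≤ (N ℕ.+ 2 ℕ.* a) 2c≤N) (ℕ.≤-reflexive
        (trans (eq′ N a) (trans (cong (2 ℕ.*_) (sym hN≡)) (trans
          (cong (λ N → 2 ℕ.* (h ℕ.* N)) (sym (ℕ.m∸n+n≡m mk≤N))) (eq″ h M m k))))))))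
      where
      eq : ∀ N a c → N ℕ.+ 2 ℕ.* (a ℕ.+ c) ≡ 2 ℕ.* c ℕ.+ (N ℕ.+ 2 ℕ.* a)
      eq = ℕ.solve-∀
      eq′ : ∀ N a → N ℕ.+ (N ℕ.+ 2 ℕ.* a) ≡ 2 ℕ.* (a ℕ.+ N)
      eq′ = ℕ.solve-∀
      eq″ : ∀ h M m k → 2 ℕ.* (h ℕ.* (M ℕ.+ m ℕ.* k)) ≡ 2 ℕ.* h ℕ.* M ℕ.+ 2 ℕ.* (m ℕ.* (h ℕ.* k))
      eq″ = ℕ.solve-∀

    2k²≤M : 2 ℕ.* (k ℕ.* k) ℕ.≤ M
    2k²≤M = ℕ.*-cancelˡ-≤ (2 ℕ.* h) {{ℕ.m*n≢0 2 h}} (ℕ.≤-trans (ℕ.≤-reflexive (eq h k)) (ℕ.≤-trans 4hk²≤N N≤2hM))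
      where
      eq : ∀ h k → 2 ℕ.* h ℕ.* (2 ℕ.* (k ℕ.* k)) ≡ 4 ℕ.* h ℕ.* (k ℕ.* k)
      eq = ℕ.solve-∀

  choose-steps : ∃₂ λ m M → M ℕ.+ m ℕ.* k ≡ N × N ℕ.≤ 2 ℕ.* h ℕ.* M ×
                            (h ∸ 1) ℕ.* N ℕ.≤ m ℕ.* (h ℕ.* k) × 2 ℕ.* (k ℕ.* k) ℕ.≤ M
  choose-steps = m , M , ℕ.m∸n+n≡m mk≤N , N≤2hM , a≤mc , 2k²≤M

-- From the invariant to an explicit failure bound

^-mono : ∀ {a b} n → 0ℚ ≤ a → a ≤ b → a ^ n ≤ b ^ n
^-mono         zero    0≤a a≤b = ≤-refl
^-mono {a} {b} (suc n) 0≤a a≤b = ≤-trans (*-monoˡ a 0≤a (^-mono n 0≤a a≤b))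
  (*-monoʳ (b ^ n) (0≤^ n (≤-trans 0≤a a≤b)) a≤b)

1^n≡1 : ∀ n → 1ℚ ^ n ≡ 1ℚ
1^n≡1 zero    = refl
1^n≡1 (suc n) = trans (*-identityˡ (1ℚ ^ n)) (1^n≡1 n)

fromℕ-^ : ∀ a n → fromℕ (a ℕ.^ n) ≡ fromℕ a ^ n
fromℕ-^ a zero    = refl
fromℕ-^ a (suc n) = trans (fromℕ-* a (a ℕ.^ n)) (cong (fromℕ a *_) (fromℕ-^ a n))

-- `between-≤` compares the two counts with `n - 2` in place of `n`, and `n ≤ 3 (n - 2)` costs the
-- factor 3.
codegree-ratio : ∀ n q → 3 ℕ.≤ n → n ℕ.* between 3 (n ∸ 3) q ℕ.≤ 3 ℕ.* (q ℕ.* between 2 (n ∸ 2) q)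
codegree-ratio n@(suc (suc (suc m))) q (ℕ.s≤s (ℕ.s≤s (ℕ.s≤s _))) = ℕ.≤-trans
  (ℕ.*-monoˡ-≤ (between 3 m q) (ℕ.≤-trans (ℕ.m≤m+n (3 ℕ.+ m) (2 ℕ.* m)) (ℕ.≤-reflexive (eq m))))
  (ℕ.≤-trans (ℕ.≤-reflexive (ℕ.*-assoc 3 (suc m) (between 3 m q))) (ℕ.*-monoʳ-≤ 3 (between-≤ 2 m q)))
  where
  eq : ∀ m → 3 ℕ.+ m ℕ.+ 2 ℕ.* m ≡ 3 ℕ.* suc m
  eq = ℕ.solve-∀

module Start (n q : ℕ) (3≤n : 3 ℕ.≤ n) where
  open Pairs n q 3≤n

  order-[] : State.order [] ≡ fromℕ (between 0 n 2)
  order-[] = trans (∑-filter (uncovered? []) pairs (λ _ → 1ℚ))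
    -- All pairs are counted as the pairs inside the full set.
    (trans (∑-cong pairs (λ x → sym (𝟙-true (x ⊆? ⊤ {n}) ⊆⊤)))
      (trans (∑-subsetsOf (⊤ {n}) 2) (cong (λ a → fromℕ (between 0 a 2)) (∣⊤∣≡n n))))

  d-[] : ∀ {x} → x ∈ uncovered [] → State.d [] x ≡ D
  d-[] {x} x∈ = trans (∑-filter (meetsAtMostOnce? []) (qSubsets n q) (λ c → x ⊆ᵢ c))
    (trans (∑-cong (qSubsets n q) (λ c → *-identityˡ (x ⊆ᵢ c)))
      (trans (∑-supersets x q) (cong (λ a → fromℕ (between a (n ∸ a) q)) (uncovered⁻ [] x∈))))

  deviation-[] : State.deviation [] D ≡ 0ℚ
  deviation-[] = trans (∑-cong∈ (uncovered []) (λ x∈ → trans (cong (λ a → (a - D) * (a - D)) (d-[] x∈))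
    (eq D))) (∑-zero (uncovered []))
    where
    eq : ∀ D → (D - D) * (D - D) ≡ 0ℚ
    eq = solve-∀ ring

module _ (n q s : ℕ) (2≤q : 2 ℕ.≤ q) (1≤s : 1 ℕ.≤ s) (2^≤n : 2 ℕ.^ (s ℕ.* (16 ℕ.* (q ℕ.* q))) ℕ.≤ n)
  (δ : ℚ) (h*δ≡1 : fromℕ (2 ℕ.^ s) * δ ≡ 1ℚ) where

  private
    kₙ N h : ℕ
    kₙ = between 0 q 2
    N  = between 0 n 2
    h  = 2 ℕ.^ s

    open Budget q s n kₙ N 2≤q 1≤s (2*between-0-2 q) (2*between-0-2 n) 2^≤n
    open Pairs n q 3≤n
    open Start n q 3≤n

    1≤h : 1 ℕ.≤ h
    1≤h = ℕ.m^n>0 2 s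

    1≤kₙ : 1 ℕ.≤ kₙ
    1≤kₙ = between-positive 0 q {2} ℕ.z≤n 2≤q

    0<fromℕ : ∀ {a} → 1 ℕ.≤ a → 0ℚ < fromℕ a
    0<fromℕ 1≤a = <-≤-trans (positive⁻¹ 1ℚ) (fromℕ-mono 1≤a)

  module _ {P : List (Subset n) → Set} (P? : Decidable P) (m M : ℕ) (M+mk≡N : M ℕ.+ m ℕ.* kₙ ≡ N)
    (N≤2hM : N ℕ.≤ 2 ℕ.* h ℕ.* M) (2k²≤M : 2 ℕ.* (kₙ ℕ.* kₙ) ℕ.≤ M)
    (enough : ∀ H → m ℕ.≤ length H → P H) where

    private
      1≤M : 1 ℕ.≤ M
      1≤M = ℕ.≤-trans (ℕ.*-mono-≤ (ℕ.s≤s (ℕ.z≤n {1})) (ℕ.*-mono-≤ 1≤kₙ 1≤kₙ)) 2k²≤M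

      μ v w r g : ℚ
      μ = fromℕ M
      v = proj₁ (inverse (0<fromℕ 1≤M))
      r = fromℕ N * v
      g = fromℕ (2 ℕ.* h)

      μ*v≡1 : μ * v ≡ 1ℚ
      μ*v≡1 = proj₁ (proj₂ (inverse (0<fromℕ 1≤M)))
      0≤v : 0ℚ ≤ v
      0≤v = proj₂ (proj₂ (inverse (0<fromℕ 1≤M)))

      1≤N : 1 ℕ.≤ N
      1≤N = ℕ.≤-trans (ℕ.≤-trans (ℕ.s≤s ℕ.z≤n) 3≤n) n≤N

      w = μ * proj₁ (inverse (0<fromℕ 1≤N))

      w*r≡1 : w * r ≡ 1ℚ
      w*r≡1 = trans (eq μ (proj₁ (inverse (0<fromℕ 1≤N))) (fromℕ N) v)
        (cong₂ _*_ μ*v≡1 (proj₁ (proj₂ (inverse (0<fromℕ 1≤N)))))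
        where
        eq : ∀ μ u N v → μ * u * (N * v) ≡ μ * v * (N * u)
        eq = solve-∀ ring

      0≤w : 0ℚ ≤ w
      0≤w = 0≤a*b (0≤fromℕ M) (proj₂ (proj₂ (inverse (0<fromℕ 1≤N))))

      0≤r : 0ℚ ≤ r
      0≤r = 0≤a*b (0≤fromℕ N) 0≤v

      1≤r : 1ℚ ≤ r
      1≤r = ≤-trans (≤-reflexive (sym μ*v≡1)) (*-monoʳ v 0≤v
        (fromℕ-mono (subst (M ℕ.≤_) M+mk≡N (ℕ.m≤m+n M (m ℕ.* kₙ)))))

      r≤g : r ≤ g
      r≤g = ≤-trans (*-monoʳ v 0≤v (fromℕ-mono N≤2hM)) (≤-reflexive
        (trans (cong (_* v) (fromℕ-* (2 ℕ.* h) M)) (trans (*-assoc g μ v)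
          (trans (cong (g *_) μ*v≡1) (*-identityʳ g)))))

      -- `X` is `(M / N)^(2k)` and `R` is its inverse. With `τ₁ = D * X` the lower bound on the
      -- trajectory demanded by `failure≤` is an equality at the start, where τ is `D`.
      X R τ₁ D′ : ℚ
      X  = w ^ (2 ℕ.* kₙ)
      R  = r ^ (2 ℕ.* kₙ)
      τ₁ = D * X
      D′ = D * D

      X*R≡1 : X * R ≡ 1ℚ
      X*R≡1 = trans (sym (^-distrib-* w r (2 ℕ.* kₙ))) (trans (cong (_^ (2 ℕ.* kₙ)) w*r≡1) (1^n≡1 (2 ℕ.* kₙ)))

      0≤R : 0ℚ ≤ R
      0≤R = 0≤^ (2 ℕ.* kₙ) 0≤r

      0≤D : 0ℚ ≤ D
      0≤D = 0≤fromℕ (between 2 (n ∸ 2) q)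

      0≤τ₁ : 0ℚ ≤ τ₁
      0≤τ₁ = 0≤a*b 0≤D (0≤^ (2 ℕ.* kₙ) 0≤w)

      2k²≤μ : 2ℚ * (k * k) ≤ μ
      2k²≤μ = ≤-trans (≤-reflexive (sym (trans (fromℕ-* 2 (kₙ ℕ.* kₙ)) (cong (2ℚ *_) (fromℕ-* kₙ kₙ)))))
        (fromℕ-mono 2k²≤M)

      open Run n q 3≤n 2≤q μ v τ₁ μ*v≡1 0≤v (0<fromℕ 1≤M) 0≤τ₁ 2k²≤μ P? using (failure≤; ν̂)

      fail : ℚ
      fail = 1ℚ - Pr (linearProcess n q) P?

      raw : fail * (μ * (τ₁ * τ₁)) ≤ (2ℚ + 2ℚ) * (r ^ (4 ℕ.* kₙ) * (0ℚ + fromℕ m * ν̂))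
      raw = subst₂ (λ M V → fail * (μ * (τ₁ * τ₁)) ≤ (2ℚ + 2ℚ) * ((M * v) ^ (4 ℕ.* kₙ) * (V + fromℕ m * ν̂)))
        order-[] deviation-[]
        (failure≤ m (length (qSubsets n q)) [] D (length-filter (meetsAtMostOnce? []) (qSubsets n q))
          (trans order-[] (trans (cong fromℕ (sym M+mk≡N)) (trans (fromℕ-+ M (m ℕ.* kₙ))
            (cong (μ +_) (fromℕ-* m kₙ)))))
          ≤-refl
          (≤-reflexive (trans (cong (λ M → τ₁ * (M * v) ^ (2 ℕ.* kₙ)) order-[])
            (trans (*-assoc D X R) (trans (cong (D *_) X*R≡1) (*-identityʳ D)))))
          enough)

      r^4k : r ^ (4 ℕ.* kₙ) ≡ R * R
      r^4k = trans (cong (r ^_) (eq kₙ)) (^-homo-* r (2 ℕ.* kₙ) (2 ℕ.* kₙ))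
        where
        eq : ∀ k → 4 ℕ.* k ≡ 2 ℕ.* k ℕ.+ 2 ℕ.* k
        eq = ℕ.solve-∀

      -- One factor `R * R` is the growth of the potential, the other undoes `X * X` in `τ₁ * τ₁`.
      -- Together they are `r^(8k)`, the origin of the exponent in the final error.
      unscaled : fail * μ * D′ ≤ (2ℚ + 2ℚ) * (R * R * (R * R)) * (fromℕ m * ν̂)
      unscaled = ≤-trans (≤-reflexive (trans (eq fail μ D) (trans
        (cong (λ a → fail * (μ * (D * D)) * (a * a)) (sym X*R≡1))
          (eq′ fail μ D X R))))
        (≤-trans (*-monoʳ (R * R) (0≤a² R) raw)
          (≤-reflexive (trans (cong (λ a → (2ℚ + 2ℚ) * (a * (0ℚ + fromℕ m * ν̂)) * (R * R)) r^4k)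
            (eq″ R (fromℕ m * ν̂)))))
        where
        eq : ∀ f μ D → f * μ * (D * D) ≡ f * (μ * (D * D)) * (1ℚ * 1ℚ)
        eq = solve-∀ ring
        eq′ : ∀ f μ D X R → f * (μ * (D * D)) * (X * R * (X * R)) ≡ f * (μ * (D * X * (D * X))) * (R * R)
        eq′ = solve-∀ ring
        eq″ : ∀ R a → (1ℚ + 1ℚ + (1ℚ + 1ℚ)) * (R * R * (0ℚ + a)) * (R * R) ≡ (1ℚ + 1ℚ + (1ℚ + 1ℚ)) *
          (R * R * (R * R)) * a
        eq″ = solve-∀ ring

      q′ n′ c15 : ℚ
      q′  = fromℕ q
      n′  = fromℕ n
      c15 = fromℕ 15

      0≤k : 0ℚ ≤ k
      0≤k = 0≤fromℕ kₙ

      -- This is the gain of a factor `n`. In the first part of `ν̂` it comes from `n * D₃ ≤ 3 q D`,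
      -- which turns 5 into 15; in the second from `n v ≤ N v = r`. The first part is multiplied by
      -- `r ≥ 1` to share that factor, and `D′` cancels afterwards.
      nν̂≤ : n′ * ν̂ ≤ D′ * ((c15 * (k * k * k * q′) + k * k * k * k) * r)
      nν̂≤ = ≤-trans (≤-reflexive (eq n′ k D₃ D v))
        (≤-trans (+-mono-≤ (*-monoˡ (c5 * (k * k * k) * D) (0≤a*b
          (0≤a*b (0≤fromℕ 5) (0≤a*b (0≤a² k) 0≤k)) 0≤D) nD₃≤)
            (*-monoˡ (k * k * k * k * D′) (0≤a*b (0≤a*b (0≤a*b (0≤a² k) 0≤k) 0≤k) (0≤a² D))
              (*-monoʳ v 0≤v (fromℕ-mono n≤N))))
          (≤-by (0≤a*b (0≤a*b (0≤a*b (0≤fromℕ 15) (0≤a*b (0≤a*b (0≤a² k) 0≤k) (0≤fromℕ q))) (0≤a² D))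
            (a≤b⇒0≤b-a 1≤r)) (eq′ k q′ D r)))
        where
        c5 : ℚ
        c5 = fromℕ 5
        nD₃≤ : n′ * D₃ ≤ fromℕ 3 * (q′ * D)
        nD₃≤ = subst₂ _≤_ (fromℕ-* n (between 3 (n ∸ 3) q))
          (trans (fromℕ-* 3 (q ℕ.* between 2 (n ∸ 2) q)) (cong (fromℕ 3 *_) (fromℕ-* q (between 2 (n ∸ 2) q))))
          (fromℕ-mono (codegree-ratio n q 3≤n))
        eq : ∀ n k D₃ D v → n * ((1ℚ + 1ℚ + 1ℚ + 1ℚ + 1ℚ) * (k * k) * (k * D₃) * D + k * k * (k * k) *
          (D * D * v)) ≡
                            (ℤ.+ 5 / 1) * (k * k * k) * D * (n * D₃) + k * k * k * k * (D * D) * (n * v)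
        eq = solve-∀ ring
        eq′ : ∀ k q D r → D * D * (((ℤ.+ 15 / 1) * (k * k * k * q) + k * k * k * k) * r) ≡
          (ℤ.+ 5 / 1) * (k * k * k) * D * ((ℤ.+ 3 / 1) * (q * D)) + k * k * k * k * (D * D) * r +
          (ℤ.+ 15 / 1) * (k * k * k * q) * (D * D) * (r - 1ℚ)
        eq′ = solve-∀ ring

      W : ℚ
      W = c15 * (k * k * k * q′) + k * k * k * k

      0≤W : 0ℚ ≤ W
      0≤W = 0≤a+b (0≤a*b (0≤fromℕ 15) (0≤a*b (0≤a*b (0≤a² k) 0≤k) (0≤fromℕ q))) (0≤a*b (0≤a*b (0≤a² k) 0≤k) 0≤k)

      0<D′ : 0ℚ < D′
      0<D′ = <-≤-trans (positive⁻¹ 1ℚ) (square-mono {1ℚ} 0≤1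
        (fromℕ-mono (between-positive 2 (n ∸ 2) 2≤q (ℕ.≤-trans q≤n (ℕ.m≤n+m∸n n 2)))))

      0≤R⁴ : 0ℚ ≤ (2ℚ + 2ℚ) * (R * R * (R * R))
      0≤R⁴ = 0≤a*b (0≤a+b 0≤2 0≤2) (0≤a*b (0≤a² R) (0≤a² R))

      cancelled : fail * μ * n′ ≤ (2ℚ + 2ℚ) * (R * R * (R * R)) * (fromℕ m * (W * r))
      cancelled = *-cancelʳ-≤-pos D′ {{positive 0<D′}} (≤-trans (≤-reflexive (eq (fail * μ) n′ D′))
        (≤-trans (*-monoʳ n′ (0≤fromℕ n) unscaled)
          (≤-trans (≤-reflexive (eq′ ((2ℚ + 2ℚ) * (R * R * (R * R))) (fromℕ m) ν̂ n′))
            (≤-trans (*-monoˡ ((2ℚ + 2ℚ) * (R * R * (R * R))) 0≤R⁴ (*-monoˡ (fromℕ m) (0≤fromℕ m) nν̂≤))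
              (≤-reflexive (eq″ ((2ℚ + 2ℚ) * (R * R * (R * R))) (fromℕ m) D′ (W * r)))))))
        where
        eq : ∀ a n D → a * n * D ≡ a * D * n
        eq = solve-∀ ring
        eq′ : ∀ c m ν n → c * (m * ν) * n ≡ c * (m * (n * ν))
        eq′ = solve-∀ ring
        eq″ : ∀ c m D W → c * (m * (D * W)) ≡ c * (m * W) * D
        eq″ = solve-∀ ring

      mv≤r : fromℕ m * v ≤ r
      mv≤r = *-monoʳ v 0≤v (fromℕ-mono (ℕ.≤-trans (ℕ.≤-trans (ℕ.≤-reflexive (sym (ℕ.*-identityʳ m)))
        (ℕ.*-monoʳ-≤ m 1≤kₙ))
        (subst (m ℕ.* kₙ ℕ.≤_) M+mk≡N (ℕ.m≤n+m (m ℕ.* kₙ) M))))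

      Γ : ℚ
      Γ = g ^ (2 ℕ.* kₙ)

      fail*n≤ : fail * n′ ≤ (2ℚ + 2ℚ) * (Γ * Γ * (Γ * Γ)) * (g * g) * W
      fail*n≤ = ≤-trans (≤-reflexive (trans (eq fail n′) (trans (cong (fail * n′ *_) (sym μ*v≡1))
        (eq′ fail n′ μ v))))
        (≤-trans (*-monoʳ v 0≤v cancelled)
        (≤-trans (≤-reflexive (eq″ c (fromℕ m) W r v))
        (≤-trans (*-monoˡ (c * W * r) (0≤a*b (0≤a*b 0≤R⁴ 0≤W) 0≤r) mv≤r)
        (≤-trans (≤-reflexive (eq‴ (2ℚ + 2ℚ) (R * R) W r))
        (≤-trans (*-monoˡ ((2ℚ + 2ℚ) * W) (0≤a*b (0≤a+b 0≤2 0≤2) 0≤W)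
            (≤-trans (*-monoʳ (r * r) (0≤a² r) (square-mono (0≤a² R) (square-mono 0≤R R≤Γ)))
              (*-monoˡ (Γ * Γ * (Γ * Γ)) (0≤a² (Γ * Γ)) (square-mono 0≤r r≤g))))
          (≤-reflexive (eq⁗ (2ℚ + 2ℚ) W (Γ * Γ * (Γ * Γ)) (g * g))))))))
        where
        c : ℚ
        c = (2ℚ + 2ℚ) * (R * R * (R * R))
        R≤Γ : R ≤ Γ
        R≤Γ = ^-mono (2 ℕ.* kₙ) 0≤r r≤g
        eq : ∀ f n → f * n ≡ f * n * 1ℚ
        eq = solve-∀ ring
        eq′ : ∀ f n μ v → f * n * (μ * v) ≡ f * μ * n * v
        eq′ = solve-∀ ring
        eq″ : ∀ c m W r v → c * (m * (W * r)) * v ≡ c * W * r * (m * v)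
        eq″ = solve-∀ ring
        eq‴ : ∀ a R W r → a * (R * R) * W * r * r ≡ a * W * (R * R * (r * r))
        eq‴ = solve-∀ ring
        eq⁗ : ∀ a W Γ g → a * W * (Γ * g) ≡ a * Γ * g * W
        eq⁗ = solve-∀ ring

      error : ℕ
      error = 4 ℕ.* (2 ℕ.* h) ℕ.^ (8 ℕ.* kₙ ℕ.+ 2) ℕ.* (15 ℕ.*
        (kₙ ℕ.* kₙ ℕ.* kₙ ℕ.* q) ℕ.+ kₙ ℕ.* kₙ ℕ.* kₙ ℕ.* kₙ)

      fromℕ-error : fromℕ error ≡ (2ℚ + 2ℚ) * (Γ * Γ * (Γ * Γ)) * (g * g) * W
      fromℕ-error = trans (fromℕ-* (4 ℕ.* (2 ℕ.* h) ℕ.^ (8 ℕ.* kₙ ℕ.+ 2))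
        (15 ℕ.* (kₙ ℕ.* kₙ ℕ.* kₙ ℕ.* q) ℕ.+ kₙ ℕ.* kₙ ℕ.* kₙ ℕ.* kₙ)) (cong₂ _*_
        (trans (fromℕ-* 4 ((2 ℕ.* h) ℕ.^ (8 ℕ.* kₙ ℕ.+ 2))) (trans (cong ((2ℚ + 2ℚ) *_) power)
          (sym (*-assoc (2ℚ + 2ℚ) (Γ * Γ * (Γ * Γ)) (g * g)))))
        (trans (fromℕ-+ (15 ℕ.* (kₙ ℕ.* kₙ ℕ.* kₙ ℕ.* q)) (kₙ ℕ.* kₙ ℕ.* kₙ ℕ.* kₙ)) (cong₂ _+_
          (trans (fromℕ-* 15 (kₙ ℕ.* kₙ ℕ.* kₙ ℕ.* q)) (cong (c15 *_)
            (trans (fromℕ-* (kₙ ℕ.* kₙ ℕ.* kₙ) q) (cong (_* q′) cube))))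
          (trans (fromℕ-* (kₙ ℕ.* kₙ ℕ.* kₙ) kₙ) (cong (_* k) cube)))))
        where
        cube : fromℕ (kₙ ℕ.* kₙ ℕ.* kₙ) ≡ k * k * k
        cube = trans (fromℕ-* (kₙ ℕ.* kₙ) kₙ) (cong (_* k) (fromℕ-* kₙ kₙ))
        exponent : ∀ k → 8 ℕ.* k ℕ.+ 2 ≡ 2 ℕ.* k ℕ.+ 2 ℕ.* k ℕ.+ (2 ℕ.* k ℕ.+ 2 ℕ.* k) ℕ.+ 2
        exponent = ℕ.solve-∀
        power : fromℕ ((2 ℕ.* h) ℕ.^ (8 ℕ.* kₙ ℕ.+ 2)) ≡ Γ * Γ * (Γ * Γ) * (g * g)
        power = trans (fromℕ-^ (2 ℕ.* h) (8 ℕ.* kₙ ℕ.+ 2)) (trans (cong (g ^_) (exponent kₙ))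
          (trans (^-homo-* g (2 ℕ.* kₙ ℕ.+ 2 ℕ.* kₙ ℕ.+ (2 ℕ.* kₙ ℕ.+ 2 ℕ.* kₙ)) 2) (cong₂ _*_
            (trans (^-homo-* g (2 ℕ.* kₙ ℕ.+ 2 ℕ.* kₙ) (2 ℕ.* kₙ ℕ.+ 2 ℕ.* kₙ)) (cong₂ _*_ half half))
            (cong (g *_) (*-identityʳ g)))))
          where
          half : g ^ (2 ℕ.* kₙ ℕ.+ 2 ℕ.* kₙ) ≡ Γ * Γ
          half = ^-homo-* g (2 ℕ.* kₙ) (2 ℕ.* kₙ)

    failure*h≤1 : (1ℚ - Pr (linearProcess n q) P?) * fromℕ h ≤ 1ℚ
    failure*h≤1 = *-cancelʳ-≤-pos n′ {{positive (0<fromℕ (ℕ.≤-trans (ℕ.s≤s ℕ.z≤n) 3≤n))}}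
      (≤-trans (≤-reflexive (eq fail (fromℕ h) n′)) (≤-trans (*-monoʳ (fromℕ h) (0≤fromℕ h) fail*n≤)
        (≤-trans (≤-reflexive (trans (cong (_* fromℕ h) (sym fromℕ-error)) (sym (fromℕ-* error h))))
          (≤-trans (fromℕ-mono error≤n) (≤-reflexive (sym (*-identityˡ n′)))))))
      where
      eq : ∀ f h n → f * h * n ≡ f * n * h
      eq = solve-∀ ring

  private
    E : ℚ
    E = edgeBound n q 2≤q

    -- `E` is `N / k` and `δ` is `1 / h`, so multiplying by `h k` turns the claim into the
    -- inequality for which `m` is chosen.
    enough : ∀ m → (h ∸ 1) ℕ.* N ℕ.≤ m ℕ.* (h ℕ.* kₙ) → (1ℚ - δ) * E ≤ fromℕ m
    enough m (hN≤) = *-cancelʳ-≤-pos (fromℕ (h ℕ.* kₙ)) {{positive (0<fromℕ (ℕ.*-mono-≤ 1≤h 1≤kₙ))}}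
      (≤-trans (≤-reflexive (trans (cong ((1ℚ - δ) * E *_) (fromℕ-* h kₙ)) (trans (eq δ E (fromℕ h) k)
        (trans (cong₂ (λ a b → (fromℕ h - a) * b) h*δ≡1 E*k) h-1))))
        (≤-trans (fromℕ-mono hN≤) (≤-reflexive (fromℕ-* m (h ℕ.* kₙ)))))
      where
      eq : ∀ δ E h k → (1ℚ - δ) * E * (h * k) ≡ (h - h * δ) * (E * k)
      eq = solve-∀ ring
      E*k : E * k ≡ fromℕ N
      E*k = *-cancelˡ 2ℚ (trans (eq′ 2ℚ E k) (trans (cong (E *_)
        (trans (sym (fromℕ-* 2 kₙ)) (cong fromℕ (2*between-0-2 q))))
        (trans (/-* (n ℕ.* (n ∸ 1)) (q ℕ.* (q ∸ 1)) {{q[q-1]≢0 2≤q}})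
          (trans (cong fromℕ (sym (2*between-0-2 n))) (fromℕ-* 2 N)))))
        where
        eq′ : ∀ a E k → a * (E * k) ≡ E * (a * k)
        eq′ = solve-∀ ring
        *-cancelˡ : ∀ a {{_ : Positive a}} {b c} → a * b ≡ a * c → b ≡ c
        *-cancelˡ a ab≡ac = ≤-antisym (*-cancelˡ-≤-pos a (≤-reflexive ab≡ac))
          (*-cancelˡ-≤-pos a (≤-reflexive (sym ab≡ac)))
      h-1 : (fromℕ h - 1ℚ) * fromℕ N ≡ fromℕ ((h ∸ 1) ℕ.* N)
      h-1 = trans (cong (_* fromℕ N) (trans (cong (λ a → fromℕ a - 1ℚ) (sym (ℕ.m∸n+n≡m 1≤h)))
        (trans (cong (_- 1ℚ) (fromℕ-+ (h ∸ 1) 1)) (eq′ (fromℕ (h ∸ 1)))))) (sym (fromℕ-* (h ∸ 1) N))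
        where
        eq′ : ∀ a → a + 1ℚ - 1ℚ ≡ a
        eq′ = solve-∀ ring

  linearProcess-failure :
    (1ℚ - Pr (linearProcess n q) (λ H → (1ℚ - δ) * edgeBound n q 2≤q ≤? fromℕ (length H)))
      * fromℕ (2 ℕ.^ s) ≤ 1ℚ
  linearProcess-failure = conclude (choose-steps h kₙ N 1≤h 1≤kₙ 4hk²≤N)
    where
    Enough : List (Subset n) → Set
    Enough H = (1ℚ - δ) * edgeBound n q 2≤q ≤ fromℕ (length H)
    enough? : Decidable Enough
    enough? H = (1ℚ - δ) * edgeBound n q 2≤q ≤? fromℕ (length H)
    conclude : (∃₂ λ m M → M ℕ.+ m ℕ.* kₙ ≡ N × N ℕ.≤ 2 ℕ.* h ℕ.* M ×
                           (h ∸ 1) ℕ.* N ℕ.≤ m ℕ.* (h ℕ.* kₙ) × 2 ℕ.* (kₙ ℕ.* kₙ) ℕ.≤ M) →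
               (1ℚ - Pr (linearProcess n q) enough?) * fromℕ (2 ℕ.^ s) ≤ 1ℚ
    conclude (m , M , M+mk≡N , N≤2hM , hN≤ , 2k²≤M) = failure*h≤1 {Enough} enough? m M M+mk≡N N≤2hM 2k²≤M
      (λ H m≤ → ≤-trans (enough m hN≤) (fromℕ-mono m≤))

-- Passage to the limit

bounded-by-ℕ : ∀ p → ∃ λ a → p ≤ fromℕ a
bounded-by-ℕ p@(mkℚ n d-1 _) = ℤ.∣ n ∣ , toℚᵘ-cancel-≤ (ℚᵘ.≤-respʳ-≃
  (ℚᵘ.≃-sym (toℚᵘ-fromℚᵘ (mkℚᵘ (ℤ.+ ℤ.∣ n ∣) 0)))
  (*≤* (ℤ.≤-trans (ℤ.≤-reflexive (ℤ.*-identityʳ n)) (bound n))))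
  where
  bound : ∀ n → n ℤ.≤ ℤ.+ ℤ.∣ n ∣ ℤ.* ℤ.+ suc d-1
  bound (ℤ.+ m)    = subst (ℤ.+ m ℤ.≤_) (ℤ.pos-* m (suc d-1)) (ℤ.+≤+ (ℕ.m≤m*n m (suc d-1)))
  bound ℤ.-[1+ m ] = subst (ℤ.-[1+ m ] ℤ.≤_) (ℤ.pos-* (suc m) (suc d-1)) ℤ.-≤+

archimedean : ∀ {ε} → 0ℚ < ε → ∃ λ a → 1ℚ < fromℕ a * ε
archimedean {ε} 0<ε with u , εu≡1 , _ ← inverse 0<ε with a , u≤a ← bounded-by-ℕ u =
  suc a , subst (_< fromℕ (suc a) * ε) (trans (*-comm u ε) εu≡1)
    (*-monoˡ-<-pos ε {{positive 0<ε}} (≤-<-trans u≤a (subst (fromℕ a <_) (sym (fromℕ-suc a))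
      (subst (_< 1ℚ + fromℕ a) (+-identityˡ (fromℕ a)) (+-monoˡ-< (fromℕ a) (positive⁻¹ 1ℚ))))))

theorem4 : (q : ℕ → ℕ) (q≥2 : ∀ n → 2 ℕ.≤ q n) → q isLittleO-√log →
    ∃ λ (δ : ℕ → ℚ) →
    (δ ⟶ 0ℚ) ×
    ((λ n → Pr (linearProcess n (q n))
    (λ H → (1ℚ - δ n) * edgeBound n (q n) (q≥2 n) ≤? fromℕ (length H))) ⟶ 1ℚ)
theorem4 q q≥2 q-small = δ , δ→0 , success→1
  where
  instance
    16q²≢0 : ∀ {n} → NonZero (16 ℕ.* (q n ℕ.* q n))
    16q²≢0 {n} = ℕ.m*n≢0 16 (q n ℕ.* q n) {{_}} {{ℕ.>-nonZero
      (ℕ.≤-trans (ℕ.s≤s ℕ.z≤n) (ℕ.*-mono-≤ (q≥2 n) (q≥2 n)))}}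

  -- The largest s with 2^(16 s q²) ≤ n, up to rounding.
  s : ℕ → ℕ
  s n = ⌊log₂ n ⌋ ℕ./ (16 ℕ.* (q n ℕ.* q n))

  instance
    2^s≢0 : ∀ {n} → NonZero (2 ℕ.^ s n)
    2^s≢0 {n} = ℕ.m^n≢0 2 (s n)

  δ : ℕ → ℚ
  δ n = ℤ.+ 1 / 2 ℕ.^ s n

  h*δ≡1 : ∀ n → fromℕ (2 ℕ.^ s n) * δ n ≡ 1ℚ
  h*δ≡1 n = trans (*-comm (fromℕ (2 ℕ.^ s n)) (δ n)) (/-* 1 (2 ℕ.^ s n))

  s→∞ : ∀ a → ∃ λ N → ∀ n → N ℕ.≤ n → a ℕ.≤ s n
  -- The instance `4 * a` of the hypothesis gives `(4 a q)² ≤ log₂ n`, and `16 a² q²` is at least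
  -- `a` times the divisor `16 q²`.
  s→∞ a with N , small ← q-small (4 ℕ.* a) = N , λ n N≤n → ℕ.≤-trans
    (ℕ.≤-reflexive (sym (ℕ.m*n/n≡m a (16 ℕ.* (q n ℕ.* q n)))))
    (ℕ./-monoˡ-≤ (16 ℕ.* (q n ℕ.* q n)) (ℕ.≤-trans (scale a (q n)) (small n N≤n)))
    where
    eq : ∀ b p → 4 ℕ.* suc b ℕ.* p ℕ.* (4 ℕ.* suc b ℕ.* p ℕ.* 1) ≡ suc b ℕ.* (16 ℕ.* (p ℕ.* p)) ℕ.* suc b
    eq = ℕ.solve-∀
    scale : ∀ a p → a ℕ.* (16 ℕ.* (p ℕ.* p)) ℕ.≤ (4 ℕ.* a ℕ.* p) ℕ.^ 2
    scale zero    p = ℕ.z≤n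
    scale (suc b) p = ℕ.≤-trans (ℕ.m≤m*n (suc b ℕ.* (16 ℕ.* (p ℕ.* p))) (suc b)) (ℕ.≤-reflexive (sym (eq b p)))

  -- One threshold serves both limits, because `δ n` and, once `1 ≤ s n`, the failure probability
  -- are at most `1 / 2^(s n)`.
  small : ∀ {ε} → 0ℚ < ε → ∃ λ N → ∀ n → N ℕ.≤ n → 1 ℕ.≤ s n × 1ℚ < fromℕ (2 ℕ.^ s n) * ε
  small {ε} 0<ε = proj₁ large , λ n N≤n →
    ℕ.≤-trans (ℕ.s≤s ℕ.z≤n) (proj₂ large n N≤n) ,
    <-≤-trans (proj₂ (archimedean 0<ε)) (*-monoʳ ε (<⇒≤ 0<ε)
      (fromℕ-mono (ℕ.≤-trans (ℕ.≤-trans (ℕ.n≤1+n a) (proj₂ large n N≤n)) (n≤2^n (s n)))))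
    where
    a : ℕ
    a = proj₁ (archimedean 0<ε)
    large : ∃ λ N → ∀ n → N ℕ.≤ n → suc a ℕ.≤ s n
    large = s→∞ (suc a)

  cancel : ∀ n {x ε} → fromℕ (2 ℕ.^ s n) * x ≤ 1ℚ → 1ℚ < fromℕ (2 ℕ.^ s n) * ε → x < ε
  cancel n hx≤1 1<hε = *-cancelˡ-<-nonNeg (fromℕ (2 ℕ.^ s n)) {{nonNegative (0≤fromℕ (2 ℕ.^ s n))}}
    (≤-<-trans hx≤1 1<hε)

  δ→0 : δ ⟶ 0ℚ
  δ→0 ε 0<ε = proj₁ (small 0<ε) , λ n N≤n → subst (_< ε)
    (sym (trans (cong abs (+-identityʳ (δ n))) (0≤p⇒∣p∣≡p (nonNegative⁻¹ (δ n) {{normalize-nonNeg 1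
      (2 ℕ.^ s n)}}))))
    (cancel n (≤-reflexive (h*δ≡1 n)) (proj₂ (proj₂ (small 0<ε) n N≤n)))

  Enough : ∀ n → List (Subset n) → Set
  Enough n H = (1ℚ - δ n) * edgeBound n (q n) (q≥2 n) ≤ fromℕ (length H)

  enough? : ∀ n → Decidable (Enough n)
  enough? n H = (1ℚ - δ n) * edgeBound n (q n) (q≥2 n) ≤? fromℕ (length H)

  2^≤n : ∀ n → 1 ℕ.≤ s n → 2 ℕ.^ (s n ℕ.* (16 ℕ.* (q n ℕ.* q n))) ℕ.≤ n
  -- `⌊log₂ 0 ⌋` is 0, hence so is `s 0`.
  2^≤n zero    1≤s = contradiction (subst (1 ℕ.≤_) (ℕ.0/n≡0 (16 ℕ.* (q 0 ℕ.* q 0))) 1≤s) λ ()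
  2^≤n (suc n) _ = ℕ.≤-trans (ℕ.^-monoʳ-≤ 2 (ℕ.m/n*n≤m ⌊log₂ suc n ⌋ (16 ℕ.* (q (suc n) ℕ.* q (suc n)))))
    (2^⌊log₂n⌋≤n (suc n) (ℕ.s≤s ℕ.z≤n))

  close-to-1 : ∀ {p ε} → p ≤ 1ℚ → 1ℚ - p < ε → abs (p - 1ℚ) < ε
  close-to-1 {p} {ε} p≤1 1-p<ε = subst (_< ε)
    (sym (trans (cong abs (eq p)) (trans (∣-p∣≡∣p∣ (1ℚ - p)) (0≤p⇒∣p∣≡p (a≤b⇒0≤b-a p≤1))))) 1-p<ε
    where
    eq : ∀ p → p - 1ℚ ≡ - (1ℚ - p)
    eq = solve-∀ ring

  success→1 : (λ n → Pr (linearProcess n (q n)) (enough? n)) ⟶ 1ℚ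
  success→1 ε 0<ε = proj₁ (small 0<ε) , λ n N≤n →
    close-to-1 {Pr (linearProcess n (q n)) (enough? n)} {ε} (Pr≤1 (enough? n) (linearProcess n (q n)))
      (cancel n {1ℚ - Pr (linearProcess n (q n)) (enough? n)} {ε}
        (≤-trans (≤-reflexive (*-comm (fromℕ (2 ℕ.^ s n)) (1ℚ - Pr (linearProcess n (q n)) (enough? n))))
          (linearProcess-failure n (q n) (s n) (q≥2 n) (proj₁ (proj₂ (small 0<ε) n N≤n))
            (2^≤n n (proj₁ (proj₂ (small 0<ε) n N≤n))) (δ n) (h*δ≡1 n)))
        (proj₂ (proj₂ (small 0<ε) n N≤n)))
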